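{- Let $k\ge 2$ and $n$ be integers with $n\ge e^{k2^{k+2}}$. Then $$\left|B_k(n)-D_k\,g_k(n)\,\frac{n^{k-1}}{(k-1)!}\right|\le \frac{707\,n^{k-1}}{\log n}.$$
   Context: $\mathbb{N}$ denotes the positive integers, $p$ always denotes a prime, and $\log$ is the natural logarithm. For positive integers $k,n$ with $k\ge 2$: $B_k(n)$ is the number of tuples $(x_1,\dots,x_k)\in\mathbb{N}^{k}$ with $n=x_1+\cdots+x_k$ and $\gcd(x_i,x_j)=1$ for all $1\le i<j\le k$. $\delta_k(x)=\dfrac{(x-1)^{k}+k(x-1)^{k-1}+(-1)^{k}(k-1)}{x}$. $D_k=\prod_{p}\dfrac{\delta_k(p)}{p^{k-1}}$, the product being over all primes $p$. $g_k(n)=\prod_{p\mid n}\left(1+\dfrac{(-1)^{k-1}(k-1)}{\delta_k(p)}\right)$, the product being over the primes $p$ dividing $n$. -}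

module Defs where

import Algebra.Definitions.RawSemiring
open import Data.Empty using (⊥; ⊥-elim; ⊥-elim-irr)
open import Data.Integer as ℤ using (ℤ; +[1+_]; -[1+_])
import Data.Integer.Properties as ℤₚ
open import Data.List using (List; []; _∷_; length; filter; upTo; cartesianProductWith)
open import Data.Nat as ℕ using (ℕ; zero; suc; NonZero; NonTrivial; z≤n; s≤s; _!)
open import Data.Nat.Divisibility using (_∣_; _∣?_)
open import Data.Nat.GCD using (gcd)
open import Data.Nat.Primality using (Prime; prime?; ¬prime[0]; ¬prime[1]; prime⇒nonZero; prime⇒nonTrivial)
import Data.Nat.Properties as ℕₚ
import Data.Nat.Tactic.RingSolver as ℕRing
open import Data.Product using (Σ; ∃; _×_; _,_; proj₁; proj₂)
open import Data.Rational
  using (ℚ; mkℚ; 0ℚ; 1ℚ; ½; _+_; _-_; -_; _*_; 1/_; _÷_; ∣_∣; _≤_; _<_; *≤*; Positive; NonNegative; positive; nonNegative; ↧ₙ_; toℚᵘ)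
import Data.Rational as ℚ
open import Data.Rational.Literals using (fromℤ)
open import Data.Rational.Properties
open import Data.Rational.Solver using (module +-*-Solver)
import Data.Rational.Unnormalised as ℚᵘ
import Data.Rational.Unnormalised.Properties as ℚᵘₚ
open import Data.Sum using (inj₁; inj₂)
open import Data.Vec as Vec using (Vec; []; _∷_)
open import Data.Vec.Relation.Unary.All as All using (All)
open import Data.Vec.Relation.Unary.AllPairs using (AllPairs; allPairs?)
open import Function using (_∘_)
open import Level using (0ℓ)
open import Relation.Binary.PropositionalEquality
open import Relation.Nullary using (¬_; Dec; yes; no)
open import Relation.Nullary.Decidable using (_×-dec_; from-no)
open import Relation.Unary using (Pred; Decidable)

open Algebra.Definitions.RawSemiring ℚ.+-*-rawSemiring public using (_^_)

open +-*-Solver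

fromℕ : ℕ → ℚ
fromℕ n = fromℤ (ℤ.+ n)

fromℕ-+ : ∀ a b → fromℕ (a ℕ.+ b) ≡ fromℕ a + fromℕ b
fromℕ-+ a b = toℚᵘ-injective (ℚᵘₚ.≃-trans lem (ℚᵘₚ.≃-sym (toℚᵘ-homo-+ (fromℕ a) (fromℕ b))))
  where
  lem : toℚᵘ (fromℕ (a ℕ.+ b)) ℚᵘ.≃ toℚᵘ (fromℕ a) ℚᵘ.+ toℚᵘ (fromℕ b)
  lem = ℚᵘ.*≡* (cong (ℤ._* ℤ.+ 1) (trans (ℤₚ.pos-+ a b)
          (sym (cong₂ ℤ._+_ (ℤₚ.*-identityʳ (ℤ.+ a)) (ℤₚ.*-identityʳ (ℤ.+ b))))))

fromℕ-* : ∀ a b → fromℕ (a ℕ.* b) ≡ fromℕ a * fromℕ b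
fromℕ-* a b = toℚᵘ-injective (ℚᵘₚ.≃-trans lem (ℚᵘₚ.≃-sym (toℚᵘ-homo-* (fromℕ a) (fromℕ b))))
  where
  lem : toℚᵘ (fromℕ (a ℕ.* b)) ℚᵘ.≃ toℚᵘ (fromℕ a) ℚᵘ.* toℚᵘ (fromℕ b)
  lem = ℚᵘ.*≡* (cong (ℤ._* ℤ.+ 1) (ℤₚ.pos-* a b))

fromℕ-^ : ∀ a n → fromℕ (a ℕ.^ n) ≡ fromℕ a ^ n
fromℕ-^ a zero    = refl
fromℕ-^ a (suc n) = trans (fromℕ-* a (a ℕ.^ n)) (cong (fromℕ a *_) (fromℕ-^ a n))

fromℕ-≤ : ∀ {a b} → a ℕ.≤ b → fromℕ a ≤ fromℕ b
fromℕ-≤ a≤b = *≤* (ℤₚ.*-monoʳ-≤-nonNeg (ℤ.+ 1) (ℤ.+≤+ a≤b))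

fromℕ-nonNeg : ∀ n → NonNegative (fromℕ n)
fromℕ-nonNeg n = nonNegative (fromℕ-≤ z≤n)

fromℕ-suc : ∀ n → fromℕ (suc n) ≡ 1ℚ + fromℕ n
fromℕ-suc n = fromℕ-+ 1 n

p≤r∧-p≤r⇒∣p∣≤r : ∀ {p r} → p ≤ r → - p ≤ r → ∣ p ∣ ≤ r
p≤r∧-p≤r⇒∣p∣≤r {p} p≤r -p≤r with ∣p∣≡p∨∣p∣≡-p p
... | inj₁ eq rewrite eq = p≤r
... | inj₂ eq rewrite eq = -p≤r

p≤∣p∣ : ∀ p → p ≤ ∣ p ∣
p≤∣p∣ p with ≤-total 0ℚ p
... | inj₁ 0≤p = ≤-reflexive (sym (0≤p⇒∣p∣≡p 0≤p))
... | inj₂ p≤0 = ≤-trans p≤0 (0≤∣p∣ p)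

∣p-q∣≡∣q-p∣ : ∀ p q → ∣ p - q ∣ ≡ ∣ q - p ∣
∣p-q∣≡∣q-p∣ p q = trans (sym (∣-p∣≡∣p∣ (p - q)))
  (cong ∣_∣ (solve 2 (λ p q → :- (p :- q) := q :- p) refl p q))

∣p∣≤∣p-q∣+∣q∣ : ∀ p q → ∣ p ∣ ≤ ∣ p - q ∣ + ∣ q ∣
∣p∣≤∣p-q∣+∣q∣ p q = subst (λ t → ∣ t ∣ ≤ ∣ p - q ∣ + ∣ q ∣)
  (solve 2 (λ p q → (p :- q) :+ q := p) refl p q) (∣p+q∣≤∣p∣+∣q∣ (p - q) q)

p≤r+q⇒p-q≤r : ∀ {p q r} → p ≤ r + q → p - q ≤ r
p≤r+q⇒p-q≤r {p} {q} {r} h = subst (p - q ≤_)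
  (solve 2 (λ r q → (r :+ q) :- q := r) refl r q) (+-monoˡ-≤ (- q) h)

∣∣p∣-∣q∣∣≤∣p-q∣ : ∀ p q → ∣ ∣ p ∣ - ∣ q ∣ ∣ ≤ ∣ p - q ∣
∣∣p∣-∣q∣∣≤∣p-q∣ p q = p≤r∧-p≤r⇒∣p∣≤r
  (p≤r+q⇒p-q≤r (∣p∣≤∣p-q∣+∣q∣ p q))
  (subst₂ _≤_ (solve 2 (λ a b → b :- a := :- (a :- b)) refl ∣ p ∣ ∣ q ∣) (∣p-q∣≡∣q-p∣ q p)
    (p≤r+q⇒p-q≤r (∣p∣≤∣p-q∣+∣q∣ q p)))

½-pos : ∀ {ε} → 0ℚ < ε → 0ℚ < ½ * ε
½-pos {ε} ε>0 = positive⁻¹ (½ * ε) {{pos*pos⇒pos ½ ε {{positive ε>0}}}}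

½+½ : ∀ ε → ½ * ε + ½ * ε ≡ ε
½+½ ε = solve 1 (λ e → con ½ :* e :+ con ½ :* e := e) refl ε

shrink : ∀ M → 0ℚ < M → ∀ ε → 0ℚ < ε → ∃ λ δ → 0ℚ < δ × M * δ ≡ ε
shrink M M>0 ε ε>0 = 1/M * ε , positive⁻¹ (1/M * ε) {{pos*pos⇒pos 1/M {{1/pos⇒pos M}} ε {{positive ε>0}}}} ,
    trans (sym (*-assoc M 1/M ε)) (trans (cong (_* ε) (*-inverseʳ M)) (*-identityˡ ε))
  where
  instance
    M⁺ : Positive M
    M⁺ = positive M>0
    M≢0 : ℚ.NonZero M
    M≢0 = pos⇒nonZero M
  1/M = 1/ M

archimedean : ∀ C ε → 0ℚ < ε → ∃ λ N → fromℕ C ≤ ε * fromℕ (suc N)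
archimedean C ε@(mkℚ +[1+ n ] d _) _ = C ℕ.* suc d ,
    toℚᵘ-cancel-≤ (ℚᵘₚ.≤-respʳ-≃ (ℚᵘₚ.≃-sym (toℚᵘ-homo-* ε (fromℕ (suc (C ℕ.* suc d)))))
      (ℚᵘ.*≤* (ℤₚ.≤-trans (ℤₚ.≤-reflexive (sym (ℤₚ.pos-* C (suc (d ℕ.* 1))))) (ℤ.+≤+ bound))))
  where
  bound : C ℕ.* suc (d ℕ.* 1) ℕ.≤ (suc n ℕ.* suc (C ℕ.* suc d)) ℕ.* 1
  bound rewrite ℕₚ.*-identityʳ d | ℕₚ.*-identityʳ (suc n ℕ.* suc (C ℕ.* suc d)) =
    ℕₚ.≤-trans (ℕₚ.n≤1+n _) (ℕₚ.m≤n*m _ (suc n))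
archimedean C (mkℚ (ℤ.+ 0) d _) (ℚ.*<* (ℤ.+<+ ()))
archimedean C (mkℚ -[1+ n ] d _) (ℚ.*<* ())

IsCauchy : (ℕ → ℚ) → Set
IsCauchy a = ∀ ε → 0ℚ < ε → ∃ λ N → ∀ m n → N ℕ.≤ m → N ℕ.≤ n → ∣ a m - a n ∣ ≤ ε

-- The real field is built here as Cauchy sequences of rationals; equality is
-- not needed, and the two order relations below are the usual ones, which
-- respect the identification of co-convergent sequences.
record ℝ : Set where
  constructor mkℝ
  field
    seq      : ℕ → ℚ
    isCauchy : IsCauchy seq

open ℝ public

infix 4 _≤ℝ_ _<ℝ_

_≤ℝ_ : ℝ → ℝ → Set
x ≤ℝ y = ∀ ε → 0ℚ < ε → ∃ λ N → ∀ n → N ℕ.≤ n → seq x n ≤ seq y n + ε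

_<ℝ_ : ℝ → ℝ → Set
x <ℝ y = ∃ λ ε → 0ℚ < ε × ∃ λ N → ∀ n → N ℕ.≤ n → seq x n + ε ≤ seq y n

cauchy-const : ∀ q → IsCauchy (λ _ → q)
cauchy-const q ε ε>0 = 0 , λ _ _ _ _ → subst (λ t → ∣ t ∣ ≤ ε) (sym (+-inverseʳ q)) (<⇒≤ ε>0)

cauchy-tail : ∀ a → (∀ ε → 0ℚ < ε → ∃ λ N → ∀ n → N ℕ.≤ n → ∣ a n - a N ∣ ≤ ε) → IsCauchy a
cauchy-tail a h ε ε>0 with h (½ * ε) (½-pos ε>0)
... | N , bound = N , λ m n N≤m N≤n → begin
  ∣ a m - a n ∣                   ≡⟨ cong ∣_∣ (solve 3 (λ x y z → x :- y := (x :- z) :- (y :- z)) refl (a m) (a n) (a N)) ⟩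
  ∣ (a m - a N) - (a n - a N) ∣   ≤⟨ ∣p-q∣≤∣p∣+∣q∣ (a m - a N) (a n - a N) ⟩
  ∣ a m - a N ∣ + ∣ a n - a N ∣   ≤⟨ +-mono-≤ (bound m N≤m) (bound n N≤n) ⟩
  ½ * ε + ½ * ε                   ≡⟨ ½+½ ε ⟩
  ε                               ∎
  where open ≤-Reasoning

cauchy-sub : ∀ {a b} → IsCauchy a → IsCauchy b → IsCauchy (λ n → a n - b n)
cauchy-sub {a} {b} ca cb ε ε>0 with ca (½ * ε) (½-pos ε>0) | cb (½ * ε) (½-pos ε>0)
... | N₁ , h₁ | N₂ , h₂ = N₁ ℕ.⊔ N₂ , λ m n N≤m N≤n → begin
  ∣ (a m - b m) - (a n - b n) ∣   ≡⟨ cong ∣_∣ (solve 4 (λ x y z w → (x :- y) :- (z :- w) := (x :- z) :- (y :- w)) refl (a m) (b m) (a n) (b n)) ⟩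
  ∣ (a m - a n) - (b m - b n) ∣   ≤⟨ ∣p-q∣≤∣p∣+∣q∣ (a m - a n) (b m - b n) ⟩
  ∣ a m - a n ∣ + ∣ b m - b n ∣   ≤⟨ +-mono-≤ (h₁ m n (ℕₚ.m⊔n≤o⇒m≤o N₁ N₂ N≤m) (ℕₚ.m⊔n≤o⇒m≤o N₁ N₂ N≤n))
                                              (h₂ m n (ℕₚ.m⊔n≤o⇒n≤o N₁ N₂ N≤m) (ℕₚ.m⊔n≤o⇒n≤o N₁ N₂ N≤n)) ⟩
  ½ * ε + ½ * ε                   ≡⟨ ½+½ ε ⟩
  ε                               ∎
  where open ≤-Reasoning

cauchy-abs : ∀ {a} → IsCauchy a → IsCauchy (λ n → ∣ a n ∣)
cauchy-abs {a} ca ε ε>0 with ca ε ε>0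
... | N , h = N , λ m n N≤m N≤n → ≤-trans (∣∣p∣-∣q∣∣≤∣p-q∣ (a m) (a n)) (h m n N≤m N≤n)

cauchy-bounded : ∀ {a} → IsCauchy a → ∃ λ N → ∃ λ M → 0ℚ < M × (∀ n → N ℕ.≤ n → ∣ a n ∣ ≤ M)
cauchy-bounded {a} ca with ca 1ℚ (positive⁻¹ 1ℚ)
... | N , h = N , 1ℚ + ∣ a N ∣
  , positive⁻¹ (1ℚ + ∣ a N ∣) {{pos+nonNeg⇒pos 1ℚ ∣ a N ∣ {{∣-∣-nonNeg (a N)}}}}
  , λ n N≤n → ≤-trans (∣p∣≤∣p-q∣+∣q∣ (a n) (a N)) (+-monoˡ-≤ ∣ a N ∣ (h n N N≤n ℕₚ.≤-refl))

∣*∣-mono : ∀ {p q r s} → ∣ p ∣ ≤ r → ∣ q ∣ ≤ s → ∣ p * q ∣ ≤ r * s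
∣*∣-mono {p} {q} {r} {s} p≤r q≤s = begin
  ∣ p * q ∣     ≡⟨ ∣p*q∣≡∣p∣*∣q∣ p q ⟩
  ∣ p ∣ * ∣ q ∣ ≤⟨ *-monoʳ-≤-nonNeg ∣ q ∣ {{∣-∣-nonNeg q}} p≤r ⟩
  r * ∣ q ∣     ≤⟨ *-monoˡ-≤-nonNeg r {{nonNegative (≤-trans (0≤∣p∣ p) p≤r)}} q≤s ⟩
  r * s         ∎
  where open ≤-Reasoning

mul-bound : ∀ x y z w {A B α β} → ∣ x ∣ ≤ A → ∣ y - w ∣ ≤ α → ∣ w ∣ ≤ B → ∣ x - z ∣ ≤ β →
            ∣ x * y - z * w ∣ ≤ A * α + B * β
mul-bound x y z w {A} {B} {α} {β} hA hα hB hβ = begin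
  ∣ x * y - z * w ∣
    ≡⟨ cong ∣_∣ (solve 4 (λ x y z w → x :* y :- z :* w := x :* (y :- w) :+ w :* (x :- z)) refl x y z w) ⟩
  ∣ x * (y - w) + w * (x - z) ∣
    ≤⟨ ∣p+q∣≤∣p∣+∣q∣ (x * (y - w)) (w * (x - z)) ⟩
  ∣ x * (y - w) ∣ + ∣ w * (x - z) ∣
    ≤⟨ +-mono-≤ (∣*∣-mono {x} {y - w} hA hα) (∣*∣-mono {w} {x - z} hB hβ) ⟩
  A * α + B * β ∎
  where open ≤-Reasoning

⊔≤₁ : ∀ a b c {n} → (a ℕ.⊔ b) ℕ.⊔ c ℕ.≤ n → a ℕ.≤ n
⊔≤₁ a b c h = ℕₚ.m⊔n≤o⇒m≤o a b (ℕₚ.m⊔n≤o⇒m≤o (a ℕ.⊔ b) c h)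
⊔≤₂ : ∀ a b c {n} → (a ℕ.⊔ b) ℕ.⊔ c ℕ.≤ n → b ℕ.≤ n
⊔≤₂ a b c h = ℕₚ.m⊔n≤o⇒n≤o a b (ℕₚ.m⊔n≤o⇒m≤o (a ℕ.⊔ b) c h)
⊔≤₃ : ∀ a b c {n} → a ℕ.⊔ (b ℕ.⊔ c) ℕ.≤ n → b ℕ.≤ n
⊔≤₃ a b c h = ℕₚ.m⊔n≤o⇒m≤o b c (ℕₚ.m⊔n≤o⇒n≤o a (b ℕ.⊔ c) h)
⊔≤₄ : ∀ a b c {n} → a ℕ.⊔ (b ℕ.⊔ c) ℕ.≤ n → c ℕ.≤ n
⊔≤₄ a b c h = ℕₚ.m⊔n≤o⇒n≤o b c (ℕₚ.m⊔n≤o⇒n≤o a (b ℕ.⊔ c) h)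

cauchy-mul : ∀ {a b} → IsCauchy a → IsCauchy b → IsCauchy (λ n → a n * b n)
cauchy-mul {a} {b} ca cb ε ε>0 =
  let (N₁ , A , A>0 , hA) = cauchy-bounded {a} ca
      (N₂ , B , B>0 , hB) = cauchy-bounded {b} cb
      (α , α>0 , Aα) = shrink A A>0 (½ * ε) (½-pos ε>0)
      (β , β>0 , Bβ) = shrink B B>0 (½ * ε) (½-pos ε>0)
      (N₃ , h₃) = cb α α>0
      (N₄ , h₄) = ca β β>0
  in (N₁ ℕ.⊔ N₂) ℕ.⊔ (N₃ ℕ.⊔ N₄) , λ m n N≤m N≤n →
     subst (∣ a m * b m - a n * b n ∣ ≤_) (trans (cong₂ _+_ Aα Bβ) (½+½ ε))
       (mul-bound (a m) (b m) (a n) (b n)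
         (hA m (⊔≤₁ N₁ N₂ _ N≤m)) (h₃ m n (⊔≤₃ (N₁ ℕ.⊔ N₂) N₃ N₄ N≤m) (⊔≤₃ (N₁ ℕ.⊔ N₂) N₃ N₄ N≤n))
         (hB n (⊔≤₂ N₁ N₂ _ N≤n)) (h₄ m n (⊔≤₄ (N₁ ℕ.⊔ N₂) N₃ N₄ N≤m) (⊔≤₄ (N₁ ℕ.⊔ N₂) N₃ N₄ N≤n)))

-- The value at 0 is never seen by recipℝ in the limit: a positive real has only
-- finitely many terms that are not positive.
recip : ℚ → ℚ
recip q with q ≟ 0ℚ
... | yes _  = 0ℚ
... | no q≢0 = (1/ q) {{ℚ.≢-nonZero q≢0}}

recip-inverse : ∀ q → 0ℚ < q → q * recip q ≡ 1ℚ
recip-inverse q q>0 with q ≟ 0ℚ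
... | yes refl = ⊥-elim (<-irrefl refl q>0)
... | no q≢0   = *-inverseʳ q {{ℚ.≢-nonZero q≢0}}

cauchy-recip : ∀ {a} → IsCauchy a → ∀ c → 0ℚ < c → ∀ N → (∀ n → N ℕ.≤ n → c ≤ a n) →
               IsCauchy (recip ∘ a)
cauchy-recip {a} ca c c>0 N₁ c≤a ε ε>0 with ca (ε * (c * c)) εcc>0
  where
  εcc>0 : 0ℚ < ε * (c * c)
  εcc>0 = positive⁻¹ (ε * (c * c)) {{pos*pos⇒pos ε {{positive ε>0}} (c * c) {{pos*pos⇒pos c {{positive c>0}} c {{positive c>0}}}}}}
... | N₂ , h = N₁ ℕ.⊔ N₂ , λ m n N≤m N≤n →
      bound (a m) (a n) (c≤a m (ℕₚ.m⊔n≤o⇒m≤o N₁ N₂ N≤m)) (c≤a n (ℕₚ.m⊔n≤o⇒m≤o N₁ N₂ N≤n))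
            (h m n (ℕₚ.m⊔n≤o⇒n≤o N₁ N₂ N≤m) (ℕₚ.m⊔n≤o⇒n≤o N₁ N₂ N≤n))
  where
  open ≤-Reasoning
  bound : ∀ p q → c ≤ p → c ≤ q → ∣ p - q ∣ ≤ ε * (c * c) → ∣ recip p - recip q ∣ ≤ ε
  bound p q c≤p c≤q pq = *-cancelʳ-≤-pos (p * q) {{pos*pos⇒pos p {{positive p>0}} q {{positive q>0}}}} (begin
    ∣ recip p - recip q ∣ * (p * q)        ≡⟨ cong (∣ recip p - recip q ∣ *_) (sym (0≤p⇒∣p∣≡p (<⇒≤ pq>0))) ⟩
    ∣ recip p - recip q ∣ * ∣ p * q ∣      ≡⟨ sym (∣p*q∣≡∣p∣*∣q∣ (recip p - recip q) (p * q)) ⟩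
    ∣ (recip p - recip q) * (p * q) ∣      ≡⟨ cong ∣_∣ (solve 4 (λ p q r s → (r :- s) :* (p :* q) := (p :* r) :* q :- (q :* s) :* p) refl p q (recip p) (recip q)) ⟩
    ∣ (p * recip p) * q - (q * recip q) * p ∣ ≡⟨ cong₂ (λ s t → ∣ s * q - t * p ∣) (recip-inverse p p>0) (recip-inverse q q>0) ⟩
    ∣ 1ℚ * q - 1ℚ * p ∣                    ≡⟨ cong₂ (λ s t → ∣ s - t ∣) (*-identityˡ q) (*-identityˡ p) ⟩
    ∣ q - p ∣                              ≡⟨ ∣p-q∣≡∣q-p∣ q p ⟩
    ∣ p - q ∣                              ≤⟨ pq ⟩
    ε * (c * c)                            ≤⟨ *-monoˡ-≤-nonNeg ε {{nonNegative (<⇒≤ ε>0)}} cc≤pq ⟩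
    ε * (p * q)                            ∎)
    where
    p>0 : 0ℚ < p
    p>0 = <-≤-trans c>0 c≤p
    q>0 : 0ℚ < q
    q>0 = <-≤-trans c>0 c≤q
    pq>0 : 0ℚ < p * q
    pq>0 = positive⁻¹ (p * q) {{pos*pos⇒pos p {{positive p>0}} q {{positive q>0}}}}
    cc≤pq : c * c ≤ p * q
    cc≤pq = ≤-trans (*-monoʳ-≤-nonNeg c {{nonNegative (<⇒≤ c>0)}} c≤p)
                    (*-monoˡ-≤-nonNeg p {{nonNegative (<⇒≤ p>0)}} c≤q)

infixl 6 _-ℝ_
infixl 7 _*ℝ_ _÷ℝ_
infixr 8 _^ℝ_

fromℚ : ℚ → ℝ
fromℚ q = mkℝ (λ _ → q) (cauchy-const q)

0ℝ 1ℝ : ℝ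
0ℝ = fromℚ 0ℚ
1ℝ = fromℚ 1ℚ

_-ℝ_ : ℝ → ℝ → ℝ
x -ℝ y = mkℝ (λ n → seq x n - seq y n) (cauchy-sub {seq x} {seq y} (isCauchy x) (isCauchy y))

_*ℝ_ : ℝ → ℝ → ℝ
x *ℝ y = mkℝ (λ n → seq x n * seq y n) (cauchy-mul {seq x} {seq y} (isCauchy x) (isCauchy y))

∣_∣ℝ : ℝ → ℝ
∣ x ∣ℝ = mkℝ (λ n → ∣ seq x n ∣) (cauchy-abs {seq x} (isCauchy x))

_^ℝ_ : ℝ → ℕ → ℝ
x ^ℝ zero  = 1ℝ
x ^ℝ suc n = x *ℝ x ^ℝ n

recipℝ : (x : ℝ) → {{0ℝ <ℝ x}} → ℝ
recipℝ x {{ c , c>0 , N , h }} = mkℝ (recip ∘ seq x)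
  (cauchy-recip {seq x} (isCauchy x) c c>0 N (λ n N≤n → subst (_≤ seq x n) (+-identityˡ c) (h n N≤n)))

_÷ℝ_ : (x y : ℝ) → {{0ℝ <ℝ y}} → ℝ
x ÷ℝ y = x *ℝ recipℝ y

-- A sequence whose j-th step is at most C/((j+1)(j+2)) is Cauchy.
module Steps (a : ℕ → ℚ) (C : ℕ)
             (step : ∀ j → ∣ a (suc j) - a j ∣ * fromℕ (suc j ℕ.* suc (suc j)) ≤ fromℕ C) where

  open ≤-Reasoning

  w : ℕ → ℚ
  w j = 1/ fromℕ (suc j)

  w-step : ∀ j → (w j - w (suc j)) * fromℕ (suc j ℕ.* suc (suc j)) ≡ 1ℚ
  w-step j = begin-equality
    (w j - w (suc j)) * fromℕ (suc j ℕ.* suc (suc j))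
      ≡⟨ cong ((w j - w (suc j)) *_) (fromℕ-* (suc j) (suc (suc j))) ⟩
    (w j - w (suc j)) * (A * B)
      ≡⟨ solve 4 (λ u v A B → (u :- v) :* (A :* B) := (u :* A) :* B :- (v :* B) :* A) refl (w j) (w (suc j)) A B ⟩
    (w j * A) * B - (w (suc j) * B) * A
      ≡⟨ cong₂ (λ s t → s * B - t * A) (*-inverseˡ A) (*-inverseˡ B) ⟩
    1ℚ * B - 1ℚ * A
      ≡⟨ cong (λ t → 1ℚ * t - 1ℚ * A) (fromℕ-suc (suc j)) ⟩
    1ℚ * (1ℚ + A) - 1ℚ * A
      ≡⟨ solve 1 (λ A → con 1ℚ :* (con 1ℚ :+ A) :- con 1ℚ :* A := con 1ℚ) refl A ⟩
    1ℚ ∎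
    where
    A = fromℕ (suc j)
    B = fromℕ (suc (suc j))

  step′ : ∀ j → ∣ a (suc j) - a j ∣ ≤ fromℕ C * (w j - w (suc j))
  step′ j = *-cancelʳ-≤-pos (fromℕ (suc j ℕ.* suc (suc j))) (begin
    ∣ a (suc j) - a j ∣ * D             ≤⟨ step j ⟩
    fromℕ C                             ≡⟨ sym (*-identityʳ (fromℕ C)) ⟩
    fromℕ C * 1ℚ                        ≡⟨ cong (fromℕ C *_) (sym (w-step j)) ⟩
    fromℕ C * ((w j - w (suc j)) * D)   ≡⟨ sym (*-assoc (fromℕ C) (w j - w (suc j)) D) ⟩
    fromℕ C * (w j - w (suc j)) * D     ∎)
    where D = fromℕ (suc j ℕ.* suc (suc j))

  telescope : ∀ i d → ∣ a (d ℕ.+ i) - a i ∣ ≤ fromℕ C * (w i - w (d ℕ.+ i))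
  telescope i zero = begin
    ∣ a i - a i ∣          ≡⟨ cong ∣_∣ (+-inverseʳ (a i)) ⟩
    0ℚ                     ≡⟨ sym (*-zeroʳ (fromℕ C)) ⟩
    fromℕ C * 0ℚ           ≡⟨ cong (fromℕ C *_) (sym (+-inverseʳ (w i))) ⟩
    fromℕ C * (w i - w i)  ∎
  telescope i (suc d) = begin
    ∣ a (suc e) - a i ∣
      ≡⟨ cong ∣_∣ (solve 3 (λ x y z → x :- z := (x :- y) :+ (y :- z)) refl (a (suc e)) (a e) (a i)) ⟩
    ∣ (a (suc e) - a e) + (a e - a i) ∣
      ≤⟨ ∣p+q∣≤∣p∣+∣q∣ (a (suc e) - a e) (a e - a i) ⟩
    ∣ a (suc e) - a e ∣ + ∣ a e - a i ∣
      ≤⟨ +-mono-≤ (step′ e) (telescope i d) ⟩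
    fromℕ C * (w e - w (suc e)) + fromℕ C * (w i - w e)
      ≡⟨ solve 4 (λ c x y z → c :* (y :- x) :+ c :* (z :- y) := c :* (z :- x)) refl (fromℕ C) (w (suc e)) (w e) (w i) ⟩
    fromℕ C * (w i - w (suc e)) ∎
    where e = d ℕ.+ i

  cauchy-steps : IsCauchy a
  cauchy-steps = cauchy-tail a bound
    where
    bound : ∀ ε → 0ℚ < ε → ∃ λ N → ∀ n → N ℕ.≤ n → ∣ a n - a N ∣ ≤ ε
    bound ε ε>0 with archimedean C ε ε>0
    ... | N , C≤εN = N , λ n N≤n → subst (λ t → ∣ a t - a N ∣ ≤ ε) (ℕₚ.m∸n+n≡m N≤n) (begin
      ∣ a (n ℕ.∸ N ℕ.+ N) - a N ∣           ≤⟨ telescope N (n ℕ.∸ N) ⟩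
      fromℕ C * (w N - w (n ℕ.∸ N ℕ.+ N))   ≤⟨ *-monoˡ-≤-nonNeg (fromℕ C) {{fromℕ-nonNeg C}} (p-w≤p (w N) (n ℕ.∸ N ℕ.+ N)) ⟩
      fromℕ C * w N                         ≤⟨ *-monoʳ-≤-nonNeg (w N) C≤εN ⟩
      ε * fromℕ (suc N) * w N               ≡⟨ *-assoc ε (fromℕ (suc N)) (w N) ⟩
      ε * (fromℕ (suc N) * w N)             ≡⟨ cong (ε *_) (*-inverseʳ (fromℕ (suc N))) ⟩
      ε * 1ℚ                                ≡⟨ *-identityʳ ε ⟩
      ε                                     ∎)
      where
      p-w≤p : ∀ p j → p - w j ≤ p
      p-w≤p p j = subst (p - w j ≤_) (+-identityʳ p) (+-monoʳ-≤ p (neg-antimono-≤ (nonNegative⁻¹ (w j))))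

open Steps using (cauchy-steps)

Σ< : ℕ → (ℕ → ℚ) → ℚ
Σ< zero    f = 0ℚ
Σ< (suc n) f = Σ< n f + f n

series-cauchy : ∀ (f : ℕ → ℚ) C → (∀ j → ∣ f j ∣ * fromℕ (suc j ℕ.* suc (suc j)) ≤ fromℕ C) →
                IsCauchy (λ n → Σ< n f)
series-cauchy f C h = cauchy-steps (λ n → Σ< n f) C (λ j →
  subst (λ t → ∣ t ∣ * fromℕ (suc j ℕ.* suc (suc j)) ≤ fromℕ C)
    (sym (solve 2 (λ s t → (s :+ t) :- s := t) refl (Σ< j f) (f j))) (h j))

Σ<-mono : ∀ f → (∀ j → 0ℚ ≤ f j) → ∀ {m n} → m ℕ.≤ n → Σ< m f ≤ Σ< n f
Σ<-mono f f≥0 {m} m≤n = go (ℕₚ.≤⇒≤′ m≤n)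
  where
  go : ∀ {n} → m ℕ.≤′ n → Σ< m f ≤ Σ< n f
  go ℕ.≤′-refl = ≤-refl
  go (ℕ.≤′-step {n} m≤n) = ≤-trans (go m≤n)
    (subst (_≤ Σ< n f + f n) (+-identityʳ (Σ< n f)) (+-monoʳ-≤ (Σ< n f) (f≥0 n)))

0≤* : ∀ {p q} → 0ℚ ≤ p → 0ℚ ≤ q → 0ℚ ≤ p * q
0≤* {p} {q} p≥0 q≥0 = nonNegative⁻¹ (p * q) {{nonNeg*nonNeg⇒nonNeg p {{nonNegative p≥0}} q {{nonNegative q≥0}}}}

0<* : ∀ {p q} → 0ℚ < p → 0ℚ < q → 0ℚ < p * q
0<* {p} {q} p>0 q>0 = positive⁻¹ (p * q) {{pos*pos⇒pos p {{positive p>0}} q {{positive q>0}}}}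

0≤^ : ∀ {p} n → 0ℚ ≤ p → 0ℚ ≤ p ^ n
0≤^ zero    p≥0 = nonNegative⁻¹ 1ℚ
0≤^ (suc n) p≥0 = 0≤* p≥0 (0≤^ n p≥0)

fromℕ-pos : ∀ n → .{{NonZero n}} → Positive (fromℕ n)
fromℕ-pos (suc n) = _

fromℕ-mono-1/ : ∀ n .{{_ : NonZero n}} {X C} → X ℕ.≤ C ℕ.* n → 1/ fromℕ n * fromℕ X ≤ fromℕ C
fromℕ-mono-1/ n {X} {C} h = *-cancelʳ-≤-pos (fromℕ n) {{fromℕ-pos n}} (begin
  1/ fromℕ n * fromℕ X * fromℕ n     ≡⟨ solve 3 (λ i x n → i :* x :* n := (i :* n) :* x) refl (1/ fromℕ n) (fromℕ X) (fromℕ n) ⟩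
  (1/ fromℕ n * fromℕ n) * fromℕ X   ≡⟨ cong (_* fromℕ X) (*-inverseˡ (fromℕ n)) ⟩
  1ℚ * fromℕ X                       ≡⟨ *-identityˡ (fromℕ X) ⟩
  fromℕ X                            ≤⟨ fromℕ-≤ h ⟩
  fromℕ (C ℕ.* n)                    ≡⟨ fromℕ-* C n ⟩
  fromℕ C * fromℕ n                  ∎)
  where open ≤-Reasoning

1/fromℕ-nonNeg : ∀ n .{{_ : NonZero n}} → 0ℚ ≤ 1/ fromℕ n
1/fromℕ-nonNeg (suc n) = nonNegative⁻¹ (1/ fromℕ (suc n))

e-term : ℕ → ℚ
e-term i = (1/ fromℕ (i !)) {{ℕₚ._!≢0 i}}

e-term≥0 : ∀ i → 0ℚ ≤ e-term i
e-term≥0 i = 1/fromℕ-nonNeg (i !) {{ℕₚ._!≢0 i}}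

[j+1][j+2]≤6j! : ∀ j → suc j ℕ.* suc (suc j) ℕ.≤ 6 ℕ.* j !
[j+1][j+2]≤6j! zero                = ℕₚ.m≤m+n 2 4
[j+1][j+2]≤6j! (suc zero)          = ℕₚ.≤-refl
[j+1][j+2]≤6j! (suc (suc j)) = begin
  (3 ℕ.+ j) ℕ.* (4 ℕ.+ j)                        ≤⟨ ℕₚ.m≤m+n _ (j ℕ.* j ℕ.* j ℕ.+ 6 ℕ.* j ℕ.* j ℕ.+ 9 ℕ.* j) ⟩
  (3 ℕ.+ j) ℕ.* (4 ℕ.+ j) ℕ.+ (j ℕ.* j ℕ.* j ℕ.+ 6 ℕ.* j ℕ.* j ℕ.+ 9 ℕ.* j) ≡⟨ lem j ⟩
  (2 ℕ.+ j) ℕ.* ((2 ℕ.+ j) ℕ.* (3 ℕ.+ j))        ≤⟨ ℕₚ.*-monoʳ-≤ (2 ℕ.+ j) ([j+1][j+2]≤6j! (suc j)) ⟩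
  (2 ℕ.+ j) ℕ.* (6 ℕ.* (suc j) !)                ≡⟨ lem₂ (2 ℕ.+ j) ((suc j) !) ⟩
  6 ℕ.* ((2 ℕ.+ j) ℕ.* (suc j) !)                ∎
  where
  open ℕₚ.≤-Reasoning
  lem : ∀ j → (3 ℕ.+ j) ℕ.* (4 ℕ.+ j) ℕ.+ (j ℕ.* j ℕ.* j ℕ.+ 6 ℕ.* j ℕ.* j ℕ.+ 9 ℕ.* j) ≡ (2 ℕ.+ j) ℕ.* ((2 ℕ.+ j) ℕ.* (3 ℕ.+ j))
  lem = ℕRing.solve-∀
  lem₂ : ∀ a b → a ℕ.* (6 ℕ.* b) ≡ 6 ℕ.* (a ℕ.* b)
  lem₂ = ℕRing.solve-∀

-- Euler's number as Σ_{i ≥ 0} 1/i!; only its natural powers are needed.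
e : ℝ
e = mkℝ (λ N → Σ< N e-term) (series-cauchy e-term 6 (λ j →
  subst (λ t → t * fromℕ (suc j ℕ.* suc (suc j)) ≤ fromℕ 6) (sym (0≤p⇒∣p∣≡p (e-term≥0 j)))
    (fromℕ-mono-1/ (j !) {{ℕₚ._!≢0 j}} ([j+1][j+2]≤6j! j))))

-- log n = - log (1 - x) = Σ_{i ≥ 0} xⁱ⁺¹/(i+1) with x = 1 - 1/n ∈ [0, 1).
module Log (n : ℕ) .{{_ : NonZero n}} where

  x : ℚ
  x = 1ℚ - 1/ fromℕ n

  term : ℕ → ℚ
  term i = x ^ suc i ÷ fromℕ (suc i)

  x*n : x * fromℕ n ≡ fromℕ (ℕ.pred n)
  x*n = begin
    (1ℚ - 1/ N) * N        ≡⟨ solve 2 (λ i N → (con 1ℚ :- i) :* N := N :- i :* N) refl (1/ N) N ⟩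
    N - 1/ N * N           ≡⟨ cong (λ t → N - t) (*-inverseˡ N) ⟩
    N - 1ℚ                 ≡⟨ cong (λ t → fromℕ t - 1ℚ) (sym (ℕₚ.suc-pred n)) ⟩
    fromℕ (suc (ℕ.pred n)) - 1ℚ  ≡⟨ cong (_- 1ℚ) (fromℕ-suc (ℕ.pred n)) ⟩
    1ℚ + fromℕ (ℕ.pred n) - 1ℚ   ≡⟨ solve 1 (λ m → con 1ℚ :+ m :- con 1ℚ := m) refl (fromℕ (ℕ.pred n)) ⟩
    fromℕ (ℕ.pred n)       ∎
    where
    open ≡-Reasoning
    N = fromℕ n

  x≥0 : 0ℚ ≤ x
  x≥0 = *-cancelʳ-≤-pos (fromℕ n) {{fromℕ-pos n}}
    (subst₂ _≤_ (sym (*-zeroˡ (fromℕ n))) (sym x*n) (fromℕ-≤ z≤n))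

  x^*n^ : ∀ j → x ^ j * fromℕ (n ℕ.^ j) ≡ fromℕ (ℕ.pred n ℕ.^ j)
  x^*n^ zero    = *-identityˡ 1ℚ
  x^*n^ (suc j) = begin
    x * x ^ j * fromℕ (n ℕ.* n ℕ.^ j)             ≡⟨ cong (x * x ^ j *_) (fromℕ-* n (n ℕ.^ j)) ⟩
    x * x ^ j * (fromℕ n * fromℕ (n ℕ.^ j))       ≡⟨ solve 4 (λ x y a b → x :* y :* (a :* b) := (x :* a) :* (y :* b)) refl x (x ^ j) (fromℕ n) (fromℕ (n ℕ.^ j)) ⟩
    (x * fromℕ n) * (x ^ j * fromℕ (n ℕ.^ j))     ≡⟨ cong₂ _*_ x*n (x^*n^ j) ⟩
    fromℕ (ℕ.pred n) * fromℕ (ℕ.pred n ℕ.^ j)     ≡⟨ sym (fromℕ-* (ℕ.pred n) (ℕ.pred n ℕ.^ j)) ⟩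
    fromℕ (ℕ.pred n ℕ.* ℕ.pred n ℕ.^ j)           ∎
    where open ≡-Reasoning

  bernoulli : ∀ m j → m ℕ.^ j ℕ.* (suc m ℕ.+ j) ℕ.≤ suc m ℕ.^ suc j
  bernoulli m zero = ℕₚ.≤-reflexive (lem m)
    where
    lem : ∀ m → 1 ℕ.* (suc m ℕ.+ 0) ≡ suc m ℕ.* 1
    lem = ℕRing.solve-∀
  bernoulli m (suc j) = begin
    m ℕ.* M ℕ.* (suc m ℕ.+ suc j)                    ≤⟨ ℕₚ.m≤m+n _ (M ℕ.* suc j) ⟩
    m ℕ.* M ℕ.* (suc m ℕ.+ suc j) ℕ.+ M ℕ.* suc j    ≡⟨ lem m M j ⟩
    suc m ℕ.* (M ℕ.* (suc m ℕ.+ j))                  ≤⟨ ℕₚ.*-monoʳ-≤ (suc m) (bernoulli m j) ⟩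
    suc m ℕ.* suc m ℕ.^ suc j                        ∎
    where
    open ℕₚ.≤-Reasoning
    M = m ℕ.^ j
    lem : ∀ m M j → m ℕ.* M ℕ.* (suc m ℕ.+ suc j) ℕ.+ M ℕ.* suc j ≡ suc m ℕ.* (M ℕ.* (suc m ℕ.+ j))
    lem = ℕRing.solve-∀

  x^*[j+1]≤n : ∀ j → x ^ j * fromℕ (suc j) ≤ fromℕ n
  x^*[j+1]≤n j = *-cancelʳ-≤-pos (fromℕ (n ℕ.^ j)) {{fromℕ-pos (n ℕ.^ j) {{ℕₚ.m^n≢0 n j}}}} (begin
    x ^ j * fromℕ (suc j) * fromℕ (n ℕ.^ j)   ≡⟨ solve 3 (λ a b c → a :* b :* c := (a :* c) :* b) refl (x ^ j) (fromℕ (suc j)) (fromℕ (n ℕ.^ j)) ⟩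
    x ^ j * fromℕ (n ℕ.^ j) * fromℕ (suc j)   ≡⟨ cong (_* fromℕ (suc j)) (x^*n^ j) ⟩
    fromℕ (ℕ.pred n ℕ.^ j) * fromℕ (suc j)    ≡⟨ sym (fromℕ-* (ℕ.pred n ℕ.^ j) (suc j)) ⟩
    fromℕ (ℕ.pred n ℕ.^ j ℕ.* suc j)          ≤⟨ fromℕ-≤ (ℕₚ.≤-trans
        (ℕₚ.*-monoʳ-≤ (ℕ.pred n ℕ.^ j) (s≤s (ℕₚ.m≤n+m j (ℕ.pred n))))
        (subst (λ t → ℕ.pred n ℕ.^ j ℕ.* (suc (ℕ.pred n) ℕ.+ j) ℕ.≤ t ℕ.^ suc j) (ℕₚ.suc-pred n) (bernoulli (ℕ.pred n) j))) ⟩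
    fromℕ (n ℕ.* n ℕ.^ j)                     ≡⟨ fromℕ-* n (n ℕ.^ j) ⟩
    fromℕ n * fromℕ (n ℕ.^ j)                 ∎)
    where open ≤-Reasoning

  term≥0 : ∀ j → 0ℚ ≤ term j
  term≥0 j = 0≤* (0≤^ (suc j) x≥0) (1/fromℕ-nonNeg (suc j))

  term-bound : ∀ j → ∣ term j ∣ * fromℕ (suc j ℕ.* suc (suc j)) ≤ fromℕ n
  term-bound j = begin
    ∣ term j ∣ * fromℕ (suc j ℕ.* suc (suc j))
      ≡⟨ cong₂ _*_ (0≤p⇒∣p∣≡p (term≥0 j)) (fromℕ-* (suc j) (suc (suc j))) ⟩
    x ^ suc j * 1/ A * (A * B)
      ≡⟨ solve 4 (λ y i A B → y :* i :* (A :* B) := (i :* A) :* (y :* B)) refl (x ^ suc j) (1/ A) A B ⟩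
    (1/ A * A) * (x ^ suc j * B)
      ≡⟨ cong (_* (x ^ suc j * B)) (*-inverseˡ A) ⟩
    1ℚ * (x ^ suc j * B)
      ≡⟨ *-identityˡ (x ^ suc j * B) ⟩
    x ^ suc j * B
      ≤⟨ x^*[j+1]≤n (suc j) ⟩
    fromℕ n ∎
    where
    open ≤-Reasoning
    A = fromℕ (suc j)
    B = fromℕ (suc (suc j))

log : (n : ℕ) .{{_ : NonZero n}} → ℝ
log n = mkℝ (λ N → Σ< N (Log.term n)) (series-cauchy (Log.term n) n (Log.term-bound n))

log>0 : ∀ n .{{_ : NonZero n}} → 1 ℕ.< n → 0ℝ <ℝ log n
log>0 (suc zero) (s≤s ())
log>0 n@(suc m@(suc r)) _ = Σ< 1 (Log.term n) , first>0 , 1 , λ N 1≤N →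
    subst (_≤ Σ< N (Log.term n)) (sym (+-identityˡ (Σ< 1 (Log.term n)))) (Σ<-mono (Log.term n) (Log.term≥0 n) 1≤N)
  where
  x>0 : 0ℚ < Log.x n
  x>0 = *-cancelʳ-<-nonNeg (fromℕ n) (subst₂ _<_ (sym (*-zeroˡ (fromℕ n))) (sym (Log.x*n n)) (positive⁻¹ (fromℕ m)))
  first>0 : 0ℚ < Σ< 1 (Log.term n)
  first>0 = subst (0ℚ <_) (sym (+-identityˡ (Log.term n 0)))
    (0<* {Log.x n * 1ℚ} {1/ fromℕ 1} (0<* {Log.x n} {1ℚ} x>0 (positive⁻¹ 1ℚ)) (positive⁻¹ (1/ fromℕ 1)))

2≤e : ∀ j → 2 ℕ.≤ j → fromℕ 2 ≤ seq e j
2≤e j 2≤j = Σ<-mono e-term e-term≥0 2≤j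

1≤e^ : ∀ m j → 2 ℕ.≤ j → 1ℚ ≤ seq (e ^ℝ m) j
1≤e^ zero    j 2≤j = ≤-refl
1≤e^ (suc m) j 2≤j = ≤-trans (1≤e^ m j 2≤j) (subst (_≤ seq e j * seq (e ^ℝ m) j) (*-identityˡ (seq (e ^ℝ m) j))
  (*-monoʳ-≤-nonNeg (seq (e ^ℝ m) j) {{nonNegative (≤-trans (nonNegative⁻¹ 1ℚ) (1≤e^ m j 2≤j))}}
    (≤-trans (fromℕ-≤ {1} {2} (s≤s z≤n)) (2≤e j 2≤j))))

2≤e^ : ∀ m .{{_ : NonZero m}} j → 2 ℕ.≤ j → fromℕ 2 ≤ seq (e ^ℝ m) j
2≤e^ (suc m) j 2≤j = ≤-trans (2≤e j 2≤j) (subst (_≤ seq e j * seq (e ^ℝ m) j) (*-identityʳ (seq e j))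
  (*-monoˡ-≤-nonNeg (seq e j) {{nonNegative (≤-trans (fromℕ-≤ z≤n) (2≤e j 2≤j))}} (1≤e^ m j 2≤j)))

2≰1+½ : ¬ (fromℕ 2 ≤ fromℕ 1 + ½)
2≰1+½ (ℚ.*≤* (ℤ.+≤+ (s≤s (s≤s (s≤s ())))))

e^m≤n⇒1<n : ∀ m .{{_ : NonZero m}} n → e ^ℝ m ≤ℝ fromℚ (fromℕ n) → 1 ℕ.< n
e^m≤n⇒1<n m n h = ℕₚ.≰⇒> λ n≤1 →
  let (N , hN) = h ½ (positive⁻¹ ½) in
  2≰1+½ (begin
    fromℕ 2                   ≤⟨ 2≤e^ m (2 ℕ.+ N) (ℕₚ.m≤m+n 2 N) ⟩
    seq (e ^ℝ m) (2 ℕ.+ N)    ≤⟨ hN (2 ℕ.+ N) (ℕₚ.m≤n+m N 2) ⟩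
    fromℕ n + ½               ≤⟨ +-monoˡ-≤ ½ {fromℕ n} {fromℕ 1} (fromℕ-≤ {n} {1} n≤1) ⟩
    fromℕ 1 + ½               ∎)
  where open ≤-Reasoning

δ : ℕ → (x : ℚ) .{{_ : ℚ.NonZero x}} → ℚ
δ k x = ((x - 1ℚ) ^ k + fromℕ k * (x - 1ℚ) ^ (k ℕ.∸ 1) + (- 1ℚ) ^ k * fromℕ (k ℕ.∸ 1)) ÷ x

module δ-Bounds (j r : ℕ) where

  k q p A C : ℕ
  k = 2 ℕ.+ j
  q = suc r
  p = suc q
  A = q ℕ.^ k ℕ.+ k ℕ.* q ℕ.^ suc j
  C = k ℕ.* k ℕ.+ suc j

  k≤A : k ℕ.≤ A
  k≤A = ℕₚ.≤-trans (ℕₚ.m≤m*n k (q ℕ.^ suc j) {{ℕₚ.m^n≢0 q (suc j)}}) (ℕₚ.m≤n+m (k ℕ.* q ℕ.^ suc j) (q ℕ.^ k))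

  binomial-≥ : ∀ i → q ℕ.* q ℕ.^ suc i ℕ.+ (2 ℕ.+ i) ℕ.* q ℕ.^ suc i ℕ.+ suc i ℕ.≤ p ℕ.^ (2 ℕ.+ i)
  binomial-≥ zero = ℕₚ.≤-reflexive (lem q)
    where
    lem : ∀ q → q ℕ.* (q ℕ.* 1) ℕ.+ 2 ℕ.* (q ℕ.* 1) ℕ.+ 1 ≡ suc q ℕ.* (suc q ℕ.* 1)
    lem = ℕRing.solve-∀
  binomial-≥ (suc i) = begin
    q ℕ.* (q ℕ.* u) ℕ.+ (3 ℕ.+ i) ℕ.* (q ℕ.* u) ℕ.+ (2 ℕ.+ i)
      ≤⟨ ℕₚ.+-monoʳ-≤ (q ℕ.* (q ℕ.* u) ℕ.+ (3 ℕ.+ i) ℕ.* (q ℕ.* u)) (ℕₚ.m≤m*n (2 ℕ.+ i) u {{ℕₚ.m^n≢0 q (suc i)}}) ⟩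
    q ℕ.* (q ℕ.* u) ℕ.+ (3 ℕ.+ i) ℕ.* (q ℕ.* u) ℕ.+ (2 ℕ.+ i) ℕ.* u
      ≤⟨ ℕₚ.m≤m+n _ (suc i ℕ.* q ℕ.+ suc i) ⟩
    q ℕ.* (q ℕ.* u) ℕ.+ (3 ℕ.+ i) ℕ.* (q ℕ.* u) ℕ.+ (2 ℕ.+ i) ℕ.* u ℕ.+ (suc i ℕ.* q ℕ.+ suc i)
      ≡⟨ lem q u i ⟩
    suc q ℕ.* (q ℕ.* u ℕ.+ (2 ℕ.+ i) ℕ.* u ℕ.+ suc i)
      ≤⟨ ℕₚ.*-monoʳ-≤ p (binomial-≥ i) ⟩
    p ℕ.* p ℕ.^ (2 ℕ.+ i) ∎
    where
    open ℕₚ.≤-Reasoning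
    u = q ℕ.^ suc i
    lem : ∀ q u i → q ℕ.* (q ℕ.* u) ℕ.+ (3 ℕ.+ i) ℕ.* (q ℕ.* u) ℕ.+ (2 ℕ.+ i) ℕ.* u ℕ.+ (suc i ℕ.* q ℕ.+ suc i)
                    ≡ suc q ℕ.* (q ℕ.* u ℕ.+ (2 ℕ.+ i) ℕ.* u ℕ.+ suc i)
    lem = ℕRing.solve-∀

  binomial-≤ : ∀ i → p ℕ.^ (2 ℕ.+ i) ℕ.≤
                     q ℕ.* q ℕ.^ suc i ℕ.+ (2 ℕ.+ i) ℕ.* q ℕ.^ suc i ℕ.+ (2 ℕ.+ i) ℕ.* (2 ℕ.+ i) ℕ.* p ℕ.^ i
  binomial-≤ zero = ℕₚ.≤-trans (ℕₚ.m≤m+n _ 3) (ℕₚ.≤-reflexive (lem q))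
    where
    lem : ∀ q → suc q ℕ.* (suc q ℕ.* 1) ℕ.+ 3 ≡ q ℕ.* (q ℕ.* 1) ℕ.+ 2 ℕ.* (q ℕ.* 1) ℕ.+ 4
    lem = ℕRing.solve-∀
  binomial-≤ (suc i) = begin
    p ℕ.* p ℕ.^ (2 ℕ.+ i)
      ≤⟨ ℕₚ.*-monoʳ-≤ p (binomial-≤ i) ⟩
    suc q ℕ.* (q ℕ.* u ℕ.+ (2 ℕ.+ i) ℕ.* u ℕ.+ (2 ℕ.+ i) ℕ.* (2 ℕ.+ i) ℕ.* v)
      ≡⟨ lem₁ q u v i ⟩
    q ℕ.* (q ℕ.* u) ℕ.+ (3 ℕ.+ i) ℕ.* (q ℕ.* u) ℕ.+ ((2 ℕ.+ i) ℕ.* u ℕ.+ (2 ℕ.+ i) ℕ.* (2 ℕ.+ i) ℕ.* (suc q ℕ.* v))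
      ≤⟨ ℕₚ.+-monoʳ-≤ (q ℕ.* (q ℕ.* u) ℕ.+ (3 ℕ.+ i) ℕ.* (q ℕ.* u))
           (ℕₚ.+-monoˡ-≤ ((2 ℕ.+ i) ℕ.* (2 ℕ.+ i) ℕ.* (suc q ℕ.* v)) (ℕₚ.*-monoʳ-≤ (2 ℕ.+ i) (ℕₚ.^-monoˡ-≤ (suc i) (ℕₚ.n≤1+n q)))) ⟩
    q ℕ.* (q ℕ.* u) ℕ.+ (3 ℕ.+ i) ℕ.* (q ℕ.* u) ℕ.+ ((2 ℕ.+ i) ℕ.* (suc q ℕ.* v) ℕ.+ (2 ℕ.+ i) ℕ.* (2 ℕ.+ i) ℕ.* (suc q ℕ.* v))
      ≤⟨ ℕₚ.m≤m+n _ ((3 ℕ.+ i) ℕ.* (suc q ℕ.* v)) ⟩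
    q ℕ.* (q ℕ.* u) ℕ.+ (3 ℕ.+ i) ℕ.* (q ℕ.* u) ℕ.+ ((2 ℕ.+ i) ℕ.* (suc q ℕ.* v) ℕ.+ (2 ℕ.+ i) ℕ.* (2 ℕ.+ i) ℕ.* (suc q ℕ.* v)) ℕ.+ (3 ℕ.+ i) ℕ.* (suc q ℕ.* v)
      ≡⟨ lem₂ (q ℕ.* (q ℕ.* u) ℕ.+ (3 ℕ.+ i) ℕ.* (q ℕ.* u)) (suc q ℕ.* v) i ⟩
    q ℕ.* (q ℕ.* u) ℕ.+ (3 ℕ.+ i) ℕ.* (q ℕ.* u) ℕ.+ (3 ℕ.+ i) ℕ.* (3 ℕ.+ i) ℕ.* (suc q ℕ.* v) ∎
    where
    open ℕₚ.≤-Reasoning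
    u = q ℕ.^ suc i
    v = p ℕ.^ i
    lem₁ : ∀ q u v i → suc q ℕ.* (q ℕ.* u ℕ.+ (2 ℕ.+ i) ℕ.* u ℕ.+ (2 ℕ.+ i) ℕ.* (2 ℕ.+ i) ℕ.* v)
      ≡ q ℕ.* (q ℕ.* u) ℕ.+ (3 ℕ.+ i) ℕ.* (q ℕ.* u) ℕ.+ ((2 ℕ.+ i) ℕ.* u ℕ.+ (2 ℕ.+ i) ℕ.* (2 ℕ.+ i) ℕ.* (suc q ℕ.* v))
    lem₁ = ℕRing.solve-∀
    lem₂ : ∀ X w i → X ℕ.+ ((2 ℕ.+ i) ℕ.* w ℕ.+ (2 ℕ.+ i) ℕ.* (2 ℕ.+ i) ℕ.* w) ℕ.+ (3 ℕ.+ i) ℕ.* w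
      ≡ X ℕ.+ (3 ℕ.+ i) ℕ.* (3 ℕ.+ i) ℕ.* w
    lem₂ = ℕRing.solve-∀

  p^k-bound : p ℕ.^ k ℕ.+ suc j ℕ.≤ A ℕ.+ C ℕ.* p ℕ.^ j
  p^k-bound = begin
    p ℕ.^ k ℕ.+ suc j
      ≤⟨ ℕₚ.+-mono-≤ (binomial-≤ j) (ℕₚ.m≤m*n (suc j) (p ℕ.^ j) {{ℕₚ.m^n≢0 p j}}) ⟩
    A ℕ.+ k ℕ.* k ℕ.* p ℕ.^ j ℕ.+ suc j ℕ.* p ℕ.^ j
      ≡⟨ lem A (k ℕ.* k) (suc j) (p ℕ.^ j) ⟩
    A ℕ.+ C ℕ.* p ℕ.^ j ∎
    where
    open ℕₚ.≤-Reasoning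
    lem : ∀ a b c d → a ℕ.+ b ℕ.* d ℕ.+ c ℕ.* d ≡ a ℕ.+ (b ℕ.+ c) ℕ.* d
    lem = ℕRing.solve-∀

  P Q c s num δₚ factor : ℚ
  P = fromℕ p
  Q = fromℕ (p ℕ.^ suc j)
  c = fromℕ (suc j)
  s = (- 1ℚ) ^ k * c
  num = (P - 1ℚ) ^ k + fromℕ k * (P - 1ℚ) ^ suc j + s
  δₚ = δ k P

  instance
    Q≢0 : ℚ.NonZero Q
    Q≢0 = ℕₚ.m^n≢0 p (suc j)

  factor = δₚ ÷ Q

  num≡A+s : num ≡ fromℕ A + s
  num≡A+s = cong (_+ s) (begin
    (P - 1ℚ) ^ k + fromℕ k * (P - 1ℚ) ^ suc j             ≡⟨ cong (λ t → t ^ k + fromℕ k * t ^ suc j) P-1 ⟩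
    fromℕ q ^ k + fromℕ k * fromℕ q ^ suc j               ≡⟨ sym (cong₂ (λ a b → a + fromℕ k * b) (fromℕ-^ q k) (fromℕ-^ q (suc j))) ⟩
    fromℕ (q ℕ.^ k) + fromℕ k * fromℕ (q ℕ.^ suc j)       ≡⟨ cong (fromℕ (q ℕ.^ k) +_) (sym (fromℕ-* k (q ℕ.^ suc j))) ⟩
    fromℕ (q ℕ.^ k) + fromℕ (k ℕ.* q ℕ.^ suc j)           ≡⟨ sym (fromℕ-+ (q ℕ.^ k) (k ℕ.* q ℕ.^ suc j)) ⟩
    fromℕ A                                               ∎)
    where
    open ≡-Reasoning
    P-1 : P - 1ℚ ≡ fromℕ q
    P-1 = trans (cong (_- 1ℚ) (fromℕ-suc q)) (solve 1 (λ m → con 1ℚ :+ m :- con 1ℚ := m) refl (fromℕ q))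

  ∣-1^_∣≡1 : ∀ n → ∣ (- 1ℚ) ^ n ∣ ≡ 1ℚ
  ∣-1^ zero  ∣≡1 = refl
  ∣-1^ suc n ∣≡1 = trans (∣p*q∣≡∣p∣*∣q∣ (- 1ℚ) ((- 1ℚ) ^ n)) (cong (1ℚ *_) ∣-1^ n ∣≡1)

  ∣s∣≡c : ∣ s ∣ ≡ c
  ∣s∣≡c = trans (∣p*q∣≡∣p∣*∣q∣ ((- 1ℚ) ^ k) c) (trans (cong (_* c) ∣-1^ k ∣≡1) (*-identityˡ c))

  s≤c : s ≤ c
  s≤c = subst (s ≤_) ∣s∣≡c (p≤∣p∣ s)

  0≤s+c : 0ℚ ≤ s + c
  0≤s+c = subst₂ _≤_ (+-inverseʳ s) (cong (s +_) (trans (∣-p∣≡∣p∣ s) ∣s∣≡c)) (+-monoʳ-≤ s (p≤∣p∣ (- s)))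

  1≤num : 1ℚ ≤ num
  1≤num = begin
    1ℚ                  ≡⟨ solve 1 (λ c → con 1ℚ := con 1ℚ :+ c :- c) refl c ⟩
    1ℚ + c - c          ≡⟨ cong (_- c) (sym (fromℕ-suc (suc j))) ⟩
    fromℕ k - c         ≤⟨ +-monoˡ-≤ (- c) (fromℕ-≤ k≤A) ⟩
    fromℕ A - c         ≡⟨ sym (+-identityʳ (fromℕ A - c)) ⟩
    fromℕ A - c + 0ℚ    ≤⟨ +-monoʳ-≤ (fromℕ A - c) 0≤s+c ⟩
    fromℕ A - c + (s + c) ≡⟨ solve 3 (λ a c s → a :- c :+ (s :+ c) := a :+ s) refl (fromℕ A) c s ⟩
    fromℕ A + s         ≡⟨ sym num≡A+s ⟩
    num                 ∎
    where open ≤-Reasoning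

  num≤p^k : num ≤ fromℕ (p ℕ.^ k)
  num≤p^k = begin
    num                  ≡⟨ num≡A+s ⟩
    fromℕ A + s          ≤⟨ +-monoʳ-≤ (fromℕ A) s≤c ⟩
    fromℕ A + c          ≡⟨ sym (fromℕ-+ A (suc j)) ⟩
    fromℕ (A ℕ.+ suc j)  ≤⟨ fromℕ-≤ (binomial-≥ j) ⟩
    fromℕ (p ℕ.^ k)      ∎
    where open ≤-Reasoning

  p^k-num≤ : fromℕ (p ℕ.^ k) - num ≤ fromℕ C * fromℕ (p ℕ.^ j)
  p^k-num≤ = p≤r+q⇒p-q≤r {fromℕ (p ℕ.^ k)} {num} (begin
    fromℕ (p ℕ.^ k)                   ≡⟨ sym (+-identityʳ (fromℕ (p ℕ.^ k))) ⟩
    fromℕ (p ℕ.^ k) + 0ℚ              ≤⟨ +-monoʳ-≤ (fromℕ (p ℕ.^ k)) 0≤s+c ⟩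
    fromℕ (p ℕ.^ k) + (s + c)         ≡⟨ solve 3 (λ a s c → a :+ (s :+ c) := (a :+ c) :+ s) refl (fromℕ (p ℕ.^ k)) s c ⟩
    fromℕ (p ℕ.^ k) + c + s           ≡⟨ cong (_+ s) (sym (fromℕ-+ (p ℕ.^ k) (suc j))) ⟩
    fromℕ (p ℕ.^ k ℕ.+ suc j) + s     ≤⟨ +-monoˡ-≤ s (fromℕ-≤ p^k-bound) ⟩
    fromℕ (A ℕ.+ C ℕ.* p ℕ.^ j) + s   ≡⟨ cong (_+ s) (trans (fromℕ-+ A (C ℕ.* p ℕ.^ j)) (cong (fromℕ A +_) (fromℕ-* C (p ℕ.^ j)))) ⟩
    fromℕ A + X + s                   ≡⟨ solve 3 (λ a x s → (a :+ x) :+ s := x :+ (a :+ s)) refl (fromℕ A) X s ⟩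
    X + (fromℕ A + s)                 ≡⟨ cong (X +_) (sym num≡A+s) ⟩
    X + num                           ∎)
    where
    open ≤-Reasoning
    X = fromℕ C * fromℕ (p ℕ.^ j)

  δ>0 : 0ℚ < δₚ
  δ>0 = 0<* {num} {1/ P} (<-≤-trans (positive⁻¹ 1ℚ) 1≤num) (positive⁻¹ (1/ P))

  1/Q≥0 : 0ℚ ≤ 1/ Q
  1/Q≥0 = 1/fromℕ-nonNeg (p ℕ.^ suc j) {{ℕₚ.m^n≢0 p (suc j)}}

  factor≥0 : 0ℚ ≤ factor
  factor≥0 = 0≤* {δₚ} {1/ Q} (<⇒≤ δ>0) 1/Q≥0

  p^k⁺ : Positive (fromℕ (p ℕ.^ k))
  p^k⁺ = fromℕ-pos (p ℕ.^ k) {{ℕₚ.m^n≢0 p k}}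

  factor*p^k : factor * fromℕ (p ℕ.^ k) ≡ num
  factor*p^k = begin
    num * 1/ P * 1/ Q * fromℕ (p ℕ.^ k)     ≡⟨ cong (num * 1/ P * 1/ Q *_) (fromℕ-* p (p ℕ.^ suc j)) ⟩
    num * 1/ P * 1/ Q * (P * Q)             ≡⟨ solve 5 (λ n a b P Q → n :* a :* b :* (P :* Q) := n :* (a :* P) :* (b :* Q)) refl num (1/ P) (1/ Q) P Q ⟩
    num * (1/ P * P) * (1/ Q * Q)           ≡⟨ cong₂ (λ a b → num * a * b) (*-inverseˡ P) (*-inverseˡ Q) ⟩
    num * 1ℚ * 1ℚ                           ≡⟨ solve 1 (λ n → n :* con 1ℚ :* con 1ℚ := n) refl num ⟩
    num                                     ∎
    where open ≡-Reasoning

  factor≤1 : factor ≤ 1ℚ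
  factor≤1 = *-cancelʳ-≤-pos (fromℕ (p ℕ.^ k)) {{p^k⁺}}
    (subst₂ _≤_ (sym factor*p^k) (sym (*-identityˡ (fromℕ (p ℕ.^ k)))) num≤p^k)

  1-factor≤ : (1ℚ - factor) * (P * P) ≤ fromℕ C
  1-factor≤ = *-cancelʳ-≤-pos R {{fromℕ-pos (p ℕ.^ j) {{ℕₚ.m^n≢0 p j}}}} (begin
    (1ℚ - factor) * (P * P) * R          ≡⟨ solve 3 (λ f P R → (con 1ℚ :- f) :* (P :* P) :* R := P :* (P :* R) :- f :* (P :* (P :* R))) refl factor P R ⟩
    P * (P * R) - factor * (P * (P * R)) ≡⟨ cong (λ t → t - factor * t) (sym p^k≡PPR) ⟩
    fromℕ (p ℕ.^ k) - factor * fromℕ (p ℕ.^ k) ≡⟨ cong (λ t → fromℕ (p ℕ.^ k) - t) factor*p^k ⟩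
    fromℕ (p ℕ.^ k) - num                ≤⟨ p^k-num≤ ⟩
    fromℕ C * R                          ∎)
    where
    open ≤-Reasoning
    R = fromℕ (p ℕ.^ j)
    p^k≡PPR : fromℕ (p ℕ.^ k) ≡ P * (P * R)
    p^k≡PPR = trans (fromℕ-* p (p ℕ.^ suc j)) (cong (P *_) (fromℕ-* p (p ℕ.^ j)))

δₚ : ℕ → (p : ℕ) .{{_ : Prime p}} → ℚ
δₚ k p {{pr}} = δ k (fromℕ p) {{prime⇒nonZero pr}}

δₚ>0 : ∀ k .{{_ : NonTrivial k}} p .{{_ : Prime p}} → 0ℚ < δₚ k p
δₚ>0 (suc (suc j)) zero          {{pr}} = ⊥-elim-irr (¬prime[0] pr)
δₚ>0 (suc (suc j)) (suc zero)    {{pr}} = ⊥-elim-irr (¬prime[1] pr)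
δₚ>0 (suc (suc j)) (suc (suc r)) = δ-Bounds.δ>0 j r

-- ∏[ Q? , f ] N is the product of f over the p ≤ N satisfying Q.
∏[_,_] : {Q : Pred ℕ 0ℓ} → Decidable Q → ((p : ℕ) → .(Q p) → ℚ) → ℕ → ℚ
∏[ Q? , f ] zero    = 1ℚ
∏[ Q? , f ] (suc N) with Q? (suc N)
... | yes Qp = ∏[ Q? , f ] N * f (suc N) Qp
... | no _   = ∏[ Q? , f ] N

D-factor : ℕ → (p : ℕ) → .(Prime p) → ℚ
D-factor k p pr = (δₚ k p {{pr}} ÷ fromℕ (p ℕ.^ (k ℕ.∸ 1))) {{ℕₚ.m^n≢0 p (k ℕ.∸ 1) {{prime⇒nonZero pr}}}}

D-partial : ℕ → ℕ → ℚ
D-partial k = ∏[ prime? , D-factor k ]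

D-factor-bounds : ∀ j p .(pr : Prime p) → 0ℚ ≤ D-factor (2 ℕ.+ j) p pr × D-factor (2 ℕ.+ j) p pr ≤ 1ℚ
D-factor-bounds j zero          pr = ⊥-elim-irr (¬prime[0] pr)
D-factor-bounds j (suc zero)    pr = ⊥-elim-irr (¬prime[1] pr)
D-factor-bounds j (suc (suc r)) pr = δ-Bounds.factor≥0 j r , δ-Bounds.factor≤1 j r

D-partial-bounds : ∀ j N → 0ℚ ≤ D-partial (2 ℕ.+ j) N × D-partial (2 ℕ.+ j) N ≤ 1ℚ
D-partial-bounds j zero    = nonNegative⁻¹ 1ℚ , ≤-refl
D-partial-bounds j (suc N) with prime? (suc N)
... | no _   = D-partial-bounds j N
... | yes pr = 0≤* {π} {f} (proj₁ πb) (proj₁ fb) , (begin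
    π * f  ≤⟨ *-monoʳ-≤-nonNeg f {{nonNegative (proj₁ fb)}} (proj₂ πb) ⟩
    1ℚ * f ≡⟨ *-identityˡ f ⟩
    f      ≤⟨ proj₂ fb ⟩
    1ℚ     ∎)
  where
  open ≤-Reasoning
  π = D-partial (2 ℕ.+ j) N
  f = D-factor (2 ℕ.+ j) (suc N) pr
  πb : 0ℚ ≤ π × π ≤ 1ℚ
  πb = D-partial-bounds j N
  fb : 0ℚ ≤ f × f ≤ 1ℚ
  fb = D-factor-bounds j (suc N) pr

D-const : ℕ → ℕ
D-const j = 2 ℕ.* ((2 ℕ.+ j) ℕ.* (2 ℕ.+ j) ℕ.+ suc j)

1-D-factor≤ : ∀ j N .(pr : Prime (suc N)) →
  (1ℚ - D-factor (2 ℕ.+ j) (suc N) pr) * fromℕ (suc N ℕ.* suc (suc N)) ≤ fromℕ (D-const j)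
1-D-factor≤ j zero    pr = ⊥-elim-irr (¬prime[1] pr)
1-D-factor≤ j (suc r) pr = begin
  g * fromℕ (p ℕ.* suc p)                ≤⟨ *-monoˡ-≤-nonNeg g {{nonNegative g≥0}} (fromℕ-≤ p[p+1]≤2p²) ⟩
  g * fromℕ (2 ℕ.* (p ℕ.* p))            ≡⟨ cong (g *_) (trans (fromℕ-* 2 (p ℕ.* p)) (cong (fromℕ 2 *_) (fromℕ-* p p))) ⟩
  g * (fromℕ 2 * (fromℕ p * fromℕ p))    ≡⟨ solve 3 (λ g t x → g :* (t :* x) := t :* (g :* x)) refl g (fromℕ 2) (fromℕ p * fromℕ p) ⟩
  fromℕ 2 * (g * (fromℕ p * fromℕ p))    ≤⟨ *-monoˡ-≤-nonNeg (fromℕ 2) (δ-Bounds.1-factor≤ j r) ⟩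
  fromℕ 2 * fromℕ (δ-Bounds.C j r)       ≡⟨ sym (fromℕ-* 2 (δ-Bounds.C j r)) ⟩
  fromℕ (D-const j)                      ∎
  where
  open ≤-Reasoning
  p = suc (suc r)
  g = 1ℚ - δ-Bounds.factor j r
  g≥0 : 0ℚ ≤ g
  g≥0 = subst (_≤ g) (+-inverseʳ 1ℚ) (+-monoʳ-≤ 1ℚ (neg-antimono-≤ (δ-Bounds.factor≤1 j r)))
  p[p+1]≤2p² : p ℕ.* suc p ℕ.≤ 2 ℕ.* (p ℕ.* p)
  p[p+1]≤2p² = ℕₚ.≤-trans (ℕₚ.*-monoʳ-≤ p (ℕₚ.+-monoˡ-≤ p (s≤s (z≤n {suc r})))) (ℕₚ.≤-reflexive (lem p))
    where
    lem : ∀ p → p ℕ.* (p ℕ.+ p) ≡ 2 ℕ.* (p ℕ.* p)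
    lem = ℕRing.solve-∀

D-step : ∀ j N → ∣ D-partial (2 ℕ.+ j) (suc N) - D-partial (2 ℕ.+ j) N ∣ * fromℕ (suc N ℕ.* suc (suc N)) ≤ fromℕ (D-const j)
D-step j N with prime? (suc N)
... | no _   = begin
    ∣ π - π ∣ * X      ≡⟨ cong {A = ℚ} {B = ℚ} (λ t → ∣ t ∣ * X) {π - π} {0ℚ} (+-inverseʳ π) ⟩
    0ℚ * X             ≡⟨ *-zeroˡ X ⟩
    0ℚ                 ≤⟨ fromℕ-≤ {0} {D-const j} z≤n ⟩
    fromℕ (D-const j)  ∎
  where
  open ≤-Reasoning
  π = D-partial (2 ℕ.+ j) N
  X = fromℕ (suc N ℕ.* suc (suc N))
... | yes pr = begin
    ∣ π * f - π ∣ * X         ≡⟨ cong (λ t → ∣ t ∣ * X) (solve 2 (λ π f → π :* f :- π := :- (π :* (con 1ℚ :- f))) refl π f) ⟩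
    ∣ - (π * (1ℚ - f)) ∣ * X  ≡⟨ cong (_* X) (trans (∣-p∣≡∣p∣ (π * (1ℚ - f))) (0≤p⇒∣p∣≡p (0≤* {π} {1ℚ - f} (proj₁ πb) 1-f≥0))) ⟩
    π * (1ℚ - f) * X          ≤⟨ *-monoʳ-≤-nonNeg X (*-monoʳ-≤-nonNeg (1ℚ - f) {{nonNegative 1-f≥0}} (proj₂ πb)) ⟩
    1ℚ * (1ℚ - f) * X         ≡⟨ cong (_* X) (*-identityˡ (1ℚ - f)) ⟩
    (1ℚ - f) * X              ≤⟨ 1-D-factor≤ j N pr ⟩
    fromℕ (D-const j)         ∎
  where
  open ≤-Reasoning
  π = D-partial (2 ℕ.+ j) N
  X = fromℕ (suc N ℕ.* suc (suc N))
  f = D-factor (2 ℕ.+ j) (suc N) pr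
  πb : 0ℚ ≤ π × π ≤ 1ℚ
  πb = D-partial-bounds j N
  1-f≥0 : 0ℚ ≤ 1ℚ - f
  1-f≥0 = subst (_≤ 1ℚ - f) (+-inverseʳ 1ℚ) (+-monoʳ-≤ 1ℚ (neg-antimono-≤ (proj₂ (D-factor-bounds j (suc N) pr))))

D-cauchy : ∀ k .{{_ : NonTrivial k}} → IsCauchy (D-partial k)
D-cauchy (suc (suc j)) = cauchy-steps (D-partial (2 ℕ.+ j)) (D-const j) (D-step j)

-- The infinite product: the limit of the partial products over primes p ≤ N.
D : (k : ℕ) .{{_ : NonTrivial k}} → ℝ
D k = mkℝ (D-partial k) (D-cauchy k)

g-factor : (k : ℕ) .{{_ : NonTrivial k}} (p : ℕ) → .(Prime p) → ℚ
g-factor k p pr = 1ℚ + (((- 1ℚ) ^ (k ℕ.∸ 1) * fromℕ (k ℕ.∸ 1)) ÷ δₚ k p {{pr}}) {{pos⇒nonZero (δₚ k p {{pr}}) {{positive (δₚ>0 k p {{pr}})}}}}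

g : (k n : ℕ) .{{_ : NonTrivial k}} .{{_ : NonZero n}} → ℚ
g k n = ∏[ (λ p → prime? p ×-dec p ∣? n) , (λ p pr → g-factor k p (proj₁ pr)) ] n

IsCoprimeRep : (k n : ℕ) → Vec ℕ k → Set
IsCoprimeRep k n xs = All (1 ℕ.≤_) xs × Vec.sum xs ≡ n × AllPairs (λ x y → gcd x y ≡ 1) xs

isCoprimeRep? : ∀ k n → Decidable (IsCoprimeRep k n)
isCoprimeRep? k n xs =
  All.all? (1 ℕ.≤?_) xs ×-dec Vec.sum xs ℕ.≟ n ×-dec allPairs? (λ x y → gcd x y ℕ.≟ 1) xs

-- All vectors with entries in {0, …, n}; a vector with sum n has no larger entry,
-- so B counts every solution exactly once.
vectors≤ : (k n : ℕ) → List (Vec ℕ k)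
vectors≤ zero    n = [] ∷ []
vectors≤ (suc k) n = cartesianProductWith _∷_ (upTo (suc n)) (vectors≤ k n)

B : (k n : ℕ) → ℕ
B k n = length (filter (isCoprimeRep? k n) (vectors≤ k n))

n≥e^m⇒log>0 : ∀ k n .{{_ : NonTrivial k}} .{{_ : NonZero n}} →
              e ^ℝ (k ℕ.* 2 ℕ.^ (k ℕ.+ 2)) ≤ℝ fromℚ (fromℕ n) → 0ℝ <ℝ log n
n≥e^m⇒log>0 k n h = log>0 n (e^m≤n⇒1<n (k ℕ.* 2 ℕ.^ (k ℕ.+ 2)) {{m≢0}} n h)
  where
  m≢0 : NonZero (k ℕ.* 2 ℕ.^ (k ℕ.+ 2))
  m≢0 = ℕₚ.m*n≢0 k (2 ℕ.^ (k ℕ.+ 2)) {{ℕ.nonTrivial⇒nonZero k}} {{ℕₚ.m^n≢0 2 (k ℕ.+ 2)}}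

{-# OPTIONS --safe #-}
-- Call a tuple z-good if no prime p ≤ z divides two of its entries. Being z-good is
-- periodic modulo the primorial of z, so the z-good positive tuples with sum n number
-- n^(k-1)/(k-1)! times a density up to boundary terms, and by the Chinese remainder
-- theorem the density is the product of the local ones, which are the factors of D_k g_k.
-- With z a power of two comparable to log n the primorial is at most 4^z, a small power
-- of n, so the boundary terms are negligible. Tuples with two entries divisible by a common
-- prime p > z number O(n^(k-1)/p²), and the product over p > z is 1 + O(1/z), so both
-- truncations cost O(n^(k-1)/z). For k = 2 the sifted set is also periodic modulo n, which
-- makes the count exact.
module Submission where

-- The tail over primes p > z converges because two entries divisible by p cost a factor 1/p². With
-- three or more entries this holds for every n. With two entries and p dividing n, divisibility of
-- one entry forces that of the other, the count is of order n/p, and the truncation argument fails: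
-- hence the separate exact route for k = 2.
--
-- D_k and g_k are cut at the same z. For odd k the factors of g_k exceed 1, but the product of both
-- factors at p is a proportion of residue tuples, so each truncation lies in [0, 1] and its steps
-- can be bounded by counting.
--
-- Errors are measured in units of n^(k-1)/Z with Z = z + 1: boundary terms cost 1, the sieve tail
-- 16, the density tail 16. Each 16 is 2 * 8, from p(p+1) ≤ 2p² and from k² ≤ 8(k-1)!. If 2^m ≤ n <
-- 2^(m+1), then log n ≤ m + 3 ≤ 8Z, so the final constant is 8 * 33 = 264 ≤ 707. For k ≥ 3 the size
-- of n is used in the form n ≥ 2^(k 2^(k+2)), which follows from e ≥ 2.

module LatticeSums where

  open import Data.Nat
  open import Data.Nat.Properties
  open import Data.Nat.Tactic.RingSolver using (solve-∀)
  open import Data.Sum using (inj₁; inj₂)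
  open import Data.Vec using (Vec; []; _∷_)
  open import Data.Product using (_×_; proj₁; proj₂)
  open import Data.Unit using (⊤)
  open import Function using (_∘_)
  open import Relation.Nullary using (yes; no)
  open import Relation.Binary.PropositionalEquality
  open ≤-Reasoning

  -- Finite sums and summation by parts.

  ∑ : ℕ → (ℕ → ℕ) → ℕ
  ∑ zero    f = 0
  ∑ (suc n) f = ∑ n f + f n

  ∑-cong< : ∀ n {f g : ℕ → ℕ} → (∀ x → x < n → f x ≡ g x) → ∑ n f ≡ ∑ n g
  ∑-cong< zero    h = refl
  ∑-cong< (suc n) h = cong₂ _+_ (∑-cong< n λ x x<n → h x (m<n⇒m<1+n x<n)) (h n ≤-refl)

  ∑-cong : ∀ n {f g : ℕ → ℕ} → (∀ x → f x ≡ g x) → ∑ n f ≡ ∑ n g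
  ∑-cong n h = ∑-cong< n λ x _ → h x

  ∑-mono< : ∀ n {f g : ℕ → ℕ} → (∀ x → x < n → f x ≤ g x) → ∑ n f ≤ ∑ n g
  ∑-mono< zero    h = z≤n
  ∑-mono< (suc n) h = +-mono-≤ (∑-mono< n λ x x<n → h x (m<n⇒m<1+n x<n)) (h n ≤-refl)

  ∑-mono : ∀ n {f g : ℕ → ℕ} → (∀ x → f x ≤ g x) → ∑ n f ≤ ∑ n g
  ∑-mono n h = ∑-mono< n λ x _ → h x

  ∑-zero : ∀ n → ∑ n (λ _ → 0) ≡ 0
  ∑-zero zero    = refl
  ∑-zero (suc n) = trans (+-identityʳ _) (∑-zero n)

  ∑-const : ∀ n c → ∑ n (λ _ → c) ≡ n * c
  ∑-const zero    c = refl
  ∑-const (suc n) c = trans (cong (_+ c) (∑-const n c)) (+-comm (n * c) c)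

  ∑-+ : ∀ n (f g : ℕ → ℕ) → ∑ n (λ x → f x + g x) ≡ ∑ n f + ∑ n g
  ∑-+ zero    f g = refl
  ∑-+ (suc n) f g = trans (cong (_+ (f n + g n)) (∑-+ n f g)) (lem (∑ n f) (∑ n g) (f n) (g n))
    where
    lem : ∀ a b c d → a + b + (c + d) ≡ a + c + (b + d)
    lem = solve-∀

  ∑-*ˡ : ∀ n c (f : ℕ → ℕ) → ∑ n (λ x → c * f x) ≡ c * ∑ n f
  ∑-*ˡ zero    c f = sym (*-zeroʳ c)
  ∑-*ˡ (suc n) c f = trans (cong (_+ c * f n) (∑-*ˡ n c f)) (sym (*-distribˡ-+ c (∑ n f) (f n)))

  ∑-*ʳ : ∀ n c (f : ℕ → ℕ) → ∑ n (λ x → f x * c) ≡ ∑ n f * c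
  ∑-*ʳ n c f = trans (∑-cong n λ x → *-comm (f x) c) (trans (∑-*ˡ n c f) (*-comm c (∑ n f)))

  ∑-split : ∀ a b (f : ℕ → ℕ) → ∑ (a + b) f ≡ ∑ a f + ∑ b (λ x → f (a + x))
  ∑-split a zero    f = trans (cong (λ t → ∑ t f) (+-identityʳ a)) (sym (+-identityʳ _))
  ∑-split a (suc b) f = trans (cong (λ t → ∑ t f) (+-suc a b))
    (trans (cong (_+ f (a + b)) (∑-split a b f)) (+-assoc (∑ a f) _ _))

  ∑-first : ∀ n (f : ℕ → ℕ) → ∑ (suc n) f ≡ f 0 + ∑ n (λ x → f (suc x))
  ∑-first n f = ∑-split 1 n f

  ∑-swap : ∀ m n (f : ℕ → ℕ → ℕ) → ∑ m (λ x → ∑ n (f x)) ≡ ∑ n (λ y → ∑ m (λ x → f x y))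
  ∑-swap zero    n f = sym (∑-zero n)
  ∑-swap (suc m) n f = trans (cong (_+ ∑ n (f m)) (∑-swap m n f)) (sym (∑-+ n _ (f m)))

  ∑-rev : ∀ n (f : ℕ → ℕ) → ∑ n (λ x → f (n ∸ suc x)) ≡ ∑ n f
  ∑-rev zero    f = refl
  ∑-rev (suc n) f = trans (∑-first n (λ x → f (n ∸ x)))
    (trans (cong (f n +_) (∑-rev n f)) (+-comm (f n) _))

  ∑-≤-extend : ∀ {m n} (f : ℕ → ℕ) → m ≤ n → ∑ m f ≤ ∑ n f
  ∑-≤-extend {m} {n} f m≤n = subst (λ t → ∑ m f ≤ ∑ t f) (m+[n∸m]≡n m≤n)
    (subst (∑ m f ≤_) (sym (∑-split m (n ∸ m) f)) (m≤m+n _ _))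

  ∑-single : ∀ n (f : ℕ → ℕ) x → x < n → (∀ y → y < n → y ≢ x → f y ≡ 0) → ∑ n f ≡ f x
  ∑-single (suc n) f x x<1+n h with x ≟ n
  ... | yes refl = cong (_+ f n) (trans (∑-cong< n λ y y<n → h y (m<n⇒m<1+n y<n) (<⇒≢ y<n)) (∑-zero n))
  ... | no x≢n   = trans (cong₂ _+_ (∑-single n f x (≤∧≢⇒< (≤-pred x<1+n) x≢n) λ y y<n → h y (m<n⇒m<1+n y<n))
                                    (h n ≤-refl (x≢n ∘ sym))) (+-identityʳ (f x))

  Periodic₁ : ℕ → (ℕ → ℕ) → Set
  Periodic₁ M h = ∀ x → h (M + x) ≡ h x

  ∑-shift : ∀ M (h : ℕ → ℕ) → Periodic₁ M h → ∑ M (λ x → h (suc x)) ≡ ∑ M h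
  ∑-shift M h per = +-cancelˡ-≡ (h 0) _ _ (trans (sym (∑-first M h))
    (trans (+-comm (∑ M h) (h M)) (cong (_+ ∑ M h) (trans (cong h (sym (+-identityʳ M))) (per 0)))))

  ∑-periods : ∀ M (h : ℕ → ℕ) → Periodic₁ M h → ∀ b → ∑ (b * M) h ≡ b * ∑ M h
  ∑-periods M h per zero    = refl
  ∑-periods M h per (suc b) = trans (∑-split M (b * M) h)
    (cong (∑ M h +_) (trans (∑-cong (b * M) per) (∑-periods M h per b)))

  -- Summation by parts with step M: for M-periodic h only the first period of ∑ h x (Ψ x ∸ Ψ (M + x)) survives.
  module _ (M : ℕ) (h : ℕ → ℕ) (per : Periodic₁ M h) (N : ℕ) (φ Ψ : ℕ → ℕ) where

    private
      Ψ-sum : ∑ M (λ x → h x * Ψ x) + ∑ N (λ x → h x * Ψ (M + x)) ≡ ∑ (N + M) (λ x → h x * Ψ x)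
      Ψ-sum = begin-equality
        ∑ M (λ x → h x * Ψ x) + ∑ N (λ x → h x * Ψ (M + x))
          ≡⟨ cong (∑ M (λ x → h x * Ψ x) +_) (∑-cong N λ x → cong (_* Ψ (M + x)) (sym (per x))) ⟩
        ∑ M (λ x → h x * Ψ x) + ∑ N (λ x → h (M + x) * Ψ (M + x))
          ≡⟨ sym (∑-split M N (λ x → h x * Ψ x)) ⟩
        ∑ (M + N) (λ x → h x * Ψ x)
          ≡⟨ cong (λ t → ∑ t (λ x → h x * Ψ x)) (+-comm M N) ⟩
        ∑ (N + M) (λ x → h x * Ψ x) ∎

    telescope-≤ : (∀ x → x < N → φ x + Ψ (M + x) ≤ Ψ x) →
                  ∑ N (λ x → h x * φ x) ≤ ∑ M (λ x → h x * Ψ x)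
    telescope-≤ step = +-cancelʳ-≤ (∑ N (λ x → h x * Ψ (M + x))) _ _ (begin
      ∑ N (λ x → h x * φ x) + ∑ N (λ x → h x * Ψ (M + x))
        ≡⟨ sym (∑-+ N _ _) ⟩
      ∑ N (λ x → h x * φ x + h x * Ψ (M + x))
        ≤⟨ ∑-mono< N (λ x x<N → ≤-trans (≤-reflexive (sym (*-distribˡ-+ (h x) (φ x) (Ψ (M + x)))))
                                         (*-monoʳ-≤ (h x) (step x x<N))) ⟩
      ∑ N (λ x → h x * Ψ x)
        ≤⟨ ∑-≤-extend _ (m≤m+n N M) ⟩
      ∑ (N + M) (λ x → h x * Ψ x)
        ≡⟨ sym Ψ-sum ⟩
      ∑ M (λ x → h x * Ψ x) + ∑ N (λ x → h x * Ψ (M + x)) ∎)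

    -- In this direction the part of the sum beyond `N` cannot be discarded, hence the condition
    -- that `Ψ` vanishes there.
    telescope-≥ : (∀ x → x < N → Ψ x ≤ φ x + Ψ (M + x)) → (∀ y → Ψ (N + y) ≡ 0) →
                  ∑ M (λ x → h x * Ψ x) ≤ ∑ N (λ x → h x * φ x)
    telescope-≥ step vanish = +-cancelʳ-≤ (∑ N (λ x → h x * Ψ (M + x))) _ _ (begin
      ∑ M (λ x → h x * Ψ x) + ∑ N (λ x → h x * Ψ (M + x))
        ≡⟨ Ψ-sum ⟩
      ∑ (N + M) (λ x → h x * Ψ x)
        ≡⟨ ∑-split N M _ ⟩
      ∑ N (λ x → h x * Ψ x) + ∑ M (λ x → h (N + x) * Ψ (N + x))
        ≡⟨ cong (∑ N (λ x → h x * Ψ x) +_)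
             (trans (∑-cong M λ y → trans (cong (h (N + y) *_) (vanish y)) (*-zeroʳ (h (N + y)))) (∑-zero M)) ⟩
      ∑ N (λ x → h x * Ψ x) + 0
        ≡⟨ +-identityʳ _ ⟩
      ∑ N (λ x → h x * Ψ x)
        ≤⟨ ∑-mono< N (λ x x<N → ≤-trans (*-monoʳ-≤ (h x) (step x x<N))
                                         (≤-reflexive (*-distribˡ-+ (h x) (φ x) (Ψ (M + x))))) ⟩
      ∑ N (λ x → h x * φ x + h x * Ψ (M + x))
        ≡⟨ ∑-+ N _ _ ⟩
      ∑ N (λ x → h x * φ x) + ∑ N (λ x → h x * Ψ (M + x)) ∎)

  -- A discrete mean value inequality: the increment of t^(d+1) over a step w lies between (d+1)w
  -- times the d-th powers of the two endpoints. This is the left endpoint, `bernoulli-≥` the right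
  -- one.
  bernoulli-≤ : ∀ w b d → suc d * w * b ^ d + b ^ suc d ≤ (b + w) ^ suc d
  bernoulli-≤ w b zero    = ≤-reflexive (lem w b)
    where
    lem : ∀ w b → 1 * w * 1 + b * 1 ≡ (b + w) * 1
    lem = solve-∀
  bernoulli-≤ w b (suc d) = begin
    (2 + d) * w * (b * u) + b * (b * u)          ≤⟨ m≤m+n _ (suc d * (w * w) * u) ⟩
    (2 + d) * w * (b * u) + b * (b * u) + suc d * (w * w) * u ≡⟨ lem w b u d ⟩
    (b + w) * (suc d * w * u + b * u)            ≤⟨ *-monoʳ-≤ (b + w) (bernoulli-≤ w b d) ⟩
    (b + w) * (b + w) ^ suc d                    ∎
    where
    u = b ^ d
    lem : ∀ w b u d → (2 + d) * w * (b * u) + b * (b * u) + suc d * (w * w) * u ≡ (b + w) * (suc d * w * u + b * u)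
    lem = solve-∀

  bernoulli-≥ : ∀ w b d → (b + w) ^ suc d ≤ suc d * w * (b + w) ^ d + b ^ suc d
  bernoulli-≥ w b zero    = ≤-reflexive (lem w b)
    where
    lem : ∀ w b → (b + w) * 1 ≡ 1 * w * 1 + b * 1
    lem = solve-∀
  bernoulli-≥ w b (suc d) = begin
    (b + w) * (b + w) ^ suc d                             ≤⟨ *-monoʳ-≤ (b + w) (bernoulli-≥ w b d) ⟩
    (b + w) * (suc d * w * v + b ^ suc d)                 ≡⟨ lem₁ w b v (b ^ suc d) d ⟩
    suc d * w * ((b + w) * v) + w * b ^ suc d + b * b ^ suc d
      ≤⟨ +-monoˡ-≤ (b * b ^ suc d) (+-monoʳ-≤ (suc d * w * ((b + w) * v)) (*-monoʳ-≤ w (^-monoˡ-≤ (suc d) (m≤m+n b w)))) ⟩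
    suc d * w * ((b + w) * v) + w * ((b + w) * v) + b * b ^ suc d ≡⟨ lem₂ w ((b + w) * v) (b * b ^ suc d) d ⟩
    (2 + d) * w * ((b + w) * v) + b * b ^ suc d           ∎
    where
    v = (b + w) ^ d
    lem₁ : ∀ w b v u d → (b + w) * (suc d * w * v + u) ≡ suc d * w * ((b + w) * v) + w * u + b * u
    lem₁ = solve-∀
    lem₂ : ∀ w v u d → suc d * w * v + w * v + u ≡ (2 + d) * w * v + u
    lem₂ = solve-∀

  -- Truncated subtraction is what lets the lower telescoping end at 0. If a ≤ M, then a^(d+1) ≤ M
  -- a^d is already enough.
  bernoulli-∸ : ∀ M a d → a ^ suc d ≤ suc d * M * a ^ d + (a ∸ M) ^ suc d
  bernoulli-∸ M a d with ≤-total M a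
  ... | inj₁ M≤a = subst (λ t → t ^ suc d ≤ suc d * M * t ^ d + (a ∸ M) ^ suc d) (m∸n+n≡m M≤a) (bernoulli-≥ M (a ∸ M) d)
  ... | inj₂ a≤M = begin
    a * a ^ d                             ≤⟨ *-monoˡ-≤ (a ^ d) (≤-trans a≤M (m≤m+n M (d * M))) ⟩
    suc d * M * a ^ d                     ≤⟨ m≤m+n _ _ ⟩
    suc d * M * a ^ d + (a ∸ M) ^ suc d   ∎

  -- Sums of periodic functions over a simplex.

  box : ℕ → (d : ℕ) → (Vec ℕ d → ℕ) → ℕ
  box M zero    f = f []
  box M (suc d) f = ∑ M λ x → box M d (λ xs → f (x ∷ xs))

  -- The sum of f over the positive d-tuples with sum at most N.
  simplex : (d N : ℕ) → (Vec ℕ d → ℕ) → ℕ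
  simplex zero    N f = f []
  simplex (suc d) N f = ∑ N λ x → simplex d (N ∸ suc x) (λ xs → f (suc x ∷ xs))

  Periodic : ℕ → (d : ℕ) → (Vec ℕ d → ℕ) → Set
  Periodic M zero    f = ⊤
  Periodic M (suc d) f = (∀ x xs → f (M + x ∷ xs) ≡ f (x ∷ xs)) × (∀ x → Periodic M d (λ xs → f (x ∷ xs)))

  box-cong : ∀ M d {f g : Vec ℕ d → ℕ} → (∀ xs → f xs ≡ g xs) → box M d f ≡ box M d g
  box-cong M zero    h = h []
  box-cong M (suc d) h = ∑-cong M λ x → box-cong M d λ xs → h (x ∷ xs)

  box-periodic : ∀ M K d {f : Vec ℕ (suc d) → ℕ} → Periodic M (suc d) f → Periodic₁ M (λ x → box K d (λ xs → f (x ∷ xs)))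
  box-periodic M K d per x = box-cong K d (proj₁ per x)

  module _ (M : ℕ) (h : ℕ → ℕ) (per : Periodic₁ M h) (N d c : ℕ) where

    private
      H = ∑ M h
      per′ : Periodic₁ M (h ∘ suc)
      per′ x = trans (cong h (sym (+-suc M x))) (per (suc x))

    -- One coordinate of the count. `Ψ` is a discrete primitive: over a step `M` it drops by at
    -- least (d+1)M times the inner bound. The slack `c` has been spent on the inner coordinates,
    -- and this one adds `M` to it.
    periodic-∑-≤ : suc d * M * ∑ N (λ x → h (suc x) * (N ∸ suc x + c) ^ d) ≤ H * (N + (M + c)) ^ suc d
    periodic-∑-≤ = begin
      suc d * M * ∑ N (λ x → h (suc x) * (N ∸ suc x + c) ^ d)
        ≡⟨ sym (∑-*ˡ N (suc d * M) _) ⟩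
      ∑ N (λ x → suc d * M * (h (suc x) * (N ∸ suc x + c) ^ d))
        ≡⟨ ∑-cong N (λ x → swap (suc d * M) (h (suc x)) _) ⟩
      ∑ N (λ x → h (suc x) * (suc d * M * (N ∸ suc x + c) ^ d))
        ≤⟨ telescope-≤ M (h ∘ suc) per′ N _ Ψ step ⟩
      ∑ M (λ x → h (suc x) * Ψ x)
        ≤⟨ ∑-mono M (λ x → *-monoʳ-≤ (h (suc x)) (^-monoˡ-≤ (suc d) (m∸n≤m (N + (M + c)) (suc x)))) ⟩
      ∑ M (λ x → h (suc x) * (N + (M + c)) ^ suc d)
        ≡⟨ ∑-*ʳ M _ _ ⟩
      ∑ M (h ∘ suc) * (N + (M + c)) ^ suc d
        ≡⟨ cong (_* (N + (M + c)) ^ suc d) (∑-shift M h per) ⟩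
      H * (N + (M + c)) ^ suc d ∎
      where
      swap : ∀ a b c → a * (b * c) ≡ b * (a * c)
      swap = solve-∀
      Ψ : ℕ → ℕ
      Ψ x = (N + (M + c) ∸ suc x) ^ suc d
      step : ∀ x → x < N → suc d * M * (N ∸ suc x + c) ^ d + Ψ (M + x) ≤ Ψ x
      step x x<N = subst₂ (λ s t → suc d * M * a ^ d + s ^ suc d ≤ t ^ suc d) (sym eq₁) (sym eq₂) (bernoulli-≤ M a d)
        where
        a = N ∸ suc x + c
        N≡ : N ≡ suc x + (N ∸ suc x)
        N≡ = sym (m+[n∸m]≡n x<N)
        r₁ : ∀ x y M c → suc x + y + (M + c) ≡ suc (M + x) + (y + c)
        r₁ = solve-∀
        r₂ : ∀ x y M c → suc x + y + (M + c) ≡ suc x + (y + c + M)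
        r₂ = solve-∀
        eq₁ : N + (M + c) ∸ suc (M + x) ≡ a
        eq₁ = trans (cong (_∸ suc (M + x)) (trans (cong (_+ (M + c)) N≡) (r₁ x (N ∸ suc x) M c))) (m+n∸m≡n (suc (M + x)) a)
        eq₂ : N + (M + c) ∸ suc x ≡ a + M
        eq₂ = trans (cong (_∸ suc x) (trans (cong (_+ (M + c)) N≡) (r₂ x (N ∸ suc x) M c))) (m+n∸m≡n (suc x) (a + M))

    -- The mirror image: the slack is subtracted, and truncation makes `Ψ` zero from `N` on.
    periodic-∑-≥ : H * (N ∸ (M + c)) ^ suc d ≤ suc d * M * ∑ N (λ x → h (suc x) * (N ∸ suc x ∸ c) ^ d)
    periodic-∑-≥ = begin
      H * (N ∸ (M + c)) ^ suc d
        ≡⟨ cong (_* (N ∸ (M + c)) ^ suc d) (sym (∑-shift M h per)) ⟩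
      ∑ M (h ∘ suc) * (N ∸ (M + c)) ^ suc d
        ≡⟨ sym (∑-*ʳ M _ _) ⟩
      ∑ M (λ x → h (suc x) * (N ∸ (M + c)) ^ suc d)
        ≤⟨ ∑-mono< M (λ x x<M → *-monoʳ-≤ (h (suc x)) (^-monoˡ-≤ (suc d)
             (≤-trans (≤-reflexive (sym (∸-+-assoc N M c))) (∸-monoˡ-≤ c (∸-monoʳ-≤ N x<M))))) ⟩
      ∑ M (λ x → h (suc x) * Ψ x)
        ≤⟨ telescope-≥ M (h ∘ suc) per′ N _ Ψ step vanish ⟩
      ∑ N (λ x → h (suc x) * (suc d * M * (N ∸ suc x ∸ c) ^ d))
        ≡⟨ ∑-cong N (λ x → swap (h (suc x)) (suc d * M) _) ⟩
      ∑ N (λ x → suc d * M * (h (suc x) * (N ∸ suc x ∸ c) ^ d))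
        ≡⟨ ∑-*ˡ N (suc d * M) _ ⟩
      suc d * M * ∑ N (λ x → h (suc x) * (N ∸ suc x ∸ c) ^ d) ∎
      where
      swap : ∀ a b c → a * (b * c) ≡ b * (a * c)
      swap = solve-∀
      Ψ : ℕ → ℕ
      Ψ x = (N ∸ suc x ∸ c) ^ suc d
      shift : ∀ x → N ∸ suc (M + x) ∸ c ≡ N ∸ suc x ∸ c ∸ M
      shift x = trans (∸-+-assoc N (suc (M + x)) c)
        (trans (cong (N ∸_) (lem M x c)) (trans (sym (∸-+-assoc N (suc x + c) M)) (cong (_∸ M) (sym (∸-+-assoc N (suc x) c)))))
        where
        lem : ∀ M x c → suc (M + x) + c ≡ suc x + c + M
        lem = solve-∀
      step : ∀ x → x < N → Ψ x ≤ suc d * M * (N ∸ suc x ∸ c) ^ d + Ψ (M + x)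
      step x _ = subst (λ t → Ψ x ≤ suc d * M * (N ∸ suc x ∸ c) ^ d + t ^ suc d) (sym (shift x)) (bernoulli-∸ M (N ∸ suc x ∸ c) d)
      vanish : ∀ y → Ψ (N + y) ≡ 0
      vanish y = cong (_^ suc d) (trans (cong (_∸ c) (m≤n⇒m∸n≡0 (m≤n⇒m≤1+n (m≤m+n N y)))) (0∸n≡0 c))

  private
    regroup : ∀ d f m k s → suc d * f * (m * k) * s ≡ suc d * m * (f * k * s)
    regroup = solve-∀

    simplex-suc : ∀ M d N (f : Vec ℕ (suc d) → ℕ) →
      suc d ! * M ^ suc d * simplex (suc d) N f
        ≡ suc d * M * ∑ N (λ x → d ! * M ^ d * simplex d (N ∸ suc x) (λ xs → f (suc x ∷ xs)))
    simplex-suc M d N f = trans (regroup d (d !) M (M ^ d) (simplex (suc d) N f))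
      (cong (suc d * M *_) (sym (∑-*ˡ N (d ! * M ^ d) _)))

  -- After division by d! M^d the right side is the mean of `f` over a box of residues times the
  -- volume of a simplex of side N + dM. Each coordinate enlarges the side by one period.
  simplex-≤ : ∀ M d N f → Periodic M d f → d ! * M ^ d * simplex d N f ≤ box M d f * (N + d * M) ^ d
  simplex-≤ M zero    N f per = ≤-reflexive (lem (f []))
    where
    lem : ∀ a → 1 * 1 * a ≡ a * 1
    lem = solve-∀
  simplex-≤ M (suc d) N f per = begin
    suc d ! * M ^ suc d * simplex (suc d) N f
      ≡⟨ simplex-suc M d N f ⟩
    suc d * M * ∑ N (λ x → d ! * M ^ d * simplex d (N ∸ suc x) (λ xs → f (suc x ∷ xs)))
      ≤⟨ *-monoʳ-≤ (suc d * M) (∑-mono N (λ x → simplex-≤ M d (N ∸ suc x) _ (proj₂ per (suc x)))) ⟩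
    suc d * M * ∑ N (λ x → box M d (λ xs → f (suc x ∷ xs)) * (N ∸ suc x + d * M) ^ d)
      ≤⟨ periodic-∑-≤ M _ (box-periodic M M d {f} per) N d (d * M) ⟩
    box M (suc d) f * (N + suc d * M) ^ suc d ∎

  simplex-≥ : ∀ M d N f → Periodic M d f → box M d f * (N ∸ d * M) ^ d ≤ d ! * M ^ d * simplex d N f
  simplex-≥ M zero    N f per = ≤-reflexive (lem (f []))
    where
    lem : ∀ a → a * 1 ≡ 1 * 1 * a
    lem = solve-∀
  simplex-≥ M (suc d) N f per = begin
    box M (suc d) f * (N ∸ suc d * M) ^ suc d
      ≤⟨ periodic-∑-≥ M _ (box-periodic M M d {f} per) N d (d * M) ⟩
    suc d * M * ∑ N (λ x → box M d (λ xs → f (suc x ∷ xs)) * (N ∸ suc x ∸ d * M) ^ d)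
      ≤⟨ *-monoʳ-≤ (suc d * M) (∑-mono N (λ x → simplex-≥ M d (N ∸ suc x) _ (proj₂ per (suc x)))) ⟩
    suc d * M * ∑ N (λ x → d ! * M ^ d * simplex d (N ∸ suc x) (λ xs → f (suc x ∷ xs)))
      ≡⟨ sym (simplex-suc M d N f) ⟩
    suc d ! * M ^ suc d * simplex (suc d) N f ∎

-- The Chinese remainder theorem for sums, and primorials.

module PrimeProducts where

  open import Data.Nat
  open import Data.Nat.Properties
  open import Data.Nat.Coprimality using (Coprime; coprime-divisor)
  open import Data.Nat.Divisibility
  open import Data.Nat.DivMod
  open import Data.Nat.Combinatorics using (k![n∸k]!∣n!)
  open import Data.Nat.Primality
  open import Data.Nat.Tactic.RingSolver using (solve-∀)
  open import Data.Vec using (Vec; _∷_)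
  open import Data.Product using (∃; _,_; proj₁; proj₂)
  open import Data.Sum using (inj₁; inj₂; reduce)
  open import Data.Empty using (⊥; ⊥-elim)
  open import Data.Unit using (tt)
  open import Function using (_∘_)
  open import Relation.Nullary using (¬_; Dec; yes; no)
  open import Relation.Binary.PropositionalEquality
  open LatticeSums
  open ≤-Reasoning

  𝟙[_] : {P : Set} → Dec P → ℕ
  𝟙[ yes _ ] = 1
  𝟙[ no _ ]  = 0

  𝟙-yes : {P : Set} (d : Dec P) → P → 𝟙[ d ] ≡ 1
  𝟙-yes (yes _) _ = refl
  𝟙-yes (no ¬p) p = ⊥-elim (¬p p)

  𝟙-no : {P : Set} (d : Dec P) → ¬ P → 𝟙[ d ] ≡ 0
  𝟙-no (yes p) ¬p = ⊥-elim (¬p p)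
  𝟙-no (no _)  _  = refl

  𝟙-⇔ : {P Q : Set} (d : Dec P) (e : Dec Q) → (P → Q) → (Q → P) → 𝟙[ d ] ≡ 𝟙[ e ]
  𝟙-⇔ (yes p) e f g = sym (𝟙-yes e (f p))
  𝟙-⇔ (no ¬p) e f g = sym (𝟙-no e (¬p ∘ g))

  𝟙≤1 : {P : Set} (d : Dec P) → 𝟙[ d ] ≤ 1
  𝟙≤1 (yes _) = ≤-refl
  𝟙≤1 (no _)  = z≤n

  1≤𝟙⇒ : {P : Set} (d : Dec P) → 1 ≤ 𝟙[ d ] → P
  1≤𝟙⇒ (yes p) _ = p

  ∑-at-most-one : ∀ n (f : ℕ → ℕ) → (∀ x → x < n → f x ≤ 1) →
                  (∀ x y → x < y → y < n → 1 ≤ f x → 1 ≤ f y → ⊥) → ∑ n f ≤ 1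
  ∑-at-most-one zero    f f≤1 uniq = z≤n
  ∑-at-most-one (suc n) f f≤1 uniq with f n in eq
  ... | zero  = subst (_≤ 1) (sym (+-identityʳ (∑ n f))) (∑-at-most-one n f (λ x x<n → f≤1 x (m<n⇒m<1+n x<n))
                  (λ x y x<y y<n → uniq x y x<y (m<n⇒m<1+n y<n)))
  ... | suc m = subst (λ t → t + suc m ≤ 1) (sym rest≡0) (subst (_≤ 1) eq (f≤1 n ≤-refl))
    where
    none : ∀ x → x < n → f x ≡ 0
    none x x<n with f x in fx
    ... | zero  = refl
    ... | suc _ = ⊥-elim (uniq x n x<n ≤-refl (subst (1 ≤_) (sym fx) (s≤s z≤n)) (subst (1 ≤_) (sym eq) (s≤s z≤n)))
    rest≡0 : ∑ n f ≡ 0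
    rest≡0 = trans (∑-cong< n none) (∑-zero n)

  ∑-full : ∀ n (f : ℕ → ℕ) → (∀ x → x < n → f x ≤ 1) → ∑ n f ≡ n → ∀ x → x < n → f x ≡ 1
  ∑-full (suc n) f f≤1 full x x<1+n = go (m≤n⇒m<n∨m≡n (≤-pred x<1+n))
    where
    ∑≤n : ∑ n f ≤ n
    ∑≤n = ≤-trans (∑-mono< n (λ y y<n → f≤1 y (m<n⇒m<1+n y<n))) (≤-reflexive (trans (∑-const n 1) (*-identityʳ n)))
    fn≡1 : f n ≡ 1
    fn≡1 = ≤-antisym (f≤1 n ≤-refl) (+-cancelˡ-≤ n 1 (f n)
      (≤-trans (≤-reflexive (trans (+-comm n 1) (sym full))) (+-monoˡ-≤ (f n) ∑≤n)))
    go : _ → f x ≡ 1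
    go (inj₁ x<n) = ∑-full n f (λ y y<n → f≤1 y (m<n⇒m<1+n y<n))
      (+-cancelʳ-≡ 1 (∑ n f) n (trans (cong (∑ n f +_) (sym fn≡1)) (trans full (+-comm 1 n)))) x x<n
    go (inj₂ x≡n) = trans (cong f x≡n) fn≡1

  %≡%⇒∣∸ : ∀ p .{{_ : NonZero p}} a b → a % p ≡ b % p → p ∣ b ∸ a
  %≡%⇒∣∸ p a b eq = divides (b / p ∸ a / p) (begin-equality
    b ∸ a                                     ≡⟨ cong₂ _∸_ (m≡m%n+[m/n]*n b p) (m≡m%n+[m/n]*n a p) ⟩
    b % p + b / p * p ∸ (a % p + a / p * p)   ≡⟨ cong (λ t → b % p + b / p * p ∸ (t + a / p * p)) eq ⟩
    b % p + b / p * p ∸ (b % p + a / p * p)   ≡⟨ [m+n]∸[m+o]≡n∸o (b % p) _ _ ⟩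
    b / p * p ∸ a / p * p                     ≡⟨ sym (*-distribʳ-∸ p (b / p) (a / p)) ⟩
    (b / p ∸ a / p) * p                       ∎)

  periodic-multiple : ∀ M (h : ℕ → ℕ) → Periodic₁ M h → ∀ b x → h (b * M + x) ≡ h x
  periodic-multiple M h per zero    x = refl
  periodic-multiple M h per (suc b) x = trans (cong h (+-assoc M (b * M) x))
    (trans (per (b * M + x)) (periodic-multiple M h per b x))

  ∑-translate : ∀ M (h : ℕ → ℕ) → Periodic₁ M h → ∀ s → ∑ M (λ x → h (s + x)) ≡ ∑ M h
  ∑-translate M h per zero    = refl
  ∑-translate M h per (suc s) = trans (∑-cong M λ x → cong h (sym (+-suc s x)))
    (trans (∑-shift M (λ x → h (s + x)) λ x → trans (cong h (lem s M x)) (per (s + x))) (∑-translate M h per s))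
    where
    lem : ∀ s M x → s + (M + x) ≡ M + (s + x)
    lem = solve-∀

  periodic-% : ∀ p .{{_ : NonZero p}} (h : ℕ → ℕ) → Periodic₁ p h → ∀ y → h y ≡ h (y % p)
  periodic-% p h per y = trans (cong h (trans (m≡m%n+[m/n]*n y p) (+-comm (y % p) _))) (periodic-multiple p h per (y / p) (y % p))

  module _ (M p : ℕ) .{{_ : NonZero p}} (cop : Coprime p M) (r : ℕ) where

    private
      hit : ℕ → ℕ → ℕ
      hit t s = 𝟙[ (r + t * M) % p ≟ s ]

      unique : ∀ s x y → x < y → y < p → 1 ≤ hit x s → 1 ≤ hit y s → ⊥
      unique s x y x<y y<p hx hy = <⇒≱ (≤-<-trans (m∸n≤m y x) y<p) (∣⇒≤ {{>-nonZero (m<n⇒0<n∸m x<y)}} p∣y-x)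
        where
        p∣diff : p ∣ (r + y * M) ∸ (r + x * M)
        p∣diff = %≡%⇒∣∸ p (r + x * M) (r + y * M) (trans (1≤𝟙⇒ (_ ≟ s) hx) (sym (1≤𝟙⇒ (_ ≟ s) hy)))
        p∣y-x : p ∣ y ∸ x
        p∣y-x = coprime-divisor cop (subst (p ∣_)
          (trans ([m+n]∸[m+o]≡n∸o r _ _) (trans (sym (*-distribʳ-∸ M y x)) (*-comm (y ∸ x) M))) p∣diff)

      column≤1 : ∀ s → s < p → ∑ p (λ t → hit t s) ≤ 1
      column≤1 s _ = ∑-at-most-one p _ (λ t _ → 𝟙≤1 (_ ≟ s)) (unique s)

      expand : ∀ (w : ℕ → ℕ) t → ∑ p (λ s → hit t s * w s) ≡ w ((r + t * M) % p)
      expand w t = trans (∑-single p _ y (m%n<n (r + t * M) p) λ s _ s≢y → cong (_* w s) (𝟙-no (y ≟ s) (s≢y ∘ sym)))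
        (trans (cong (_* w y) (𝟙-yes (y ≟ y) refl)) (+-identityʳ (w y)))
        where y = (r + t * M) % p

      column≡1 : ∀ s → s < p → ∑ p (λ t → hit t s) ≡ 1
      column≡1 = ∑-full p _ column≤1 (begin-equality
        ∑ p (λ s → ∑ p (λ t → hit t s))       ≡⟨ ∑-swap p p (λ s t → hit t s) ⟩
        ∑ p (λ t → ∑ p (λ s → hit t s))       ≡⟨ ∑-cong p (λ t → trans (∑-cong p λ s → sym (*-identityʳ (hit t s))) (expand (λ _ → 1) t)) ⟩
        ∑ p (λ t → 1)                         ≡⟨ trans (∑-const p 1) (*-identityʳ p) ⟩
        p                                     ∎)

    -- `hit` is a p × p matrix of zeros and ones. Every row sums to 1, and coprimality bounds every
    -- column sum by 1; the total is p both ways, so every column sums to 1 and r + tM meets each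
    -- residue once.
    ∑-dilate : ∀ (h : ℕ → ℕ) → Periodic₁ p h → ∑ p (λ t → h (r + t * M)) ≡ ∑ p h
    ∑-dilate h per = begin-equality
      ∑ p (λ t → h (r + t * M))             ≡⟨ ∑-cong p (λ t → trans (periodic-% p h per _) (sym (expand h t))) ⟩
      ∑ p (λ t → ∑ p (λ s → hit t s * h s)) ≡⟨ ∑-swap p p (λ t s → hit t s * h s) ⟩
      ∑ p (λ s → ∑ p (λ t → hit t s * h s)) ≡⟨ ∑-cong p (λ s → ∑-*ʳ p (h s) (λ t → hit t s)) ⟩
      ∑ p (λ s → ∑ p (λ t → hit t s) * h s) ≡⟨ ∑-cong< p (λ s s<p → trans (cong (_* h s) (column≡1 s s<p)) (*-identityˡ (h s))) ⟩
      ∑ p h                                 ∎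

  ∑-blocks : ∀ b M (h : ℕ → ℕ) → ∑ (b * M) h ≡ ∑ b (λ t → ∑ M (λ r → h (t * M + r)))
  ∑-blocks zero    M h = refl
  ∑-blocks (suc b) M h = trans (cong (λ t → ∑ t h) (+-comm M (b * M)))
    (trans (∑-split (b * M) M h) (cong (_+ ∑ M (λ r → h (b * M + r))) (∑-blocks b M h)))

  -- Write x = tM + r. Then `f` sees only `r`, and for fixed `r` the argument of `g` runs through
  -- all residues modulo p as `t` varies.
  crt₁ : ∀ M p .{{_ : NonZero p}} → Coprime p M → ∀ f g → Periodic₁ M f → Periodic₁ p g →
         ∑ (p * M) (λ x → f x * g x) ≡ ∑ M f * ∑ p g
  crt₁ M p cop f g perf perg = begin-equality
    ∑ (p * M) (λ x → f x * g x)
      ≡⟨ ∑-blocks p M _ ⟩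
    ∑ p (λ t → ∑ M (λ r → f (t * M + r) * g (t * M + r)))
      ≡⟨ ∑-cong p (λ t → ∑-cong M λ r → cong₂ _*_ (periodic-multiple M f perf t r) (cong g (+-comm (t * M) r))) ⟩
    ∑ p (λ t → ∑ M (λ r → f r * g (r + t * M)))
      ≡⟨ ∑-swap p M _ ⟩
    ∑ M (λ r → ∑ p (λ t → f r * g (r + t * M)))
      ≡⟨ ∑-cong M (λ r → trans (∑-*ˡ p (f r) _) (cong (f r *_) (∑-dilate M p cop r g perg))) ⟩
    ∑ M (λ r → f r * ∑ p g)
      ≡⟨ ∑-*ʳ M (∑ p g) f ⟩
    ∑ M f * ∑ p g ∎

  crt : ∀ M p .{{_ : NonZero p}} → Coprime p M → ∀ d f g → Periodic M d f → Periodic p d g →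
        box (p * M) d (λ xs → f xs * g xs) ≡ box M d f * box p d g
  crt M p cop zero    f g perf perg = refl
  crt M p cop (suc d) f g perf perg = trans
    (∑-cong (p * M) λ x → crt M p cop d _ _ (proj₂ perf x) (proj₂ perg x))
    (crt₁ M p cop _ _ (box-periodic M M d {f} perf) (box-periodic p p d {g} perg))

  Periodic-zip : (_∙_ : ℕ → ℕ → ℕ) → ∀ M d f g → Periodic M d f → Periodic M d g → Periodic M d (λ xs → f xs ∙ g xs)
  Periodic-zip _∙_ M zero    f g perf perg = tt
  Periodic-zip _∙_ M (suc d) f g perf perg =
    (λ x xs → cong₂ _∙_ (proj₁ perf x xs) (proj₁ perg x xs)) ,
    (λ x → Periodic-zip _∙_ M d _ _ (proj₂ perf x) (proj₂ perg x))

  Periodic-multiple : ∀ M d f b → Periodic M d f → Periodic (b * M) d f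
  Periodic-multiple M zero    f b per = tt
  Periodic-multiple M (suc d) f b per =
    (λ x xs → periodic-multiple M (λ y → f (y ∷ xs)) (λ y → proj₁ per y xs) b x) ,
    (λ x → Periodic-multiple M d _ b (proj₂ per x))

  Periodic-const : ∀ M d c → Periodic M d (λ _ → c)
  Periodic-const M zero    c = tt
  Periodic-const M (suc d) c = (λ _ _ → refl) , λ _ → Periodic-const M d c

  -- Products over primes and their periods.

  ∏ₚ : (ℕ → ℕ) → ℕ → ℕ
  ∏ₚ h zero    = 1
  ∏ₚ h (suc z) with prime? (suc z)
  ... | yes _ = ∏ₚ h z * h (suc z)
  ... | no _  = ∏ₚ h z

  primorial : ℕ → ℕ
  primorial = ∏ₚ (λ p → p)

  primorial>0 : ∀ z → 0 < primorial z
  primorial>0 zero    = s≤s z≤n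
  primorial>0 (suc z) with prime? (suc z)
  ... | yes _ = *-mono-≤ (primorial>0 z) (s≤s (z≤n {z}))
  ... | no _  = primorial>0 z

  ∣1⇒¬prime : ∀ {p} → Prime p → ¬ (p ∣ 1)
  ∣1⇒¬prime pr p∣1 = ¬prime[1] (subst Prime (∣1⇒≡1 p∣1) pr)

  prime∣primorial⇒≤ : ∀ z {p} → Prime p → p ∣ primorial z → p ≤ z
  prime∣primorial⇒≤ zero    pr p∣1 = ⊥-elim (∣1⇒¬prime pr p∣1)
  prime∣primorial⇒≤ (suc z) pr p∣ with prime? (suc z)
  ... | no _  = m≤n⇒m≤1+n (prime∣primorial⇒≤ z pr p∣)
  ... | yes _ with euclidsLemma (primorial z) (suc z) pr p∣
  ...   | inj₁ p∣P = m≤n⇒m≤1+n (prime∣primorial⇒≤ z pr p∣P)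
  ...   | inj₂ p∣z = ∣⇒≤ p∣z

  prime∧∤⇒coprime : ∀ {p m} → Prime p → ¬ (p ∣ m) → Coprime p m
  prime∧∤⇒coprime pr p∤m (d∣p , d∣m) with prime⇒irreducible pr d∣p
  ... | inj₁ d≡1  = d≡1
  ... | inj₂ refl = ⊥-elim (p∤m d∣m)

  coprime-primorial : ∀ z → Prime (suc z) → Coprime (suc z) (primorial z)
  coprime-primorial z pr = prime∧∤⇒coprime pr λ p∣P → <-irrefl refl (prime∣primorial⇒≤ z pr p∣P)

  Periodic-∏ₚ : ∀ d (χ : ℕ → Vec ℕ d → ℕ) → (∀ p → Prime p → Periodic p d (χ p)) → ∀ z →
                Periodic (primorial z) d (λ xs → ∏ₚ (λ p → χ p xs) z)
  Periodic-∏ₚ d χ per zero    = Periodic-const 1 d 1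
  Periodic-∏ₚ d χ per (suc z) with prime? (suc z)
  ... | no _   = Periodic-∏ₚ d χ per z
  ... | yes pr = Periodic-zip _*_ (primorial z * suc z) d (λ xs → ∏ₚ (λ p → χ p xs) z) (χ (suc z))
    (subst (λ t → Periodic t d (λ xs → ∏ₚ (λ p → χ p xs) z)) (*-comm (suc z) (primorial z)) (Periodic-multiple (primorial z) d _ (suc z) (Periodic-∏ₚ d χ per z)))
    (Periodic-multiple (suc z) d (χ (suc z)) (primorial z) (per (suc z) pr))

  box-∏ₚ : ∀ d (χ : ℕ → Vec ℕ d → ℕ) → (∀ p → Prime p → Periodic p d (χ p)) → ∀ z →
           box (primorial z) d (λ xs → ∏ₚ (λ p → χ p xs) z) ≡ ∏ₚ (λ p → box p d (χ p)) z
  box-∏ₚ d χ per zero    = box-one d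
    where
    box-one : ∀ d → box 1 d (λ _ → 1) ≡ 1
    box-one zero    = refl
    box-one (suc d) = box-one d
  box-∏ₚ d χ per (suc z) with prime? (suc z)
  ... | no _   = box-∏ₚ d χ per z
  ... | yes pr = trans (cong (λ t → box t d (λ xs → ∏ₚ (λ p → χ p xs) z * χ (suc z) xs)) (*-comm (primorial z) (suc z)))
    (trans (crt (primorial z) (suc z) (coprime-primorial z pr) d _ _ (Periodic-∏ₚ d χ per z) (per (suc z) pr))
           (cong (_* box (suc z) d (χ (suc z))) (box-∏ₚ d χ per z)))

  -- Chebyshev's upper bound for the primorial.

  coprime-*-∣ : ∀ {p m x} → Coprime p m → m ∣ x → p ∣ x → m * p ∣ x
  coprime-*-∣ {p} {m} cop (divides q refl) p∣qm with coprime-divisor cop (subst (p ∣_) (*-comm q m) p∣qm)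
  ... | divides q′ refl = divides q′ (lem q′ p m)
    where
    lem : ∀ q p m → q * p * m ≡ q * (m * p)
    lem = solve-∀

  -- The primes of the interval enter one at a time; each is coprime to the primorial collected so
  -- far, so divisibility by both gives divisibility by their product.
  primorial-∣ : ∀ z L X → (∀ p → Prime p → z < p → p ≤ z + L → p ∣ X) → primorial (z + L) ∣ primorial z * X
  primorial-∣ z zero    X h rewrite +-identityʳ z = m∣m*n X
  primorial-∣ z (suc L) X h rewrite +-suc z L with prime? (suc (z + L))
  ... | no _   = primorial-∣ z L X (λ p pr z<p p≤ → h p pr z<p (m≤n⇒m≤1+n p≤))
  ... | yes pr = coprime-*-∣ (coprime-primorial (z + L) pr)
    (primorial-∣ z L X (λ p pr z<p p≤ → h p pr z<p (m≤n⇒m≤1+n p≤)))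
    (∣n⇒∣m*n (primorial z) (h (suc (z + L)) pr (s≤s (m≤m+n z L)) ≤-refl))

  prime∣!⇒≤ : ∀ n {p} → Prime p → p ∣ n ! → p ≤ n
  prime∣!⇒≤ zero    pr p∣1 = ⊥-elim (∣1⇒¬prime pr p∣1)
  prime∣!⇒≤ (suc n) pr p∣ with euclidsLemma (suc n) (n !) pr p∣
  ... | inj₁ p∣n  = ∣⇒≤ p∣n
  ... | inj₂ p∣n! = m≤n⇒m≤1+n (prime∣!⇒≤ n pr p∣n!)

  ∣! : ∀ {p n} .{{_ : NonZero p}} → p ≤ n → p ∣ n !
  ∣! {suc p} p≤n = ∣-trans (m∣m*n (p !)) (m≤n⇒m!∣n! p≤n)

  abstract
    -- The central binomial coefficient, kept `abstract` so that only its defining equation is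
    -- visible.
    central : ∀ z → ∃ λ C → C * (z ! * z !) ≡ (z + z) !
    central z with k![n∸k]!∣n! (m≤m+n z z)
    ... | divides C eq = C , trans (cong (λ t → C * (z ! * t !)) (sym (m+n∸m≡n z z))) (sym eq)

  central>0 : ∀ z → 0 < proj₁ (central z)
  central>0 z = n≢0⇒n>0 λ C≡0 →
    <-irrefl (trans (cong (_* (z ! * z !)) (sym C≡0)) (proj₂ (central z))) (>-nonZero⁻¹ _ {{(z + z) !≢0}})

  -- The ratio of consecutive coefficients is at most 4, because (2z+1)(2z+2) ≤ (2z+2)² = 4(z+1)².
  central-≤ : ∀ z → proj₁ (central z) ≤ 4 ^ z
  central-≤ zero    = ≤-reflexive (trans (sym (*-identityʳ _)) (proj₂ (central 0)))
  central-≤ (suc z) = *-cancelʳ-≤ C′ (4 * 4 ^ z) (suc z * f * (suc z * f)) {{m*n≢0 _ _ {{m*n≢0 (suc z) f {{_}} {{z !≢0}}}} {{m*n≢0 (suc z) f {{_}} {{z !≢0}}}}}} (begin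
    C′ * (suc z * f * (suc z * f))             ≡⟨ proj₂ (central (suc z)) ⟩
    (suc z + suc z) !                          ≡⟨ cong (λ t → suc t !) (+-suc z z) ⟩
    (2 + (z + z)) * ((1 + (z + z)) * (z + z) !)  ≡⟨ cong (λ t → (2 + (z + z)) * ((1 + (z + z)) * t)) (sym (proj₂ (central z))) ⟩
    (2 + (z + z)) * ((1 + (z + z)) * (C * (f * f))) ≤⟨ *-monoʳ-≤ (2 + (z + z)) (*-mono-≤ (n≤1+n (1 + (z + z))) (*-monoˡ-≤ (f * f) (central-≤ z))) ⟩
    (2 + (z + z)) * ((2 + (z + z)) * (4 ^ z * (f * f))) ≡⟨ lem z (4 ^ z) f ⟩
    4 * 4 ^ z * (suc z * f * (suc z * f))      ∎)
    where
    f = z !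
    C = proj₁ (central z)
    C′ = proj₁ (central (suc z))
    lem : ∀ z u f → (2 + (z + z)) * ((2 + (z + z)) * (u * (f * f))) ≡ 4 * u * (suc z * f * (suc z * f))
    lem = solve-∀

  -- Such a p divides (2z)! but not (z!)², whose prime factors are at most z.
  prime∣central : ∀ z p → Prime p → z < p → p ≤ z + z → p ∣ proj₁ (central z)
  prime∣central z p pr z<p p≤2z with euclidsLemma C (z ! * z !) pr (subst (p ∣_) (sym (proj₂ (central z))) (∣! {{prime⇒nonZero pr}} p≤2z))
    where C = proj₁ (central z)
  ... | inj₁ p∣C = p∣C
  ... | inj₂ p∣z!z! = ⊥-elim (<⇒≱ z<p (prime∣!⇒≤ z pr (reduce (euclidsLemma (z !) (z !) pr p∣z!z!))))

  -- Erdős's doubling argument: all primes in (z, 2z] divide the central binomial coefficient.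
  -- Restricting to powers of two makes doubling the whole induction.
  primorial-2^-≤ : ∀ j → primorial (2 ^ j) ≤ 4 ^ (2 ^ j)
  primorial-2^-≤ zero    = s≤s z≤n
  primorial-2^-≤ (suc j) = begin
    primorial (2 * z)                   ≡⟨ cong (λ t → primorial (z + t)) (+-identityʳ z) ⟩
    primorial (z + z)                   ≤⟨ ∣⇒≤ {{>-nonZero (*-mono-≤ (primorial>0 z) (central>0 z))}} (primorial-∣ z z _ (prime∣central z)) ⟩
    primorial z * proj₁ (central z)     ≤⟨ *-mono-≤ (primorial-2^-≤ j) (central-≤ z) ⟩
    4 ^ z * 4 ^ z                       ≡⟨ sym (^-distribˡ-+-* 4 z z) ⟩
    4 ^ (z + z)                         ≡⟨ cong (λ t → 4 ^ (z + t)) (sym (+-identityʳ z)) ⟩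
    4 ^ (2 * z)                         ∎
    where z = 2 ^ j

-- Sieving the tuples with prescribed sum.

module Sieve where

  open import Data.Nat
  open import Data.Nat.Properties
  open import Data.Nat.Divisibility
  open import Data.Nat.GCD using (gcd; gcd[m,n]∣m; gcd[m,n]∣n; gcd-greatest)
  open import Data.Nat.Primality
  open import Data.Nat.Primality.Factorisation using (factorise)
  open import Data.Nat.Tactic.RingSolver using (solve-∀)
  open import Data.List as List using (List; []; _∷_; length; filter; applyUpTo; cartesianProductWith)
  open import Data.List.Properties using (filter-++; length-++)
  import Data.List.Relation.Unary.All as ListAll
  open import Data.Vec as Vec using (Vec; []; _∷_; _∷ʳ_)
  open import Data.Vec.Relation.Unary.All as All using (All; []; _∷_)
  open import Data.Vec.Relation.Unary.AllPairs using (AllPairs; allPairs?; []; _∷_)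
  open import Data.Product using (∃; ∃₂; _×_; _,_; proj₁; proj₂)
  open import Data.Sum using (inj₁; inj₂)
  open import Data.Empty using (⊥-elim)
  open import Data.Unit using (tt)
  open import Function using (_∘_)
  open import Relation.Nullary using (¬_; yes; no)
  open import Relation.Unary using (Decidable)
  open import Relation.Binary.PropositionalEquality
  open import Defs using (vectors≤; B; isCoprimeRep?)
  open LatticeSums
  open PrimeProducts
  open ≤-Reasoning

  -- The sum of F over the positive (d+1)-tuples with sum exactly N + 1.
  exact : (d N : ℕ) → (Vec ℕ (suc d) → ℕ) → ℕ
  exact zero    N F = F (suc N ∷ [])
  exact (suc d) N F = ∑ N λ x → exact d (N ∸ suc x) (λ v → F (suc x ∷ v))

  AllPositive : ∀ {k} → Vec ℕ k → Set
  AllPositive = All (1 ≤_)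

  suc-∸ : ∀ {N x} → x < N → suc x + suc (N ∸ suc x) ≡ suc N
  suc-∸ {N} {x} x<N = trans (+-suc (suc x) _) (cong suc (m+[n∸m]≡n x<N))

  exact-mono : ∀ d N {F G : Vec ℕ (suc d) → ℕ} →
    (∀ v → AllPositive v → Vec.sum v ≡ suc N → F v ≤ G v) → exact d N F ≤ exact d N G
  exact-mono zero    N h = h (suc N ∷ []) (s≤s z≤n ∷ []) (+-identityʳ (suc N))
  exact-mono (suc d) N h = ∑-mono< N λ x x<N → exact-mono d (N ∸ suc x)
    λ v v>0 eq → h (suc x ∷ v) (s≤s z≤n ∷ v>0) (trans (cong (suc x +_) eq) (suc-∸ x<N))

  exact-+ : ∀ d N (F G : Vec ℕ (suc d) → ℕ) → exact d N (λ v → F v + G v) ≡ exact d N F + exact d N G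
  exact-+ zero    N F G = refl
  exact-+ (suc d) N F G = trans (∑-cong N λ x → exact-+ d (N ∸ suc x) _ _) (∑-+ N _ _)

  exact-*ˡ : ∀ d N c (F : Vec ℕ (suc d) → ℕ) → exact d N (λ v → c * F v) ≡ c * exact d N F
  exact-*ˡ zero    N c F = refl
  exact-*ˡ (suc d) N c F = trans (∑-cong N λ x → exact-*ˡ d (N ∸ suc x) c _) (∑-*ˡ N c _)

  exact-∑ : ∀ d N L (F : ℕ → Vec ℕ (suc d) → ℕ) → exact d N (λ v → ∑ L (λ i → F i v)) ≡ ∑ L (λ i → exact d N (F i))
  exact-∑ d N zero    F = exact-*ˡ d N 0 (λ _ → 0)
  exact-∑ d N (suc L) F = trans (exact-+ d N _ (F L)) (cong (_+ exact d N (F L)) (exact-∑ d N L F))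

  -- The last entry is determined by the others, which range freely over a simplex; it is positive
  -- because they sum to at most `N`, one less than the total.
  exact≡simplex : ∀ d N (F : Vec ℕ (suc d) → ℕ) (f : Vec ℕ d → ℕ) →
    (∀ xs → Vec.sum xs ≤ N → F (xs ∷ʳ (suc N ∸ Vec.sum xs)) ≡ f xs) → exact d N F ≡ simplex d N f
  exact≡simplex zero    N F f h = h [] z≤n
  exact≡simplex (suc d) N F f h = ∑-cong< N λ x x<N → exact≡simplex d (N ∸ suc x) _ _ λ xs sum≤ →
    trans (cong (λ t → F (suc x ∷ (xs ∷ʳ t)))
            (trans (cong (_∸ Vec.sum xs) (sym (+-∸-assoc 1 x<N))) (∸-+-assoc N x (Vec.sum xs))))
          (h (suc x ∷ xs) (subst (suc x + Vec.sum xs ≤_) (m+[n∸m]≡n x<N) (+-monoʳ-≤ (suc x) sum≤)))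

  length-filter-map : ∀ {A C : Set} {P : C → Set} (P? : Decidable P) (f : A → C) xs →
                      length (filter P? (List.map f xs)) ≡ length (filter (P? ∘ f) xs)
  length-filter-map P? f []       = refl
  length-filter-map P? f (x ∷ xs) with P? (f x)
  ... | yes _ = cong suc (length-filter-map P? f xs)
  ... | no _  = length-filter-map P? f xs

  length-filter-product : ∀ {k} {P : Vec ℕ (suc k) → Set} (P? : Decidable P) m (f : ℕ → ℕ) L →
    length (filter P? (cartesianProductWith _∷_ (applyUpTo f m) L))
      ≡ ∑ m (λ x → length (filter (λ v → P? (f x ∷ v)) L))
  length-filter-product P? zero    f L = refl
  length-filter-product P? (suc m) f L = trans
    (cong length (filter-++ P? (List.map (f 0 ∷_) L) _))
    (trans (length-++ (filter P? (List.map (f 0 ∷_) L)))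
    (trans (cong₂ _+_ (length-filter-map P? (f 0 ∷_) L) (length-filter-product P? m (f ∘ suc) L))
           (sym (∑-first m _))))

  length-filter-vectors : ∀ k n {P : Vec ℕ k → Set} (P? : Decidable P) →
    length (filter P? (vectors≤ k n)) ≡ box (suc n) k (λ v → 𝟙[ P? v ])
  length-filter-vectors zero    n P? with P? []
  ... | yes _ = refl
  ... | no _  = refl
  length-filter-vectors (suc k) n P? = trans (length-filter-product P? (suc n) (λ x → x) (vectors≤ k n))
    (∑-cong (suc n) λ x → length-filter-vectors k n (λ v → P? (x ∷ v)))

  box-zero : ∀ M d {f : Vec ℕ d → ℕ} → (∀ xs → f xs ≡ 0) → box M d f ≡ 0
  box-zero M zero    h = h []
  box-zero M (suc d) h = trans (∑-cong M λ x → box-zero M d λ xs → h (x ∷ xs)) (∑-zero M)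

  box≡exact : ∀ d N K (F G : Vec ℕ (suc d) → ℕ) → suc N < K →
    (∀ v → AllPositive v → Vec.sum v ≡ suc N → F v ≡ G v) →
    (∀ v → ¬ (AllPositive v × Vec.sum v ≡ suc N) → F v ≡ 0) → box K (suc d) F ≡ exact d N G
  box≡exact zero N K F G N<K same other = trans
    (∑-single K (λ x → F (x ∷ [])) (suc N) N<K λ y _ y≢ → other (y ∷ []) λ (_ , eq) → y≢ (trans (sym (+-identityʳ y)) eq))
    (same (suc N ∷ []) (s≤s z≤n ∷ []) (+-identityʳ (suc N)))
  box≡exact (suc d) N K@(suc K′) F G (s≤s N<K′) same other = begin-equality
    ∑ K (λ x → box K (suc d) (λ v → F (x ∷ v)))
      ≡⟨ ∑-first K′ _ ⟩
    box K (suc d) (λ v → F (0 ∷ v)) + ∑ K′ (λ y → box K (suc d) (λ v → F (suc y ∷ v)))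
      ≡⟨ cong₂ _+_ (box-zero K (suc d) λ v → other (0 ∷ v) λ { (() ∷ _ , _) })
                   (trans (cong (λ t → ∑ t (λ y → box K (suc d) (λ v → F (suc y ∷ v)))) (sym (m+[n∸m]≡n (<⇒≤ N<K′))))
                          (∑-split N (K′ ∸ N) _)) ⟩
    ∑ N (λ y → box K (suc d) (λ v → F (suc y ∷ v))) + ∑ (K′ ∸ N) (λ y → box K (suc d) (λ v → F (suc (N + y) ∷ v)))
      ≡⟨ cong₂ _+_ (∑-cong< N inside) (trans (∑-cong (K′ ∸ N) λ y → box-zero K (suc d) (outside y)) (∑-zero (K′ ∸ N))) ⟩
    exact (suc d) N G + 0
      ≡⟨ +-identityʳ _ ⟩
    exact (suc d) N G ∎
    where
    inside : ∀ y → y < N → box K (suc d) (λ v → F (suc y ∷ v)) ≡ exact d (N ∸ suc y) (λ v → G (suc y ∷ v))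
    inside y y<N = box≡exact d (N ∸ suc y) K _ _ (s≤s (≤-<-trans (m∸n≤m N (suc y)) N<K′))
      (λ v v>0 eq → same (suc y ∷ v) (s≤s z≤n ∷ v>0) (trans (cong (suc y +_) eq) (suc-∸ y<N)))
      (λ v ¬rep → other (suc y ∷ v) λ { (_ ∷ v>0 , eq) → ¬rep (v>0 , +-cancelˡ-≡ (suc y) _ _ (trans eq (sym (suc-∸ y<N)))) })
    -- At least one further positive entry follows, so a first entry above `N` makes the sum exceed
    -- N + 1.
    outside : ∀ y v → F (suc (N + y) ∷ v) ≡ 0
    outside y v@(_ ∷ _) = other (suc (N + y) ∷ v) λ { (_ ∷ (a>0 ∷ _) , eq) →
      <⇒≱ (n<1+n N) (≤-trans (m≤m+n (suc N) y) (≤-pred (≤-trans (≤-reflexive (+-comm 1 (suc (N + y))))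
        (≤-trans (+-monoʳ-≤ (suc (N + y)) (≤-trans a>0 (m≤m+n _ _))) (≤-reflexive eq))))) }

  Coprimes : ∀ {k} → Vec ℕ k → Set
  Coprimes = AllPairs (λ x y → gcd x y ≡ 1)

  coprimes? : ∀ {k} → Decidable (Coprimes {k})
  coprimes? = allPairs? (λ x y → gcd x y ≟ 1)

  B≡exact : ∀ d N → B (suc d) (suc N) ≡ exact d N (λ v → 𝟙[ coprimes? v ])
  B≡exact d N = trans (length-filter-vectors (suc d) (suc N) (isCoprimeRep? (suc d) (suc N)))
    (box≡exact d N (suc (suc N)) _ _ ≤-refl
      (λ v v>0 eq → 𝟙-⇔ (isCoprimeRep? (suc d) (suc N) v) (coprimes? v) (proj₂ ∘ proj₂) λ c → v>0 , eq , c)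
      (λ v ¬rep → 𝟙-no (isCoprimeRep? (suc d) (suc N) v) λ (v>0 , eq , _) → ¬rep (v>0 , eq)))

  -- How often two entries share the divisor p.

  module _ (p : ℕ) where

    div : ℕ → ℕ
    div x = 𝟙[ p ∣? x ]

    multiples : ∀ {k} → Vec ℕ k → ℕ
    multiples []       = 0
    multiples (x ∷ xs) = div x + multiples xs

    -- This is the binomial coefficient `multiples` over 2. A count of pairs, unlike a yes-or-no
    -- test, can be averaged position by position, and it is 0 exactly when at most one entry is
    -- divisible by p.
    pairs : ∀ {k} → Vec ℕ k → ℕ
    pairs []       = 0
    pairs (x ∷ xs) = div x * multiples xs + pairs xs

    div-periodic : Periodic₁ p div
    div-periodic x = 𝟙-⇔ (p ∣? p + x) (p ∣? x) (λ h → ∣m+n∣m⇒∣n h ∣-refl) (λ h → ∣m∣n⇒∣m+n ∣-refl h)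

    pairs-zero : ∀ {k} (v : Vec ℕ k) → multiples v ≡ 0 → pairs v ≡ 0
    pairs-zero []       _ = refl
    pairs-zero (x ∷ xs) h rewrite m+n≡0⇒m≡0 (div x) h = pairs-zero xs (m+n≡0⇒n≡0 (div x) h)

  -- Telescoping with step `w` when one residue class carries all the weight: the first period
  -- contributes only `Ψ` at w - 1, which is exactly N^(d+1). There is no boundary term, so the
  -- bound stays useful when `w` is larger than `N`.
  weighted-∑-≤ : ∀ w .{{_ : NonZero w}} d N → suc d * w * ∑ N (λ x → div w (suc x) * (N ∸ suc x) ^ d) ≤ N ^ suc d
  weighted-∑-≤ w@(suc w′) d N = begin
    suc d * w * ∑ N (λ x → h x * (N ∸ suc x) ^ d)
      ≡⟨ sym (∑-*ˡ N (suc d * w) _) ⟩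
    ∑ N (λ x → suc d * w * (h x * (N ∸ suc x) ^ d))
      ≡⟨ ∑-cong N (λ x → swap (suc d * w) (h x) _) ⟩
    ∑ N (λ x → h x * (suc d * w * (N ∸ suc x) ^ d))
      ≤⟨ telescope-≤ w h per N _ Ψ step ⟩
    ∑ w (λ x → h x * Ψ x)
      ≡⟨ ∑-single w _ w′ ≤-refl (λ y y<w y≢w′ → cong (_* Ψ y) (𝟙-no (w ∣? suc y) λ w∣ → y≢w′ (suc-injective (≤-antisym y<w (∣⇒≤ w∣))))) ⟩
    h w′ * Ψ w′
      ≡⟨ cong₂ _*_ (𝟙-yes (w ∣? w) ∣-refl) (cong (_^ suc d) (m+n∸n≡m N w)) ⟩
    1 * N ^ suc d
      ≡⟨ *-identityˡ _ ⟩
    N ^ suc d ∎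
    where
    h Ψ : ℕ → ℕ
    h x = div w (suc x)
    Ψ x = (N + w ∸ suc x) ^ suc d
    swap : ∀ a b c → a * (b * c) ≡ b * (a * c)
    swap = solve-∀
    per : Periodic₁ w h
    per x = trans (cong (div w) (sym (+-suc w x))) (div-periodic w (suc x))
    step : ∀ x → x < N → suc d * w * (N ∸ suc x) ^ d + Ψ (w + x) ≤ Ψ x
    step x x<N = subst₂ (λ s t → suc d * w * a ^ d + s ^ suc d ≤ t ^ suc d) (sym eq₁) (sym eq₂) (bernoulli-≤ w a d)
      where
      a = N ∸ suc x
      r₁ : ∀ x y w → suc x + y + w ≡ suc (w + x) + y
      r₁ = solve-∀
      eq₁ : N + w ∸ suc (w + x) ≡ a
      eq₁ = trans (cong (_∸ suc (w + x)) (trans (cong (_+ w) (sym (m+[n∸m]≡n x<N))) (r₁ x a w))) (m+n∸m≡n (suc (w + x)) a)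
      eq₂ : N + w ∸ suc x ≡ a + w
      eq₂ = trans (cong (_∸ suc x) (trans (cong (_+ w) (sym (m+[n∸m]≡n x<N))) (+-assoc (suc x) a w))) (m+n∸m≡n (suc x) (a + w))

  power-∑-≤ : ∀ d N → suc d * ∑ N (λ x → (N ∸ suc x) ^ d) ≤ N ^ suc d
  power-∑-≤ d N = ≤-trans (≤-reflexive (cong₂ _*_ (sym (*-identityʳ (suc d)))
    (∑-cong N λ x → sym (trans (cong (_* (N ∸ suc x) ^ d) (𝟙-yes (1 ∣? suc x) (1∣ suc x))) (*-identityˡ _)))))
    (weighted-∑-≤ 1 d N)

  div-∑-≤ : ∀ w .{{_ : NonZero w}} N → w * ∑ N (λ x → div w (suc x)) ≤ N
  div-∑-≤ w N = subst₂ _≤_ (cong₂ _*_ (*-identityˡ w) (∑-cong N λ x → *-identityʳ (div w (suc x)))) (*-identityʳ N) (weighted-∑-≤ w 0 N)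

  exact-one : ∀ d N → d ! * exact d N (λ _ → 1) ≤ N ^ d
  exact-one zero    N = ≤-refl
  exact-one (suc d) N = begin
    suc d ! * ∑ N (λ x → exact d (N ∸ suc x) (λ _ → 1))    ≡⟨ *-assoc (suc d) (d !) _ ⟩
    suc d * (d ! * ∑ N (λ x → exact d (N ∸ suc x) (λ _ → 1))) ≡⟨ cong (suc d *_) (sym (∑-*ˡ N (d !) _)) ⟩
    suc d * ∑ N (λ x → d ! * exact d (N ∸ suc x) (λ _ → 1))   ≤⟨ *-monoʳ-≤ (suc d) (∑-mono N λ x → exact-one d (N ∸ suc x)) ⟩
    suc d * ∑ N (λ x → (N ∸ suc x) ^ d)                    ≤⟨ power-∑-≤ d N ⟩
    N ^ suc d                                              ∎

  module _ (p : ℕ) .{{_ : NonZero p}} where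

    private
      -- Prepending an entry. The term weighted by divisibility of that entry gains a factor 1/p
      -- from `weighted-∑-≤`, so the bound for `F₁` may have one factor 1/p fewer than that for
      -- `F₀`, whose term uses `power-∑-≤`.
      exact-step : ∀ d N c a b u v (F₀ F₁ : Vec ℕ (suc d) → ℕ) →
        (∀ N′ → c * a * exact d N′ F₁ ≤ u * N′ ^ d) →
        (∀ N′ → c * (p * a) * exact d N′ F₀ ≤ v * N′ ^ d) →
        b ≡ suc d * c →
        b * (p * a) * ∑ N (λ x → exact d (N ∸ suc x) (λ w → div p (suc x) * F₁ w + F₀ w)) ≤ (u + v) * N ^ suc d
      exact-step d N c a b u v F₀ F₁ h₁ h₀ refl = begin
        suc d * c * (p * a) * ∑ N (λ x → exact d (N ∸ suc x) (λ w → div p (suc x) * F₁ w + F₀ w))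
          ≡⟨ cong (suc d * c * (p * a) *_) (trans (∑-cong N λ x → trans (exact-+ d (N ∸ suc x) _ F₀)
               (cong (_+ exact d (N ∸ suc x) F₀) (exact-*ˡ d (N ∸ suc x) (div p (suc x)) F₁))) (∑-+ N _ _)) ⟩
        suc d * c * (p * a) * (S₁ + S₀)
          ≡⟨ lem₁ (suc d) c p a S₁ S₀ ⟩
        suc d * p * (c * a * S₁) + suc d * (c * (p * a) * S₀)
          ≡⟨ cong₂ (λ s t → suc d * p * s + suc d * t)
               (trans (sym (∑-*ˡ N (c * a) _)) (∑-cong N λ x → lem₂ (c * a) (div p (suc x)) _))
               (sym (∑-*ˡ N (c * (p * a)) _)) ⟩
        suc d * p * ∑ N (λ x → div p (suc x) * (c * a * exact d (N ∸ suc x) F₁))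
          + suc d * ∑ N (λ x → c * (p * a) * exact d (N ∸ suc x) F₀)
          ≤⟨ +-mono-≤ (*-monoʳ-≤ (suc d * p) (∑-mono N λ x → *-monoʳ-≤ (div p (suc x)) (h₁ (N ∸ suc x))))
                      (*-monoʳ-≤ (suc d) (∑-mono N λ x → h₀ (N ∸ suc x))) ⟩
        suc d * p * ∑ N (λ x → div p (suc x) * (u * (N ∸ suc x) ^ d)) + suc d * ∑ N (λ x → v * (N ∸ suc x) ^ d)
          ≡⟨ cong₂ (λ s t → suc d * p * s + suc d * t)
               (trans (∑-cong N λ x → lem₂ (div p (suc x)) u _) (∑-*ˡ N u _)) (∑-*ˡ N v _) ⟩
        suc d * p * (u * ∑ N (λ x → div p (suc x) * (N ∸ suc x) ^ d)) + suc d * (v * ∑ N (λ x → (N ∸ suc x) ^ d))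
          ≡⟨ cong₂ _+_ (lem₂ (suc d * p) u _) (lem₂ (suc d) v _) ⟩
        u * (suc d * p * ∑ N (λ x → div p (suc x) * (N ∸ suc x) ^ d)) + v * (suc d * ∑ N (λ x → (N ∸ suc x) ^ d))
          ≤⟨ +-mono-≤ (*-monoʳ-≤ u (weighted-∑-≤ p d N)) (*-monoʳ-≤ v (power-∑-≤ d N)) ⟩
        u * N ^ suc d + v * N ^ suc d
          ≡⟨ sym (*-distribʳ-+ (N ^ suc d) u v) ⟩
        (u + v) * N ^ suc d ∎
        where
        S₁ = ∑ N (λ x → div p (suc x) * exact d (N ∸ suc x) F₁)
        S₀ = ∑ N (λ x → exact d (N ∸ suc x) F₀)
        lem₁ : ∀ e c p a s t → e * c * (p * a) * (s + t) ≡ e * p * (c * a * s) + e * (c * (p * a) * t)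
        lem₁ = solve-∀
        lem₂ : ∀ a b c → a * (b * c) ≡ b * (a * c)
        lem₂ = solve-∀

      ∑-div-rev : ∀ N → ∑ N (λ x → div p (suc (N ∸ suc x))) ≡ ∑ N (λ x → div p (suc x))
      ∑-div-rev N = ∑-rev N (λ y → div p (suc y))

    -- There are d + 2 positions, and each contributes at most N^(d+1)/((d+1)! p). For two entries
    -- the second is the first read backwards, so reversing the sum treats both alike.
    exact-multiples : ∀ d N → suc d ! * (p * 1) * exact (suc d) N (multiples p) ≤ (2 + d) * N ^ suc d
    exact-multiples zero N = begin
      1 * (p * 1) * ∑ N (λ x → div p (suc x) + (div p (suc (N ∸ suc x)) + 0))
        ≡⟨ cong (1 * (p * 1) *_) (trans (∑-+ N _ _) (cong (S +_) (trans (∑-cong N λ x → +-identityʳ _) (∑-div-rev N)))) ⟩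
      1 * (p * 1) * (S + S)   ≡⟨ lem p S ⟩
      2 * (p * S)             ≤⟨ *-monoʳ-≤ 2 (div-∑-≤ p N) ⟩
      2 * N                   ≡⟨ cong (2 *_) (sym (*-identityʳ N)) ⟩
      2 * (N * 1)             ∎
      where
      S = ∑ N (λ x → div p (suc x))
      lem : ∀ p s → 1 * (p * 1) * (s + s) ≡ 2 * (p * s)
      lem = solve-∀
    exact-multiples (suc d) N = ≤-trans
      (*-monoʳ-≤ ((2 + d) ! * (p * 1)) (∑-mono N λ x → exact-mono (suc d) (N ∸ suc x)
        λ v _ _ → ≤-reflexive (cong (_+ multiples p v) (sym (*-identityʳ (div p (suc x)))))))
      (exact-step (suc d) N (suc d !) 1 ((2 + d) !) 1 (2 + d) (multiples p) (λ _ → 1)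
        (λ N′ → ≤-trans (≤-reflexive (cong (_* exact (suc d) N′ (λ _ → 1)) (*-identityʳ (suc d !))))
                  (≤-trans (exact-one (suc d) N′) (≤-reflexive (sym (*-identityˡ _)))))
        (exact-multiples d) refl)

    -- When both entries of a pair with sum N + 1 are divisible by p, so is N + 1: this supplies the second factor 1/p.
    private
      exact-1-pairs : ∀ N → p * exact 1 N (pairs p) ≤ div p (suc N) * N
      exact-1-pairs N = begin
        p * ∑ N (λ x → div p (suc x) * (div p (suc (N ∸ suc x)) + 0) + (div p (suc (N ∸ suc x)) * 0 + 0))
          ≤⟨ *-monoʳ-≤ p (∑-mono< N λ x x<N → bound x (suc-∸ x<N)) ⟩
        p * ∑ N (λ x → div p (suc N) * div p (suc x)) ≡⟨ cong (p *_) (∑-*ˡ N (div p (suc N)) _) ⟩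
        p * (div p (suc N) * ∑ N (λ x → div p (suc x))) ≡⟨ lem p (div p (suc N)) _ ⟩
        div p (suc N) * (p * ∑ N (λ x → div p (suc x))) ≤⟨ *-monoʳ-≤ (div p (suc N)) (div-∑-≤ p N) ⟩
        div p (suc N) * N ∎
        where
        lem : ∀ a b c → a * (b * c) ≡ b * (a * c)
        lem = solve-∀
        bound : ∀ x → suc x + suc (N ∸ suc x) ≡ suc N →
          div p (suc x) * (div p (suc (N ∸ suc x)) + 0) + (div p (suc (N ∸ suc x)) * 0 + 0) ≤ div p (suc N) * div p (suc x)
        bound x eq with p ∣? suc x | p ∣? suc (N ∸ suc x)
        ... | no _  | yes _ = z≤n
        ... | no _  | no _  = z≤n
        ... | yes _ | no _  = z≤n
        ... | yes a | yes b = ≤-reflexive (sym (cong (_* 1) (𝟙-yes (p ∣? suc N) (subst (p ∣_) eq (∣m∣n⇒∣m+n a b)))))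

      -- `exact-1-pairs` leaves the condition that p divides the sum of the last two entries; as the
      -- first entry varies, this sum takes each value from 1 to `N` once, which gives the second
      -- factor 1/p.
      exact-2-pairs-tail : ∀ N → 2 * (p * (p * ∑ N (λ x → exact 1 (N ∸ suc x) (pairs p)))) ≤ 2 * N ^ 2
      exact-2-pairs-tail N = *-monoʳ-≤ 2 (begin
        p * (p * ∑ N (λ x → exact 1 (N ∸ suc x) (pairs p)))  ≡⟨ cong (p *_) (sym (∑-*ˡ N p _)) ⟩
        p * ∑ N (λ x → p * exact 1 (N ∸ suc x) (pairs p))    ≤⟨ *-monoʳ-≤ p (∑-mono N λ x → ≤-trans (exact-1-pairs (N ∸ suc x))
                                                                   (*-monoʳ-≤ (div p (suc (N ∸ suc x))) (m∸n≤m N (suc x)))) ⟩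
        p * ∑ N (λ x → div p (suc (N ∸ suc x)) * N)          ≡⟨ cong (p *_) (trans (∑-*ʳ N N _) (cong (_* N) (∑-div-rev N))) ⟩
        p * (∑ N (λ x → div p (suc x)) * N)                  ≡⟨ sym (*-assoc p _ N) ⟩
        p * ∑ N (λ x → div p (suc x)) * N                    ≤⟨ *-monoˡ-≤ N (div-∑-≤ p N) ⟩
        N * N                                                ≡⟨ cong (N *_) (sym (*-identityʳ N)) ⟩
        N ^ 2                                                ∎)

      exact-2-pairs-head : ∀ N → 2 * (p * (p * ∑ N (λ x → div p (suc x) * exact 1 (N ∸ suc x) (multiples p)))) ≤ 2 * N ^ 2
      exact-2-pairs-head N = begin
        2 * (p * (p * ∑ N (λ x → div p (suc x) * exact 1 (N ∸ suc x) (multiples p))))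
          ≡⟨ trans (sym (*-assoc 2 p _)) (cong (2 * p *_) (trans (sym (∑-*ˡ N p _)) (∑-cong N λ x → lem p (div p (suc x)) _))) ⟩
        2 * p * ∑ N (λ x → div p (suc x) * (p * exact 1 (N ∸ suc x) (multiples p)))
          ≤⟨ *-monoʳ-≤ (2 * p) (∑-mono N λ x → *-monoʳ-≤ (div p (suc x)) (≤-trans (≤-reflexive (lem₂ p _)) (exact-multiples 0 (N ∸ suc x)))) ⟩
        2 * p * ∑ N (λ x → div p (suc x) * (2 * (N ∸ suc x) ^ 1))
          ≡⟨ cong (2 * p *_) (trans (∑-cong N λ x → lem (div p (suc x)) 2 _) (∑-*ˡ N 2 _)) ⟩
        2 * p * (2 * ∑ N (λ x → div p (suc x) * (N ∸ suc x) ^ 1))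
          ≡⟨ lem (2 * p) 2 _ ⟩
        2 * (2 * p * ∑ N (λ x → div p (suc x) * (N ∸ suc x) ^ 1))
          ≤⟨ *-monoʳ-≤ 2 (weighted-∑-≤ p 1 N) ⟩
        2 * N ^ 2 ∎
        where
        lem : ∀ a b c → a * (b * c) ≡ b * (a * c)
        lem = solve-∀
        lem₂ : ∀ p s → p * s ≡ 1 * (p * 1) * s
        lem₂ = solve-∀

    -- Three entries are the least for which the order 1/p² is uniform in n. The square (d+3)²
    -- majorises the number of pairs of positions and survives the recursion, as (d+3) + (d+3)² ≤
    -- (d+4)².
    exact-pairs : ∀ d N → (2 + d) ! * (p * (p * 1)) * exact (2 + d) N (pairs p) ≤ (3 + d) * (3 + d) * N ^ (2 + d)
    exact-pairs zero N = begin
      2 * (p * (p * 1)) * ∑ N (λ x → exact 1 (N ∸ suc x) (λ w → div p (suc x) * multiples p w + pairs p w))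
        ≡⟨ cong (2 * (p * (p * 1)) *_) (trans (∑-cong N λ x → trans (exact-+ 1 (N ∸ suc x) (λ w → div p (suc x) * multiples p w) (pairs p))
             (cong (_+ exact 1 (N ∸ suc x) (pairs p)) (exact-*ˡ 1 (N ∸ suc x) (div p (suc x)) (multiples p)))) (∑-+ N _ _)) ⟩
      2 * (p * (p * 1)) * (S₁ + S₀)                    ≡⟨ lem p S₁ S₀ ⟩
      2 * (p * (p * S₁)) + 2 * (p * (p * S₀))          ≤⟨ +-mono-≤ (exact-2-pairs-head N) (exact-2-pairs-tail N) ⟩
      2 * N ^ 2 + 2 * N ^ 2                            ≤⟨ m≤m+n _ (5 * N ^ 2) ⟩
      2 * N ^ 2 + 2 * N ^ 2 + 5 * N ^ 2                ≡⟨ lem₂ (N ^ 2) ⟩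
      9 * N ^ 2                                        ∎
      where
      S₁ = ∑ N (λ x → div p (suc x) * exact 1 (N ∸ suc x) (multiples p))
      S₀ = ∑ N (λ x → exact 1 (N ∸ suc x) (pairs p))
      lem : ∀ p s t → 2 * (p * (p * 1)) * (s + t) ≡ 2 * (p * (p * s)) + 2 * (p * (p * t))
      lem = solve-∀
      lem₂ : ∀ s → 2 * s + 2 * s + 5 * s ≡ 9 * s
      lem₂ = solve-∀
    exact-pairs (suc d) N = ≤-trans
      (exact-step (2 + d) N ((2 + d) !) (p * 1) ((3 + d) !) (3 + d) ((3 + d) * (3 + d)) (pairs p) (multiples p)
        (exact-multiples (suc d)) (exact-pairs d) refl)
      (*-monoˡ-≤ (N ^ (3 + d)) (*-monoʳ-≤ (4 + d) (n≤1+n (3 + d))))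

  -- The condition at one prime as a periodic function of the free entries.

  [m+n]∸[o+n]≡m∸o : ∀ m n o → (m + n) ∸ (o + n) ≡ m ∸ o
  [m+n]∸[o+n]≡m∸o m n o = trans (cong₂ _∸_ (+-comm m n) (+-comm o n)) ([m+n]∸[m+o]≡n∸o n m o)

  -- Congruence in additive form, where shifting `a` by p only changes a multiplier.
  ∣∣-∣∣⇔≡-mod : ∀ p a b → (p ∣ ∣ a - b ∣ → ∃₂ λ u v → a + u * p ≡ b + v * p) × (∀ u v → a + u * p ≡ b + v * p → p ∣ ∣ a - b ∣)
  ∣∣-∣∣⇔≡-mod p a b with ≤-total a b
  ... | inj₁ a≤b rewrite m≤n⇒∣m-n∣≡n∸m a≤b =
    (λ { (divides q eq) → q , 0 , trans (cong (a +_) (sym eq)) (trans (m+[n∸m]≡n a≤b) (sym (+-identityʳ b))) }) ,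
    (λ u v eq → divides (u ∸ v) (trans (sym ([m+n]∸[o+n]≡m∸o b (v * p) a))
      (trans (cong (_∸ (a + v * p)) (sym eq)) (trans ([m+n]∸[m+o]≡n∸o a (u * p) (v * p)) (sym (*-distribʳ-∸ p u v))))))
  ... | inj₂ b≤a rewrite m≤n⇒∣n-m∣≡n∸m b≤a =
    (λ { (divides q eq) → 0 , q , trans (+-identityʳ a) (trans (sym (m+[n∸m]≡n b≤a)) (cong (b +_) eq)) }) ,
    (λ u v eq → divides (v ∸ u) (trans (sym ([m+n]∸[o+n]≡m∸o a (u * p) b))
      (trans (cong (_∸ (b + u * p)) eq) (trans ([m+n]∸[m+o]≡n∸o b (v * p) (u * p)) (sym (*-distribʳ-∸ p v u))))))

  module _ (p n : ℕ) where

    -- The absolute difference replaces n - s because residues taken from a box may sum to more than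
    -- n; truncated subtraction would destroy periodicity in s.
    last : ℕ → ℕ
    last s = 𝟙[ p ∣? ∣ s - n ∣ ]

    last-periodic : Periodic₁ p last
    last-periodic s = 𝟙-⇔ (p ∣? ∣ p + s - n ∣) (p ∣? ∣ s - n ∣)
      (λ h → let (u , v , eq) = proj₁ (∣∣-∣∣⇔≡-mod p (p + s) n) h in
         proj₂ (∣∣-∣∣⇔≡-mod p s n) (suc u) v (trans (lem p s (u * p)) eq))
      (λ h → let (u , v , eq) = proj₁ (∣∣-∣∣⇔≡-mod p s n) h in
         proj₂ (∣∣-∣∣⇔≡-mod p (p + s) n) u (suc v) (trans (lem₂ p s (u * p)) (trans (cong (p +_) eq) (lem₃ p n (v * p)))))
      where
      lem : ∀ p s u → s + (p + u) ≡ p + s + u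
      lem = solve-∀
      lem₂ : ∀ p s u → p + s + u ≡ p + (s + u)
      lem₂ = solve-∀
      lem₃ : ∀ p n v → p + (n + v) ≡ n + (p + v)
      lem₃ = solve-∀

    -- The last entry of a tuple with sum n is n minus the sum s of the entries
    -- already read; clear and good test whether p divides none, respectively at
    -- most one, of the remaining entries including that last one.
    clear good : ∀ {d} → ℕ → Vec ℕ d → ℕ
    clear s []       = 1 ∸ last s
    clear s (x ∷ xs) = (1 ∸ div p x) * clear (s + x) xs
    good s []       = 1
    good s (x ∷ xs) = div p x * clear (s + x) xs + (1 ∸ div p x) * good (s + x) xs

    private
      swap-+ : ∀ p s x → p + s + x ≡ p + (s + x)
      swap-+ = solve-∀
      swap-+′ : ∀ p s x → s + (p + x) ≡ p + (s + x)
      swap-+′ = solve-∀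
      shift-+ : ∀ s x t r → s + x + (t + r) ≡ s + (x + t + r)
      shift-+ = solve-∀

    -- The running sum matters only modulo p, and shifting an entry by p shifts every later running
    -- sum by p.
    clear-translate : ∀ {d} s (xs : Vec ℕ d) → clear (p + s) xs ≡ clear s xs
    clear-translate s []       = cong (1 ∸_) (last-periodic s)
    clear-translate s (x ∷ xs) = cong ((1 ∸ div p x) *_)
      (trans (cong (λ t → clear t xs) (swap-+ p s x)) (clear-translate (s + x) xs))

    good-translate : ∀ {d} s (xs : Vec ℕ d) → good (p + s) xs ≡ good s xs
    good-translate s []       = refl
    good-translate s (x ∷ xs) = cong₂ (λ a b → div p x * a + (1 ∸ div p x) * b)
      (trans (cong (λ t → clear t xs) (swap-+ p s x)) (clear-translate (s + x) xs))
      (trans (cong (λ t → good t xs) (swap-+ p s x)) (good-translate (s + x) xs))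

    clear-periodic : ∀ d s → Periodic p d (clear s)
    clear-periodic zero    s = tt
    clear-periodic (suc d) s =
      (λ x xs → cong₂ (λ a b → (1 ∸ a) * b) (div-periodic p x)
        (trans (cong (λ t → clear t xs) (swap-+′ p s x)) (clear-translate (s + x) xs))) ,
      (λ x → Periodic-zip _*_ p d _ (clear (s + x)) (Periodic-const p d (1 ∸ div p x)) (clear-periodic d (s + x)))

    good-periodic : ∀ d s → Periodic p d (good s)
    good-periodic zero    s = tt
    good-periodic (suc d) s =
      (λ x xs → cong₂ _+_
        (cong₂ _*_ (div-periodic p x) (trans (cong (λ t → clear t xs) (swap-+′ p s x)) (clear-translate (s + x) xs)))
        (cong₂ (λ a b → (1 ∸ a) * b) (div-periodic p x) (trans (cong (λ t → good t xs) (swap-+′ p s x)) (good-translate (s + x) xs)))) ,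
      (λ x → Periodic-zip _+_ p d (λ xs → div p x * clear (s + x) xs) (λ xs → (1 ∸ div p x) * good (s + x) xs)
        (Periodic-zip _*_ p d _ (clear (s + x)) (Periodic-const p d (div p x)) (clear-periodic d (s + x)))
        (Periodic-zip _*_ p d _ (good (s + x)) (Periodic-const p d (1 ∸ div p x)) (good-periodic d (s + x))))

    clear≡ : ∀ {d} s (xs : Vec ℕ d) r → s + (Vec.sum xs + r) ≡ n → 𝟙[ multiples p (xs ∷ʳ r) ≟ 0 ] ≡ clear s xs
    clear≡ s [] r refl with p ∣? r | p ∣? ∣ s - (s + r) ∣
    ... | yes _   | yes _ = refl
    ... | no _    | no _  = refl
    ... | yes p∣r | no p∤ = ⊥-elim (p∤ (subst (p ∣_) (sym (∣m-m+n∣≡n s r)) p∣r))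
    ... | no p∤r  | yes p∣ = ⊥-elim (p∤r (subst (p ∣_) (∣m-m+n∣≡n s r) p∣))
    clear≡ s (x ∷ xs) r eq with p ∣? x
    ... | yes _ = 𝟙-no (suc (multiples p (xs ∷ʳ r)) ≟ 0) λ ()
    ... | no _  = trans (clear≡ (s + x) xs r (trans (shift-+ s x (Vec.sum xs) r) eq)) (sym (*-identityˡ _))

    good≡ : ∀ {d} s (xs : Vec ℕ d) r → s + (Vec.sum xs + r) ≡ n → 𝟙[ pairs p (xs ∷ʳ r) ≟ 0 ] ≡ good s xs
    good≡ s []       r eq = 𝟙-yes (div p r * 0 + 0 ≟ 0) (trans (+-identityʳ _) (*-zeroʳ (div p r)))
    good≡ s (x ∷ xs) r eq with p ∣? x
    -- Once an entry is divisible by p no later one may be: `multiples` must be 0, which forces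
    -- `pairs` to be 0 too and is the condition that `clear` tests.
    ... | yes _ = trans (𝟙-⇔ (1 * ω + pairs p v ≟ 0) (ω ≟ 0)
                          (λ h → trans (sym (*-identityˡ ω)) (m+n≡0⇒m≡0 (1 * ω) h))
                          (λ h → cong₂ _+_ (trans (*-identityˡ ω) h) (pairs-zero p v h)))
                  (trans (clear≡ (s + x) xs r eq′) (sym (trans (+-identityʳ _) (*-identityˡ _))))
      where
      v = xs ∷ʳ r
      ω = multiples p v
      eq′ = trans (shift-+ s x (Vec.sum xs) r) eq
    ... | no _  = trans (good≡ (s + x) xs r (trans (shift-+ s x (Vec.sum xs) r) eq)) (sym (*-identityˡ _))

  clear≤1 : ∀ p n {d} s (xs : Vec ℕ d) → clear p n s xs ≤ 1
  clear≤1 p n s []       = m∸n≤m 1 (last p n s)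
  clear≤1 p n s (x ∷ xs) = *-mono-≤ (m∸n≤m 1 (div p x)) (clear≤1 p n (s + x) xs)

  good≤1 : ∀ p n {d} s (xs : Vec ℕ d) → good p n s xs ≤ 1
  good≤1 p n s []       = ≤-refl
  good≤1 p n s (x ∷ xs) with p ∣? x
  ... | yes _ = ≤-trans (≤-reflexive (trans (+-identityʳ _) (*-identityˡ _))) (clear≤1 p n (s + x) xs)
  ... | no _  = ≤-trans (≤-reflexive (*-identityˡ _)) (good≤1 p n (s + x) xs)

  sifted : ∀ {d} → ℕ → ℕ → Vec ℕ d → ℕ
  sifted n z xs = ∏ₚ (λ p → good p n 0 xs) z

  ∏ₚ-cong : ∀ z {h h′ : ℕ → ℕ} → (∀ p → h p ≡ h′ p) → ∏ₚ h z ≡ ∏ₚ h′ z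
  ∏ₚ-cong zero    eq = refl
  ∏ₚ-cong (suc z) eq with prime? (suc z)
  ... | yes _ = cong₂ _*_ (∏ₚ-cong z eq) (eq (suc z))
  ... | no _  = ∏ₚ-cong z eq

  ∏ₚ≤1 : ∀ z {h : ℕ → ℕ} → (∀ p → h p ≤ 1) → ∏ₚ h z ≤ 1
  ∏ₚ≤1 zero    h≤1 = ≤-refl
  ∏ₚ≤1 (suc z) h≤1 with prime? (suc z)
  ... | yes _ = *-mono-≤ (∏ₚ≤1 z h≤1) (h≤1 (suc z))
  ... | no _  = ∏ₚ≤1 z h≤1

  ∏ₚ≡1 : ∀ z {h : ℕ → ℕ} → (∀ p → Prime p → h p ≡ 1) → ∏ₚ h z ≡ 1
  ∏ₚ≡1 zero    h≡1 = refl
  ∏ₚ≡1 (suc z) h≡1 with prime? (suc z)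
  ... | yes pr = cong₂ _*_ (∏ₚ≡1 z h≡1) (h≡1 (suc z) pr)
  ... | no _   = ∏ₚ≡1 z h≡1

  ∏ₚ-zero : ∀ z {h : ℕ → ℕ} p → Prime p → p ≤ z → h p ≡ 0 → ∏ₚ h z ≡ 0
  ∏ₚ-zero zero    p pr z≤n hp = ⊥-elim (¬prime[0] pr)
  ∏ₚ-zero (suc z) {h} p pr p≤ hp with prime? (suc z) | m≤n⇒m<n∨m≡n p≤
  ... | yes _  | inj₁ (s≤s p≤z) = cong (_* h (suc z)) (∏ₚ-zero z p pr p≤z hp)
  ... | no _   | inj₁ (s≤s p≤z) = ∏ₚ-zero z p pr p≤z hp
  ... | yes _  | inj₂ refl = trans (cong (∏ₚ h z *_) hp) (*-zeroʳ (∏ₚ h z))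
  ... | no ¬pr | inj₂ refl = ⊥-elim (¬pr pr)

  primeDivisor : ∀ g → 1 < g → ∃ λ p → Prime p × p ∣ g
  primeDivisor g 1<g with factorise g {{>-nonZero (<⇒≤ 1<g)}}
  ... | record { factors = [] ; isFactorisation = eq } = ⊥-elim (<-irrefl (sym eq) 1<g)
  ... | record { factors = p ∷ ps ; isFactorisation = eq ; factorsPrime = pr ListAll.∷ _ } =
    p , pr , subst (p ∣_) (sym eq) (m∣m*n _)

  coprimes⇒pairs≡0 : ∀ {k} (v : Vec ℕ k) → Coprimes v → ∀ p → Prime p → pairs p v ≡ 0
  coprimes⇒pairs≡0 []       _        p pr = refl
  coprimes⇒pairs≡0 (x ∷ xs) (c ∷ cs) p pr = trans (cong (div p x * multiples p xs +_) (coprimes⇒pairs≡0 xs cs p pr))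
    (trans (+-identityʳ _) head)
    where
    none : p ∣ x → ∀ {j} {ys : Vec ℕ j} → All (λ y → gcd x y ≡ 1) ys → multiples p ys ≡ 0
    none p∣x []       = refl
    none p∣x (_∷_ {x = y} g gs) = cong₂ _+_ (𝟙-no (p ∣? y) λ p∣y → ∣1⇒¬prime pr (subst (p ∣_) g (gcd-greatest p∣x p∣y))) (none p∣x gs)
    head : div p x * multiples p xs ≡ 0
    head with p ∣? x
    ... | no _    = refl
    ... | yes p∣x = trans (+-identityʳ _) (none p∣x c)

  -- A common prime factor of two entries is at most an entry, hence at most the sum, so the primes
  -- up to `Z` detect every failure of coprimality.
  pairs≡0⇒coprimes : ∀ Z {k} (v : Vec ℕ k) → AllPositive v → Vec.sum v ≤ Z →
                     (∀ p → Prime p → p ≤ Z → pairs p v ≡ 0) → Coprimes v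
  pairs≡0⇒coprimes Z []       _            _    h = []
  pairs≡0⇒coprimes Z (x ∷ xs) (x>0 ∷ xs>0) sum≤ h =
    heads xs (λ p pr p∣x → trans (sym (*-identityˡ _)) (trans (cong (_* multiples p xs) (sym (𝟙-yes (p ∣? x) p∣x)))
               (m+n≡0⇒m≡0 (div p x * multiples p xs) (h p pr (≤-trans (∣⇒≤ {{>-nonZero x>0}} p∣x) (m+n≤o⇒m≤o x sum≤)))))) ∷
    pairs≡0⇒coprimes Z xs xs>0 (m+n≤o⇒n≤o x sum≤) (λ p pr p≤Z → m+n≡0⇒n≡0 (div p x * multiples p xs) (h p pr p≤Z))
    where
    gcd≡1 : ∀ y → (∀ p → Prime p → p ∣ x → ¬ (p ∣ y)) → gcd x y ≡ 1
    gcd≡1 y none with gcd x y in eq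
    ... | 0 = ⊥-elim (<-irrefl (sym (0∣⇒≡0 (subst (_∣ x) eq (gcd[m,n]∣m x y)))) x>0)
    ... | 1 = refl
    ... | suc (suc g) = let (p , pr , p∣g) = primeDivisor (2 + g) (s≤s (s≤s z≤n)) in
      ⊥-elim (none p pr (∣-trans p∣g (subst (_∣ x) eq (gcd[m,n]∣m x y))) (∣-trans p∣g (subst (_∣ y) eq (gcd[m,n]∣n x y))))
    heads : ∀ {j} (ys : Vec ℕ j) → (∀ p → Prime p → p ∣ x → multiples p ys ≡ 0) → All (λ y → gcd x y ≡ 1) ys
    heads []       none = []
    heads (y ∷ ys) none =
      gcd≡1 y (λ p pr p∣x p∣y → 0≢1+n (trans (sym (m+n≡0⇒m≡0 (div p y) (none p pr p∣x))) (𝟙-yes (p ∣? y) p∣y))) ∷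
      heads ys (λ p pr p∣x → m+n≡0⇒n≡0 (div p y) (none p pr p∣x))

  module _ (d N : ℕ) where

    private
      n = suc N
      survives : ∀ {k} → ℕ → Vec ℕ k → ℕ
      survives z v = ∏ₚ (λ p → 𝟙[ pairs p v ≟ 0 ]) z

      exact-survives : ∀ z → exact d N (survives z) ≡ simplex d N (sifted n z)
      exact-survives z = exact≡simplex d N _ _ λ xs sum≤ → ∏ₚ-cong z λ p →
        good≡ p n 0 xs _ (m+[n∸m]≡n (m≤n⇒m≤1+n sum≤))

      survives≤coprimes : ∀ Z → n ≤ Z → ∀ (v : Vec ℕ (suc d)) → AllPositive v → Vec.sum v ≡ n → survives Z v ≤ 𝟙[ coprimes? v ]
      survives≤coprimes Z n≤Z v v>0 sum≡ with coprimes? v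
      ... | yes _ = ∏ₚ≤1 Z λ p → 𝟙≤1 (pairs p v ≟ 0)
      ... | no ¬c with survives Z v in eq
      ...   | zero  = z≤n
      ...   | suc _ = ⊥-elim (¬c (pairs≡0⇒coprimes Z v v>0 (≤-trans (≤-reflexive sum≡) n≤Z) pairs≡0))
        where
        pairs≡0 : ∀ p → Prime p → p ≤ Z → pairs p v ≡ 0
        pairs≡0 p pr p≤Z with pairs p v ≟ 0
        ... | yes h = h
        ... | no ¬h = ⊥-elim (0≢1+n (trans (sym (∏ₚ-zero Z p pr p≤Z (𝟙-no (pairs p v ≟ 0) ¬h))) eq))

      -- A union bound: between the levels z and z + L a tuple is lost only at a prime where `pairs`
      -- is at least 1. Summing over all integers instead of primes gives an explicit series.
      survives-tail : ∀ z L (v : Vec ℕ (suc d)) → survives z v ≤ survives (z + L) v + ∑ L (λ i → pairs (suc (z + i)) v)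
      survives-tail z zero    v = ≤-reflexive (trans (cong (λ t → survives t v) (sym (+-identityʳ z))) (sym (+-identityʳ _)))
      survives-tail z (suc L) v rewrite +-suc z L with prime? (suc (z + L))
      ... | no _  = ≤-trans (survives-tail z L v) (+-monoʳ-≤ (survives (z + L) v) (m≤m+n _ _))
      ... | yes _ with pairs (suc (z + L)) v ≟ 0
      ...   | yes _ = ≤-trans (survives-tail z L v) (+-mono-≤ (≤-reflexive (sym (*-identityʳ (survives (z + L) v)))) (m≤m+n (∑ L (λ i → pairs (suc (z + i)) v)) _))
      ...   | no ¬h = ≤-trans (∏ₚ≤1 z λ p → 𝟙≤1 (pairs p v ≟ 0))
                        (≤-trans (n≢0⇒n>0 ¬h) (≤-trans (m≤n+m _ _) (m≤n+m _ (survives (z + L) v * 0))))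

    B-≤-simplex : ∀ z → B (suc d) n ≤ simplex d N (sifted n z)
    B-≤-simplex z = subst₂ _≤_ (sym (B≡exact d N)) (exact-survives z) (exact-mono d N λ v _ _ → bound v)
      where
      bound : ∀ (v : Vec ℕ (suc d)) → 𝟙[ coprimes? v ] ≤ survives z v
      bound v with coprimes? v
      ... | no _  = z≤n
      ... | yes c = ≤-reflexive (sym (∏ₚ≡1 z λ p pr → 𝟙-yes (pairs p v ≟ 0) (coprimes⇒pairs≡0 v c p pr)))

    -- At level z + L ≥ n the sieve retains only coprime tuples, and `survives-tail` pays for the
    -- levels in between.
    simplex-≤-B : ∀ z L → n ≤ z + L → simplex d N (sifted n z) ≤ B (suc d) n + ∑ L (λ i → exact d N (pairs (suc (z + i))))
    simplex-≤-B z L n≤ = begin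
      simplex d N (sifted n z)
        ≡⟨ sym (exact-survives z) ⟩
      exact d N (survives z)
        ≤⟨ exact-mono d N (λ v v>0 eq → ≤-trans (survives-tail z L v) (+-monoˡ-≤ _ (survives≤coprimes (z + L) n≤ v v>0 eq))) ⟩
      exact d N (λ v → 𝟙[ coprimes? v ] + ∑ L (λ i → pairs (suc (z + i)) v))
        ≡⟨ exact-+ d N _ _ ⟩
      exact d N (λ v → 𝟙[ coprimes? v ]) + exact d N (λ v → ∑ L (λ i → pairs (suc (z + i)) v))
        ≡⟨ cong₂ _+_ (sym (B≡exact d N)) (exact-∑ d N L _) ⟩
      B (suc d) n + ∑ L (λ i → exact d N (pairs (suc (z + i)))) ∎

-- Counting residue tuples at one prime.

module LocalCounts where

  open import Data.Nat
  open import Data.Nat.Properties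
  open import Data.Nat.Divisibility
  open import Data.Nat.Primality
  open import Data.Nat.Tactic.RingSolver using (solve-∀)
  open import Data.Vec using (Vec; []; _∷_)
  open import Data.Product using (∃; ∃₂; _×_; _,_; proj₁)
  open import Data.Sum using (inj₁; inj₂)
  open import Data.Empty using (⊥-elim)
  open import Relation.Nullary using (¬_; yes; no)
  open import Relation.Binary.PropositionalEquality
  open import Defs using (module δ-Bounds; B)
  open LatticeSums
  open PrimeProducts
  open Sieve
  open ≤-Reasoning

  box-+ : ∀ M d (f g : Vec ℕ d → ℕ) → box M d (λ xs → f xs + g xs) ≡ box M d f + box M d g
  box-+ M zero    f g = refl
  box-+ M (suc d) f g = trans (∑-cong M λ x → box-+ M d _ _) (∑-+ M _ _)

  box-*ˡ : ∀ M d c (f : Vec ℕ d → ℕ) → box M d (λ xs → c * f xs) ≡ c * box M d f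
  box-*ˡ M zero    c f = refl
  box-*ˡ M (suc d) c f = trans (∑-cong M λ x → box-*ˡ M d c _) (∑-*ˡ M c _)

  box≤ : ∀ M d {f : Vec ℕ d → ℕ} → (∀ xs → f xs ≤ 1) → box M d f ≤ M ^ d
  box≤ M zero    h = h []
  box≤ M (suc d) h = ≤-trans (∑-mono M λ x → box≤ M d λ xs → h (x ∷ xs)) (≤-reflexive (∑-const M (M ^ d)))

  module LocalCount (q n : ℕ) where

    private
      p = suc q

    clear# good# : ℕ → ℕ → ℕ
    clear# d s = box p d (clear p n s)
    good#  d s = box p d (good p n s)

    private
      div-0 : div p 0 ≡ 1
      div-0 = 𝟙-yes (p ∣? 0) (p ∣0)

      div-suc : ∀ y → y < q → div p (suc y) ≡ 0
      div-suc y y<q = 𝟙-no (p ∣? suc y) λ p∣ → <⇒≱ (s≤s y<q) (∣⇒≤ p∣)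

    clear#-suc : ∀ d s → clear# (suc d) s ≡ ∑ q (λ y → clear# d (s + suc y))
    clear#-suc d s = begin-equality
      ∑ p (λ x → box p d (λ xs → (1 ∸ div p x) * clear p n (s + x) xs))
        ≡⟨ ∑-cong p (λ x → box-*ˡ p d (1 ∸ div p x) _) ⟩
      ∑ p (λ x → (1 ∸ div p x) * clear# d (s + x))
        ≡⟨ ∑-first q _ ⟩
      (1 ∸ div p 0) * clear# d (s + 0) + ∑ q (λ y → (1 ∸ div p (suc y)) * clear# d (s + suc y))
        ≡⟨ cong₂ _+_ (cong (λ t → (1 ∸ t) * clear# d (s + 0)) div-0)
             (∑-cong< q λ y y<q → trans (cong (λ t → (1 ∸ t) * clear# d (s + suc y)) (div-suc y y<q)) (*-identityˡ _)) ⟩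
      ∑ q (λ y → clear# d (s + suc y)) ∎

    good#-suc : ∀ d s → good# (suc d) s ≡ clear# d s + ∑ q (λ y → good# d (s + suc y))
    good#-suc d s = begin-equality
      ∑ p (λ x → box p d (λ xs → div p x * clear p n (s + x) xs + (1 ∸ div p x) * good p n (s + x) xs))
        ≡⟨ ∑-cong p (λ x → trans (box-+ p d _ _) (cong₂ _+_ (box-*ˡ p d (div p x) _) (box-*ˡ p d (1 ∸ div p x) _))) ⟩
      ∑ p (λ x → div p x * clear# d (s + x) + (1 ∸ div p x) * good# d (s + x))
        ≡⟨ ∑-first q _ ⟩
      div p 0 * clear# d (s + 0) + (1 ∸ div p 0) * good# d (s + 0)
        + ∑ q (λ y → div p (suc y) * clear# d (s + suc y) + (1 ∸ div p (suc y)) * good# d (s + suc y))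
        ≡⟨ cong₂ _+_
             (trans (cong (λ t → t * clear# d (s + 0) + (1 ∸ t) * good# d (s + 0)) div-0)
                    (trans (+-identityʳ _) (trans (*-identityˡ _) (cong (clear# d) (+-identityʳ s)))))
             (∑-cong< q λ y y<q → trans (cong (λ t → t * clear# d (s + suc y) + (1 ∸ t) * good# d (s + suc y)) (div-suc y y<q)) (*-identityˡ _)) ⟩
      clear# d s + ∑ q (λ y → good# d (s + suc y)) ∎

    private
      last-total : ∀ s → ∑ p (λ x → last p n (s + x)) ≡ 1
      last-total s = begin-equality
        ∑ p (λ x → last p n (s + x))   ≡⟨ ∑-translate p (last p n) (last-periodic p n) s ⟩
        ∑ p (last p n)                 ≡⟨ sym (∑-translate p (last p n) (last-periodic p n) n) ⟩
        ∑ p (λ x → last p n (n + x))   ≡⟨ ∑-first q _ ⟩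
        last p n (n + 0) + ∑ q (λ y → last p n (n + suc y))
          ≡⟨ cong₂ _+_ (trans (cong (div p) (gap 0)) div-0)
               (trans (∑-cong< q λ y y<q → trans (cong (div p) (gap (suc y))) (div-suc y y<q)) (∑-zero q)) ⟩
        1 ∎
        where
        gap : ∀ x → ∣ n + x - n ∣ ≡ x
        gap x = trans (∣-∣-comm (n + x) n) (∣m-m+n∣≡n n x)

    -- A tuple of d + 1 nonzero residues that is not clear has a zero last entry, hence is a clear d-tuple with one entry appended.
    clear#-rec : ∀ d s → clear# (suc d) s + clear# d s ≡ q ^ suc d
    clear#-rec zero    s = +-cancelʳ-≡ 1 _ _ (begin-equality
      clear# 1 s + clear# 0 s + 1
        ≡⟨ cong₂ (λ a b → a + clear# 0 b + 1) (clear#-suc 0 s) (sym (+-identityʳ s)) ⟩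
      ∑ q (λ y → clear# 0 (s + suc y)) + clear# 0 (s + 0) + 1
        ≡⟨ cong₂ _+_ (trans (+-comm _ (clear# 0 (s + 0))) (sym (∑-first q _))) (sym (last-total s)) ⟩
      ∑ p (λ x → 1 ∸ last p n (s + x)) + ∑ p (λ x → last p n (s + x))
        ≡⟨ sym (∑-+ p _ _) ⟩
      ∑ p (λ x → 1 ∸ last p n (s + x) + last p n (s + x))
        ≡⟨ ∑-cong p (λ x → m∸n+n≡m (𝟙≤1 (p ∣? ∣ s + x - n ∣))) ⟩
      ∑ p (λ x → 1)
        ≡⟨ trans (∑-const p 1) (trans (*-identityʳ p) (+-comm 1 q)) ⟩
      q + 1
        ≡⟨ cong (_+ 1) (sym (*-identityʳ q)) ⟩
      q * 1 + 1 ∎)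
    clear#-rec (suc d) s = begin-equality
      clear# (2 + d) s + clear# (suc d) s
        ≡⟨ cong₂ _+_ (clear#-suc (suc d) s) (clear#-suc d s) ⟩
      ∑ q (λ y → clear# (suc d) (s + suc y)) + ∑ q (λ y → clear# d (s + suc y))
        ≡⟨ sym (∑-+ q _ _) ⟩
      ∑ q (λ y → clear# (suc d) (s + suc y) + clear# d (s + suc y))
        ≡⟨ ∑-cong q (λ y → clear#-rec d (s + suc y)) ⟩
      ∑ q (λ _ → q ^ suc d)
        ≡⟨ ∑-const q _ ⟩
      q ^ (2 + d) ∎

    -- Of d + 2 residues, the last one included, either none vanishes or exactly one does. Deleting
    -- the vanishing one from any of its d + 2 positions leaves a clear d-tuple with the same sum;
    -- the induction carries this out through the two recursions.
    good#≡ : ∀ d s → good# (suc d) s ≡ clear# (suc d) s + (2 + d) * clear# d s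
    good#≡ zero    s = begin-equality
      good# 1 s                           ≡⟨ good#-suc 0 s ⟩
      clear# 0 s + ∑ q (λ _ → 1)          ≡⟨ cong (clear# 0 s +_) (trans (∑-const q 1) (sym (clear#-rec 0 s))) ⟩
      clear# 0 s + (clear# 1 s + clear# 0 s) ≡⟨ lem (clear# 0 s) (clear# 1 s) ⟩
      clear# 1 s + 2 * clear# 0 s         ∎
      where
      lem : ∀ a b → a + (b + a) ≡ b + 2 * a
      lem = solve-∀
    good#≡ (suc d) s = begin-equality
      good# (2 + d) s
        ≡⟨ good#-suc (suc d) s ⟩
      clear# (suc d) s + ∑ q (λ y → good# (suc d) (s + suc y))
        ≡⟨ cong (clear# (suc d) s +_) (trans (∑-cong q λ y → good#≡ d (s + suc y))
             (trans (∑-+ q _ _) (cong₂ _+_ (sym (clear#-suc (suc d) s))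
               (trans (∑-*ˡ q (2 + d) _) (cong ((2 + d) *_) (sym (clear#-suc d s))))))) ⟩
      clear# (suc d) s + (clear# (2 + d) s + (2 + d) * clear# (suc d) s)
        ≡⟨ lem (clear# (suc d) s) (clear# (2 + d) s) d ⟩
      clear# (2 + d) s + (3 + d) * clear# (suc d) s ∎
      where
      lem : ∀ a b d → a + (b + (2 + d) * a) ≡ b + (3 + d) * a
      lem = solve-∀

  good#-large : ∀ r n i s → let open LocalCount (suc r) n in
    (2 + r) ^ (2 + i) ≤ good# (2 + i) s + ((2 + i) * (2 + i) + (2 + i)) * (2 + r) ^ i
  good#-large r n i s = begin
    p ^ (2 + i)
      ≤⟨ binomial-≤ i ⟩
    q * q ^ suc i + (2 + i) * q ^ suc i + (2 + i) * (2 + i) * p ^ i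
      ≡⟨ cong₂ (λ a b → a + (2 + i) * b + (2 + i) * (2 + i) * p ^ i) (sym (clear#-rec (suc i) s)) (sym (clear#-rec i s)) ⟩
    clear# (2 + i) s + clear# (1 + i) s + (2 + i) * (clear# (1 + i) s + clear# i s) + (2 + i) * (2 + i) * p ^ i
      ≤⟨ +-monoˡ-≤ ((2 + i) * (2 + i) * p ^ i) (+-monoʳ-≤ (clear# (2 + i) s + clear# (1 + i) s)
           (*-monoʳ-≤ (2 + i) (+-monoʳ-≤ (clear# (1 + i) s) (box≤ p i (clear≤1 p n s))))) ⟩
    clear# (2 + i) s + clear# (1 + i) s + (2 + i) * (clear# (1 + i) s + p ^ i) + (2 + i) * (2 + i) * p ^ i
      ≡⟨ lem (clear# (2 + i) s) (clear# (1 + i) s) (p ^ i) i ⟩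
    clear# (2 + i) s + (3 + i) * clear# (1 + i) s + ((2 + i) * (2 + i) + (2 + i)) * p ^ i
      ≡⟨ cong (_+ ((2 + i) * (2 + i) + (2 + i)) * p ^ i) (sym (good#≡ (suc i) s)) ⟩
    good# (2 + i) s + ((2 + i) * (2 + i) + (2 + i)) * p ^ i ∎
    where
    open LocalCount (suc r) n
    open δ-Bounds i r using (p; q; binomial-≤)
    lem : ∀ a b c i → a + b + (2 + i) * (b + c) + (2 + i) * (2 + i) * c ≡ a + (3 + i) * b + ((2 + i) * (2 + i) + (2 + i)) * c
    lem = solve-∀

  goodCount : ℕ → ℕ → ℕ → ℕ
  goodCount d n p = box p d (good p n 0)

  goodCount≤ : ∀ d n p → goodCount d n p ≤ p ^ d
  goodCount≤ d n p = box≤ p d (good≤1 p n 0)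

  box-sifted : ∀ d n z → box (primorial z) d (sifted n z) ≡ ∏ₚ (goodCount d n) z
  box-sifted d n = box-∏ₚ d (λ p → good p n 0) (λ p _ → good-periodic p n d 0)

  sifted-periodic : ∀ d n z → Periodic (primorial z) d (sifted n z)
  sifted-periodic d n = Periodic-∏ₚ d (λ p → good p n 0) (λ p _ → good-periodic p n d 0)

  ∏ₚ-goodCount≤ : ∀ d n z → ∏ₚ (goodCount d n) z ≤ primorial z ^ d
  ∏ₚ-goodCount≤ d n z = subst (_≤ primorial z ^ d) (box-sifted d n z)
    (box≤ (primorial z) d λ xs → ∏ₚ≤1 z λ p → good≤1 p n 0 xs)

  sifted-simplex-≤ : ∀ d N z → d ! * primorial z ^ d * simplex d N (sifted (suc N) z)
                               ≤ ∏ₚ (goodCount d (suc N)) z * (N + d * primorial z) ^ d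
  sifted-simplex-≤ d N z = subst (λ t → d ! * primorial z ^ d * simplex d N (sifted (suc N) z) ≤ t * (N + d * primorial z) ^ d)
    (box-sifted d (suc N) z) (simplex-≤ (primorial z) d N _ (sifted-periodic d (suc N) z))

  sifted-simplex-≥ : ∀ d N z → ∏ₚ (goodCount d (suc N)) z * (N ∸ d * primorial z) ^ d
                               ≤ d ! * primorial z ^ d * simplex d N (sifted (suc N) z)
  sifted-simplex-≥ d N z = subst (λ t → t * (N ∸ d * primorial z) ^ d ≤ d ! * primorial z ^ d * simplex d N (sifted (suc N) z))
    (box-sifted d (suc N) z) (simplex-≥ (primorial z) d N _ (sifted-periodic d (suc N) z))

  -- For pairs the sifting function has period n as well as period primorial z, so the count is exact.
  B₂-exact : ∀ N z → 1 ≤ N → suc N ≤ z → B 2 (suc N) * primorial z ≡ suc N * ∏ₚ (goodCount 1 (suc N)) z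
  B₂-exact N z 1≤N n≤z = begin-equality
    B 2 n * P                       ≡⟨ cong (_* P) B≡ ⟩
    ∑ N (λ x → h (suc x)) * P       ≡⟨ cong (_* P) (trans (cong (_+ ∑ N (λ x → h (suc x))) (sym h0≡0)) (sym (∑-first N h))) ⟩
    ∑ n h * P                       ≡⟨ *-comm (∑ n h) P ⟩
    -- The sum of `h` over nP terms is evaluated twice: as P periods of length n and as n periods of
    -- length P.
    P * ∑ n h                       ≡⟨ sym (∑-periods n h (λ x → ∏ₚ-cong z λ p → good-n-periodic p x) P) ⟩
    ∑ (P * n) h                     ≡⟨ cong (λ t → ∑ t h) (*-comm P n) ⟩
    ∑ (n * P) h                     ≡⟨ ∑-periods P h (λ x → proj₁ (sifted-periodic 1 n z) x []) n ⟩
    n * ∑ P h                       ≡⟨ cong (n *_) (box-sifted 1 n z) ⟩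
    n * ∏ₚ (goodCount 1 n) z        ∎
    where
    n = suc N
    P = primorial z
    h : ℕ → ℕ
    h x = sifted n z (x ∷ [])
    B≡ : B 2 n ≡ ∑ N (λ x → h (suc x))
    B≡ = ≤-antisym (B-≤-simplex 1 N z)
      (≤-trans (simplex-≤-B 1 N z 0 (≤-trans n≤z (≤-reflexive (sym (+-identityʳ z))))) (≤-reflexive (+-identityʳ _)))
    good≡𝟙 : ∀ p x → p ∣ n → good p n 0 (x ∷ []) ≡ 1 ∸ div p x
    good≡𝟙 p x p∣n with p ∣? x
    ... | no _    = refl
    ... | yes p∣x = trans (+-identityʳ _) (trans (*-identityˡ _) (cong (1 ∸_) (𝟙-yes (p ∣? ∣ x - n ∣)
        (gap (≤-total x n)))))
      where
      gap : _ → p ∣ ∣ x - n ∣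
      gap (inj₁ x≤n) = subst (p ∣_) (sym (m≤n⇒∣m-n∣≡n∸m x≤n)) (∣m+n∣m⇒∣n (subst (p ∣_) (sym (m+[n∸m]≡n x≤n)) p∣n) p∣x)
      gap (inj₂ n≤x) = subst (p ∣_) (sym (m≤n⇒∣n-m∣≡n∸m n≤x)) (∣m+n∣m⇒∣n (subst (p ∣_) (sym (m+[n∸m]≡n n≤x)) p∣x) p∣n)
    good≡1 : ∀ p x → ¬ (p ∣ n) → good p n 0 (x ∷ []) ≡ 1
    good≡1 p x p∤n with p ∣? x
    ... | no _    = refl
    ... | yes p∣x = trans (+-identityʳ _) (trans (*-identityˡ _) (cong (1 ∸_) (𝟙-no (p ∣? ∣ x - n ∣) λ p∣ → p∤n (gap (≤-total x n) p∣))))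
      where
      gap : _ → p ∣ ∣ x - n ∣ → p ∣ n
      gap (inj₁ x≤n) p∣ = subst (p ∣_) (m+[n∸m]≡n x≤n) (∣m∣n⇒∣m+n p∣x (subst (p ∣_) (m≤n⇒∣m-n∣≡n∸m x≤n) p∣))
      gap (inj₂ n≤x) p∣ = ∣m+n∣n⇒∣m (subst (p ∣_) (sym (m+[n∸m]≡n n≤x)) p∣x) (subst (p ∣_) (m≤n⇒∣n-m∣≡n∸m n≤x) p∣)
        where
        ∣m+n∣n⇒∣m : ∀ {a b} → p ∣ a + b → p ∣ b → p ∣ a
        ∣m+n∣n⇒∣m {a} {b} h h′ = ∣m+n∣m⇒∣n (subst (p ∣_) (+-comm a b) h) h′
    -- If p does not divide n, two entries with sum n are never both divisible by p and the
    -- condition is void. If it does, both are divisible as soon as one is, so only the residue of x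
    -- matters.
    good-n-periodic : ∀ p x → good p n 0 (n + x ∷ []) ≡ good p n 0 (x ∷ [])
    good-n-periodic p x with p ∣? n
    ... | no p∤n  = trans (good≡1 p (n + x) p∤n) (sym (good≡1 p x p∤n))
    ... | yes p∣n = trans (good≡𝟙 p (n + x) p∣n) (trans (cong (1 ∸_)
      (𝟙-⇔ (p ∣? n + x) (p ∣? x) (λ h → ∣m+n∣m⇒∣n h p∣n) (λ h → ∣m∣n⇒∣m+n p∣n h))) (sym (good≡𝟙 p x p∣n)))
    -- The residue 0 stands for the pair (0, n), which any prime factor of n rejects; so a full
    -- period counts just the positive pairs.
    h0≡0 : h 0 ≡ 0
    h0≡0 = let (p , pr , p∣n) = primeDivisor n (s≤s 1≤N) in
      ∏ₚ-zero z p pr (≤-trans (∣⇒≤ p∣n) n≤z) (trans (good≡𝟙 p 0 p∣n) (cong (1 ∸_) (𝟙-yes (p ∣? 0) (p ∣0))))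

  -- The sieving level and elementary size estimates.

  floorLog₂ : ∀ n → 1 ≤ n → ∃ λ m → 2 ^ m ≤ n × n < 2 ^ suc m
  floorLog₂ (suc zero)    _ = 0 , ≤-refl , ≤-refl
  floorLog₂ (suc (suc n)) _ with floorLog₂ (suc n) (s≤s z≤n)
  ... | m , lo , hi with m≤n⇒m<n∨m≡n hi
  ...   | inj₁ hi′ = m , m≤n⇒m≤1+n lo , hi′
  ...   | inj₂ eq  = suc m , ≤-reflexive (sym eq) , subst (_< 2 ^ (2 + m)) (sym eq) (^-monoʳ-< 2 (s≤s (s≤s z≤n)) (n<1+n (suc m)))

  1+n≤2^n : ∀ n → suc n ≤ 2 ^ n
  1+n≤2^n zero    = ≤-refl
  1+n≤2^n (suc n) = begin
    2 + n           ≤⟨ m≤m+n (2 + n) n ⟩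
    2 + n + n       ≡⟨ lem n ⟩
    2 * suc n       ≤⟨ *-monoʳ-≤ 2 (1+n≤2^n n) ⟩
    2 * 2 ^ n       ∎
    where
    lem : ∀ n → 2 + n + n ≡ 2 * suc n
    lem = solve-∀

  2n≤2^n : ∀ n → 1 ≤ n → 2 * n ≤ 2 ^ n
  2n≤2^n (suc n) _ = *-monoʳ-≤ 2 (1+n≤2^n n)

  -- With 2^m ≤ n < 2^(m+1), z is the power of two with 4z ≤ m < 8z. The hypothesis gives 8(d+1)2^d
  -- ≤ m < 8z, hence d(d+1) ≤ z. Then 2d(d+1) ≤ 2^z, z + 1 ≤ 2^z and `primorial` z ≤ 4^z multiply to
  -- 2^(4z) ≤ 2^m ≤ n.
  sievingLevel : ∀ d n → 2 ^ (suc d * 2 ^ (suc d + 2)) ≤ n →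
    ∃₂ λ z m → n < 2 ^ suc m × m < 8 * z × 2 * suc z * d * (suc d * primorial z) ≤ n
  sievingLevel d n n≥ with floorLog₂ n (≤-trans (m^n>0 2 (suc d * 2 ^ (suc d + 2))) n≥)
  ... | m , lo , hi = go (floorLog₂ m (≤-trans (s≤s z≤n) 8≤m))
    where
    kk≤m : suc d * 2 ^ (suc d + 2) ≤ m
    kk≤m = ≮⇒≥ λ m< → <⇒≱ hi (≤-trans (^-monoʳ-≤ 2 m<) n≥)
    kk≡ : ∀ d → suc d * 2 ^ (suc d + 2) ≡ 8 * (suc d * 2 ^ d)
    kk≡ d = trans (cong (suc d *_) (^-distribˡ-+-* 2 (suc d) 2)) (lem d (2 ^ d))
      where
      lem : ∀ d u → suc d * (2 * u * 4) ≡ 8 * (suc d * u)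
      lem = solve-∀
    8≤m : 8 ≤ m
    8≤m = ≤-trans (≤-trans (*-monoʳ-≤ 8 (*-mono-≤ (s≤s (z≤n {d})) (m^n>0 2 d))) (≤-reflexive (sym (kk≡ d)))) kk≤m
    go : ∃ (λ j → 2 ^ j ≤ m × m < 2 ^ suc j) → _
    go (0 , _ , m<)           = ⊥-elim (<⇒≱ m< (≤-trans (s≤s (s≤s z≤n)) 8≤m))
    go (1 , _ , m<)           = ⊥-elim (<⇒≱ m< (≤-trans (s≤s (s≤s (s≤s (s≤s z≤n)))) 8≤m))
    go (suc (suc j) , lo′ , m<) = z , m , hi , m<8z , (begin
      2 * suc z * d * (suc d * primorial z)       ≡⟨ lem₁ z d (primorial z) ⟩
      2 * (d * suc d) * suc z * primorial z       ≤⟨ *-mono-≤ (*-mono-≤ (*-monoʳ-≤ 2 dk≤z) (1+n≤2^n z)) (primorial-2^-≤ j) ⟩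
      2 * z * 2 ^ z * 4 ^ z                       ≤⟨ *-monoˡ-≤ (4 ^ z) (*-monoˡ-≤ (2 ^ z) (2n≤2^n z (m^n>0 2 j))) ⟩
      2 ^ z * 2 ^ z * 4 ^ z                       ≡⟨ cong₂ _*_ (sym (^-distribˡ-+-* 2 z z)) (^-*-assoc 2 2 z) ⟩
      2 ^ (z + z) * 2 ^ (2 * z)                   ≡⟨ sym (^-distribˡ-+-* 2 (z + z) (2 * z)) ⟩
      2 ^ (z + z + 2 * z)                         ≡⟨ cong (2 ^_) (lem₂ z) ⟩
      2 ^ (2 * (2 * z))                           ≤⟨ ^-monoʳ-≤ 2 lo′ ⟩
      2 ^ m                                       ≤⟨ lo ⟩
      n                                           ∎)
      where
      z = 2 ^ j
      m<8z : m < 8 * z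
      m<8z = ≤-trans m< (≤-reflexive (lem z))
        where
        lem : ∀ z → 2 * (2 * (2 * z)) ≡ 8 * z
        lem = solve-∀
      dk≤z : d * suc d ≤ z
      dk≤z = *-cancelˡ-≤ 8 (begin
        8 * (d * suc d)         ≤⟨ *-monoʳ-≤ 8 (≤-trans (*-monoˡ-≤ (suc d) (≤-trans (n≤1+n d) (1+n≤2^n d))) (≤-reflexive (*-comm (2 ^ d) (suc d)))) ⟩
        8 * (suc d * 2 ^ d)     ≡⟨ sym (kk≡ d) ⟩
        suc d * 2 ^ (suc d + 2) ≤⟨ kk≤m ⟩
        m                       ≤⟨ <⇒≤ m<8z ⟩
        8 * z                   ∎)
      lem₁ : ∀ z d P → 2 * suc z * d * (suc d * P) ≡ 2 * (d * suc d) * suc z * P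
      lem₁ = solve-∀
      lem₂ : ∀ z → z + z + 2 * z ≡ 2 * (2 * z)
      lem₂ = solve-∀

  module _ (Z d n a : ℕ) (small : 2 * Z * d * a ≤ n) where

    private
      K = 2 * Z * d
      -- A linear bound for (1 + a/n)^i. Its slope 2, where first order would ask for 1, absorbs the
      -- cross term, since 2ia ≤ Ka ≤ n.
      growth : ∀ i → 2 * i ≤ K → K * (n + a) ^ i ≤ (K + 2 * i) * n ^ i
      growth zero    _ = ≤-reflexive (cong (_* 1) (sym (+-identityʳ K)))
      growth (suc i) h = begin
        K * ((n + a) * (n + a) ^ i)             ≡⟨ lem₁ K (n + a) _ ⟩
        (n + a) * (K * (n + a) ^ i)             ≤⟨ *-monoʳ-≤ (n + a) (growth i 2i≤K) ⟩
        (n + a) * ((K + 2 * i) * n ^ i)         ≡⟨ lem₂ n a K i (n ^ i) ⟩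
        (K * a + 2 * i * a + (K + 2 * i) * n) * n ^ i
          ≤⟨ *-monoˡ-≤ (n ^ i) (+-monoˡ-≤ ((K + 2 * i) * n) (+-mono-≤ small (≤-trans (*-monoˡ-≤ a 2i≤K) small))) ⟩
        (n + n + (K + 2 * i) * n) * n ^ i       ≡⟨ lem₃ n K i (n ^ i) ⟩
        (K + 2 * suc i) * (n * n ^ i)           ∎
        where
        2i≤K : 2 * i ≤ K
        2i≤K = ≤-trans (*-monoʳ-≤ 2 (n≤1+n i)) h
        lem₁ : ∀ a b c → a * (b * c) ≡ b * (a * c)
        lem₁ = solve-∀
        lem₂ : ∀ n a K i u → (n + a) * ((K + 2 * i) * u) ≡ (K * a + 2 * i * a + (K + 2 * i) * n) * u
        lem₂ = solve-∀
        lem₃ : ∀ n K i u → (n + n + (K + 2 * i) * n) * u ≡ (K + 2 * suc i) * (n * u)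
        lem₃ = solve-∀

    power-upper : .{{NonZero Z}} → .{{NonZero d}} → Z * (n + a) ^ d ≤ suc Z * n ^ d
    power-upper = *-cancelˡ-≤ (2 * d) {{m*n≢0 2 d}} (begin
      2 * d * (Z * (n + a) ^ d)     ≡⟨ lem₁ d Z ((n + a) ^ d) ⟩
      K * (n + a) ^ d               ≤⟨ growth d (≤-trans (m≤n*m (2 * d) Z) (≤-reflexive (lem₂ d Z))) ⟩
      (K + 2 * d) * n ^ d           ≡⟨ lem₃ d Z (n ^ d) ⟩
      2 * d * (suc Z * n ^ d)       ∎)
      where
      lem₁ : ∀ d Z u → 2 * d * (Z * u) ≡ 2 * Z * d * u
      lem₁ = solve-∀
      lem₂ : ∀ d Z → Z * (2 * d) ≡ 2 * Z * d
      lem₂ = solve-∀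
      lem₃ : ∀ d Z u → (2 * Z * d + 2 * d) * u ≡ 2 * d * (suc Z * u)
      lem₃ = solve-∀

  power-lower : ∀ Z d n a → 2 * Z * d * a ≤ n → .{{NonZero d}} → Z * n ^ d ≤ Z * (n ∸ a) ^ d + n ^ d
  power-lower Z (suc d) n a small = begin
    Z * n ^ suc d                                   ≤⟨ *-monoʳ-≤ Z (bernoulli-∸ a n d) ⟩
    Z * (suc d * a * n ^ d + (n ∸ a) ^ suc d)       ≡⟨ lem Z (suc d) a (n ^ d) _ ⟩
    Z * (n ∸ a) ^ suc d + Z * suc d * a * n ^ d     ≤⟨ +-monoʳ-≤ (Z * (n ∸ a) ^ suc d) (*-monoˡ-≤ (n ^ d)
        (≤-trans (≤-trans (m≤n*m (Z * suc d * a) 2) (≤-reflexive (lem₂ Z (suc d) a))) small)) ⟩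
    Z * (n ∸ a) ^ suc d + n ^ suc d                 ∎
    where
    lem : ∀ Z d a u v → Z * (d * a * u + v) ≡ Z * v + Z * d * a * u
    lem = solve-∀
    lem₂ : ∀ Z d a → 2 * (Z * d * a) ≡ 2 * Z * d * a
    lem₂ = solve-∀

  [3+i]²≤8[2+i]! : ∀ i → (3 + i) * (3 + i) ≤ 8 * (2 + i) !
  [3+i]²≤8[2+i]! zero    = m≤m+n 9 7
  [3+i]²≤8[2+i]! (suc i) = begin
    (4 + i) * (4 + i)                     ≤⟨ m≤m+n _ (11 + 19 * i + 8 * (i * i) + i * i * i) ⟩
    (4 + i) * (4 + i) + (11 + 19 * i + 8 * (i * i) + i * i * i)   ≡⟨ lem i ⟩
    (3 + i) * ((3 + i) * (3 + i))         ≤⟨ *-monoʳ-≤ (3 + i) ([3+i]²≤8[2+i]! i) ⟩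
    (3 + i) * (8 * (2 + i) !)             ≡⟨ lem₂ (3 + i) ((2 + i) !) ⟩
    8 * ((3 + i) * (2 + i) !)             ∎
    where
    lem : ∀ i → (4 + i) * (4 + i) + (11 + 19 * i + 8 * (i * i) + i * i * i) ≡ (3 + i) * ((3 + i) * (3 + i))
    lem = solve-∀
    lem₂ : ∀ a b → a * (8 * b) ≡ 8 * (a * b)
    lem₂ = solve-∀

  d²+d≤8d! : ∀ i → (2 + i) * (2 + i) + (2 + i) ≤ 8 * (2 + i) !
  d²+d≤8d! i = ≤-trans (≤-trans (m≤m+n _ (3 + i)) (≤-reflexive (lem i))) ([3+i]²≤8[2+i]! i)
    where
    lem : ∀ i → (2 + i) * (2 + i) + (2 + i) + (3 + i) ≡ (3 + i) * (3 + i)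
    lem = solve-∀

  -- The denominator (j+1)(j+2) is chosen because its series telescopes; p(p+1) ≤ 2p² then turns the
  -- 8 of the factorial estimate into 16.
  exact-pairs-step : ∀ i N j → exact (2 + i) N (pairs (suc j)) * (suc j * suc (suc j)) ≤ 16 * N ^ (2 + i)
  exact-pairs-step i N j = *-cancelˡ-≤ ((2 + i) !) {{(2 + i) !≢0}} (begin
    (2 + i) ! * (E * (p * suc p))                 ≤⟨ *-monoʳ-≤ ((2 + i) !) (*-monoʳ-≤ E (*-monoʳ-≤ p (m≤m+n (suc p) j))) ⟩
    (2 + i) ! * (E * (p * (suc p + j)))           ≡⟨ lem ((2 + i) !) E j ⟩
    2 * ((2 + i) ! * (p * (p * 1)) * E)           ≤⟨ *-monoʳ-≤ 2 (exact-pairs p i N) ⟩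
    2 * ((3 + i) * (3 + i) * N ^ (2 + i))         ≤⟨ *-monoʳ-≤ 2 (*-monoˡ-≤ (N ^ (2 + i)) ([3+i]²≤8[2+i]! i)) ⟩
    2 * (8 * (2 + i) ! * N ^ (2 + i))             ≡⟨ lem₂ ((2 + i) !) (N ^ (2 + i)) ⟩
    (2 + i) ! * (16 * N ^ (2 + i))                ∎)
    where
    p = suc j
    E = exact (2 + i) N (pairs p)
    lem : ∀ f E j → f * (E * (suc j * (suc (suc j) + j))) ≡ 2 * (f * (suc j * (suc j * 1)) * E)
    lem = solve-∀
    lem₂ : ∀ f u → 2 * (8 * f * u) ≡ f * (16 * u)
    lem₂ = solve-∀

  ^-distribʳ-* : ∀ d a b → (a * b) ^ d ≡ a ^ d * b ^ d
  ^-distribʳ-* zero    a b = refl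
  ^-distribʳ-* (suc d) a b = trans (cong (a * b *_) (^-distribʳ-* d a b)) (lem a b (a ^ d) (b ^ d))
    where
    lem : ∀ a b c d → a * b * (c * d) ≡ a * c * (b * d)
    lem = solve-∀

-- Local counts as the factors of D_k and g_k.

module LocalDensities where

  open import Data.Nat as ℕ using (ℕ; zero; suc; NonZero; _!; z≤n; s≤s)
  import Data.Nat.Properties as ℕₚ
  open import Data.Nat.Divisibility using (_∣_; _∣?_; ∣⇒≤)
  open import Data.Nat.Primality using (Prime; prime?; prime⇒nonZero; ¬prime[0]; ¬prime[1])
  open import Data.Rational
    using (ℚ; 0ℚ; 1ℚ; _+_; _-_; -_; _*_; 1/_; _÷_; ∣_∣; _≤_; Positive; positive; nonNegative)
  import Data.Rational as ℚ
  open import Data.Rational.Properties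
  open import Data.Rational.Solver using (module +-*-Solver)
  open import Data.Product using (∃; _×_; _,_; proj₁; proj₂)
  open import Data.Empty using (⊥-elim)
  open import Level using (0ℓ)
  open import Function using (_∘_)
  open import Relation.Nullary using (¬_; Dec; yes; no)
  open import Relation.Nullary.Decidable using (_×-dec_)
  open import Relation.Unary using (Pred; Decidable)
  open import Relation.Binary.PropositionalEquality hiding (J)
  open import Defs hiding (e)
  open PrimeProducts
  open Sieve
  open LocalCounts
  open +-*-Solver

  *-monoˡ : ∀ {r p q} → 0ℚ ≤ r → p ≤ q → r * p ≤ r * q
  *-monoˡ {r} r≥0 = *-monoˡ-≤-nonNeg r {{nonNegative r≥0}}

  *-monoʳ : ∀ {r p q} → 0ℚ ≤ r → p ≤ q → p * r ≤ q * r
  *-monoʳ {r} r≥0 = *-monoʳ-≤-nonNeg r {{nonNegative r≥0}}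

  ÷-* : ∀ p q .{{_ : ℚ.NonZero q}} → (p ÷ q) * q ≡ p
  ÷-* p q = trans (*-assoc p (1/ q) q) (trans (cong (p *_) (*-inverseˡ q)) (*-identityʳ p))

  fromℕ≥0 : ∀ n → 0ℚ ≤ fromℕ n
  fromℕ≥0 n = nonNegative⁻¹ (fromℕ n) {{fromℕ-nonNeg n}}

  *-cancelʳ-≡-pos : ∀ {p q} r → Positive r → p * r ≡ q * r → p ≡ q
  *-cancelʳ-≡-pos r r>0 eq = ≤-antisym
    (*-cancelʳ-≤-pos r {{r>0}} (≤-reflexive eq)) (*-cancelʳ-≤-pos r {{r>0}} (≤-reflexive (sym eq)))

  module _ (q n : ℕ) where

    open LocalCount q n

    private
      p = suc q
      P = fromℕ p
      Q = fromℕ q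

      P≡ : P ≡ 1ℚ + Q
      P≡ = fromℕ-suc q

    clear#-closed : ∀ d s → P * fromℕ (clear# d s) ≡ Q ^ suc d + (- 1ℚ) ^ suc d * (P * fromℕ (last p n s) - 1ℚ)
    clear#-closed zero s = begin
      P * fromℕ (1 ℕ.∸ last p n s)
        ≡⟨ cong (P *_) (begin
             c                 ≡⟨ solve 2 (λ a b → a := (a :+ b) :- b) refl c l ⟩
             c + l - l         ≡⟨ cong (_- l) (sym (fromℕ-+ (1 ℕ.∸ last p n s) (last p n s))) ⟩
             fromℕ (1 ℕ.∸ last p n s ℕ.+ last p n s) - l ≡⟨ cong (λ t → fromℕ t - l) (ℕₚ.m∸n+n≡m (𝟙≤1 (p ∣? ℕ.∣ s - n ∣))) ⟩
             1ℚ - l            ∎) ⟩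
      P * (1ℚ - l)
        ≡⟨ cong (λ t → t * (1ℚ - l)) P≡ ⟩
      (1ℚ + Q) * (1ℚ - l)
        ≡⟨ solve 2 (λ q l → (con 1ℚ :+ q) :* (con 1ℚ :- l) := q :* con 1ℚ :+ (:- con 1ℚ :* con 1ℚ) :* ((con 1ℚ :+ q) :* l :- con 1ℚ)) refl Q l ⟩
      Q * 1ℚ + (- 1ℚ * 1ℚ) * ((1ℚ + Q) * l - 1ℚ)
        ≡⟨ cong (λ t → Q * 1ℚ + (- 1ℚ * 1ℚ) * (t * l - 1ℚ)) (sym P≡) ⟩
      Q * 1ℚ + (- 1ℚ * 1ℚ) * (P * l - 1ℚ) ∎
      where
      open ≡-Reasoning
      c = fromℕ (1 ℕ.∸ last p n s)
      l = fromℕ (last p n s)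
    clear#-closed (suc d) s = begin
      P * c₁                                   ≡⟨ solve 3 (λ p a b → p :* a := p :* (a :+ b) :- p :* b) refl P c₁ c₀ ⟩
      P * (c₁ + c₀) - P * c₀                   ≡⟨ cong₂ (λ a b → P * a - b) rec (clear#-closed d s) ⟩
      P * U - (U + e * v)                      ≡⟨ cong (λ t → t * U - (U + e * v)) P≡ ⟩
      (1ℚ + Q) * U - (U + e * v)               ≡⟨ solve 4 (λ q u e v → (con 1ℚ :+ q) :* u :- (u :+ e :* v) := q :* u :+ (:- con 1ℚ :* e) :* v) refl Q U e v ⟩
      Q * U + (- 1ℚ * e) * v                   ∎
      where
      open ≡-Reasoning
      c₁ = fromℕ (clear# (suc d) s)
      c₀ = fromℕ (clear# d s)
      U = Q ^ suc d
      e = (- 1ℚ) ^ suc d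
      v = P * fromℕ (last p n s) - 1ℚ
      rec : c₁ + c₀ ≡ U
      rec = trans (sym (fromℕ-+ (clear# (suc d) s) (clear# d s))) (trans (cong fromℕ (clear#-rec d s)) (fromℕ-^ q (suc d)))

    -- This is where the polynomial δ_k comes from: in `good#≡` the powers of q form its leading
    -- part, and the alternating terms leave its constant term and, when p divides n, the correction
    -- encoded in g_k.
    good#-closed : ∀ d .{{_ : ℚ.NonZero P}} →
      fromℕ (good# (suc d) 0) ≡ δ (2 ℕ.+ d) P + (- 1ℚ) ^ suc d * fromℕ (suc d) * fromℕ (div p n)
    good#-closed d = *-cancelʳ-≡-pos P (fromℕ-pos p) (begin
      G * P
        ≡⟨ cong (_* P) (trans (cong fromℕ (good#≡ d 0)) (trans (fromℕ-+ (clear# (suc d) 0) _)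
             (cong (c₁ +_) (trans (fromℕ-* (2 ℕ.+ d) (clear# d 0)) (cong (_* c₀) (fromℕ-suc (suc d))))))) ⟩
      (c₁ + (1ℚ + J) * c₀) * P
        ≡⟨ solve 4 (λ p a b j → (a :+ (con 1ℚ :+ j) :* b) :* p := p :* a :+ (con 1ℚ :+ j) :* (p :* b)) refl P c₁ c₀ J ⟩
      P * c₁ + (1ℚ + J) * (P * c₀)
        -- The distance from 0 to n computes to n, so `last p n 0` is `div p n`.
        ≡⟨ cong₂ (λ a b → a + (1ℚ + J) * b) (clear#-closed (suc d) 0) (clear#-closed d 0) ⟩
      Q * U + (- 1ℚ * e) * (P * l - 1ℚ) + (1ℚ + J) * (U + e * (P * l - 1ℚ))
        ≡⟨ solve 6 (λ p q u e j l → q :* u :+ (:- con 1ℚ :* e) :* (p :* l :- con 1ℚ) :+ (con 1ℚ :+ j) :* (u :+ e :* (p :* l :- con 1ℚ))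
                    := (q :* u :+ (con 1ℚ :+ j) :* u :+ (:- con 1ℚ :* e) :* j) :+ e :* j :* l :* p) refl P Q U e J l ⟩
      Q * U + (1ℚ + J) * U + (- 1ℚ * e) * J + e * J * l * P
        ≡⟨ cong₂ (λ a b → a ^ (2 ℕ.+ d) + b * a ^ suc d + (- 1ℚ * e) * J + e * J * l * P) Q≡ (sym (fromℕ-suc (suc d))) ⟩
      num + e * J * l * P
        ≡⟨ cong (_+ e * J * l * P) (sym (÷-* num P)) ⟩
      δ (2 ℕ.+ d) P * P + e * J * l * P
        ≡⟨ sym (*-distribʳ-+ P (δ (2 ℕ.+ d) P) (e * J * l)) ⟩
      (δ (2 ℕ.+ d) P + e * J * l) * P ∎)
      where
      open ≡-Reasoning
      G = fromℕ (good# (suc d) 0)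
      c₁ = fromℕ (clear# (suc d) 0)
      c₀ = fromℕ (clear# d 0)
      U = Q ^ suc d
      e = (- 1ℚ) ^ suc d
      J = fromℕ (suc d)
      l = fromℕ (div p n)
      num = (P - 1ℚ) ^ (2 ℕ.+ d) + fromℕ (2 ℕ.+ d) * (P - 1ℚ) ^ suc d + (- 1ℚ) ^ (2 ℕ.+ d) * J
      Q≡ : Q ≡ P - 1ℚ
      Q≡ = sym (trans (cong (_- 1ℚ) P≡) (solve 1 (λ q → con 1ℚ :+ q :- con 1ℚ := q) refl Q))

  module _ {Q : Pred ℕ 0ℓ} (Q? : Decidable Q) (f : (p : ℕ) → .(Q p) → ℚ) where

    ∏-yes : ∀ N → (Qp : Q (suc N)) → ∏[ Q? , f ] (suc N) ≡ ∏[ Q? , f ] N * f (suc N) Qp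
    ∏-yes N Qp with Q? (suc N)
    ... | yes _ = refl
    ... | no ¬Q = ⊥-elim (¬Q Qp)

    ∏-no : ∀ N → ¬ Q (suc N) → ∏[ Q? , f ] (suc N) ≡ ∏[ Q? , f ] N
    ∏-no N ¬Q with Q? (suc N)
    ... | yes Qp = ⊥-elim (¬Q Qp)
    ... | no _   = refl

  ∏ₚ-yes : ∀ h z → Prime (suc z) → ∏ₚ h (suc z) ≡ ∏ₚ h z ℕ.* h (suc z)
  ∏ₚ-yes h z pr with prime? (suc z)
  ... | yes _  = refl
  ... | no ¬pr = ⊥-elim (¬pr pr)

  ∏ₚ-no : ∀ h z → ¬ Prime (suc z) → ∏ₚ h (suc z) ≡ ∏ₚ h z
  ∏ₚ-no h z ¬pr with prime? (suc z)
  ... | yes pr = ⊥-elim (¬pr pr)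
  ... | no _   = refl

  D-factor-* : ∀ i p (pr : Prime p) → D-factor (2 ℕ.+ i) p pr * fromℕ (p ℕ.^ suc i) ≡ δₚ (2 ℕ.+ i) p {{pr}}
  D-factor-* i p pr = ÷-* (δₚ (2 ℕ.+ i) p {{pr}}) (fromℕ (p ℕ.^ suc i)) {{ℕₚ.m^n≢0 p (suc i) {{prime⇒nonZero pr}}}}

  g-factor-* : ∀ i p (pr : Prime p) → g-factor (2 ℕ.+ i) p pr * δₚ (2 ℕ.+ i) p {{pr}}
                                       ≡ δₚ (2 ℕ.+ i) p {{pr}} + (- 1ℚ) ^ suc i * fromℕ (suc i)
  g-factor-* i p pr = lem Δ ((- 1ℚ) ^ suc i * fromℕ (suc i)) {{pos⇒nonZero Δ {{positive (δₚ>0 (2 ℕ.+ i) p {{pr}})}}}}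
    where
    Δ = δₚ (2 ℕ.+ i) p {{pr}}
    lem : ∀ Δ e .{{_ : ℚ.NonZero Δ}} → (1ℚ + e ÷ Δ) * Δ ≡ Δ + e
    lem Δ e = trans (*-distribʳ-+ Δ 1ℚ (e ÷ Δ)) (cong₂ _+_ (*-identityˡ Δ) (÷-* e Δ))

  goodCount-δ : ∀ i n p (pr : Prime p) → fromℕ (goodCount (suc i) n p)
                ≡ δₚ (2 ℕ.+ i) p {{pr}} + (- 1ℚ) ^ suc i * fromℕ (suc i) * fromℕ (div p n)
  goodCount-δ i n zero    pr = ⊥-elim (¬prime[0] pr)
  goodCount-δ i n (suc q) pr = good#-closed q n i

  module Density (i n : ℕ) .{{_ : NonZero n}} where

    private
      k d : ℕ
      k = 2 ℕ.+ i
      d = suc i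

      g? : Decidable (λ p → Prime p × p ∣ n)
      g? p = prime? p ×-dec p ∣? n

      g-factor′ : (p : ℕ) → .(Prime p × p ∣ n) → ℚ
      g-factor′ p pr = g-factor k p (proj₁ pr)

    g-partial : ℕ → ℚ
    g-partial = ∏[ g? , g-factor′ ]

    -- The density, among all residue tuples with sum n, of those with no two entries divisible by a prime p ≤ z.
    density : ℕ → ℚ
    density z = D-partial k z * g-partial z

    -- Prime divisors of n are at most n, so from there on only D_k is still changing.
    g-partial-stable : ∀ z → n ℕ.≤ z → g-partial z ≡ g k n
    g-partial-stable z n≤z = subst (λ t → g-partial t ≡ g k n) (ℕₚ.m+[n∸m]≡n n≤z) (go (z ℕ.∸ n))
      where
      go : ∀ L → g-partial (n ℕ.+ L) ≡ g k n
      go zero    = cong g-partial (ℕₚ.+-identityʳ n)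
      go (suc L) = trans (cong g-partial (ℕₚ.+-suc n L))
        (trans (∏-no g? g-factor′ (n ℕ.+ L)
                 (λ (_ , p∣n) → ℕₚ.<⇒≱ (s≤s (ℕₚ.m≤m+n n L)) (∣⇒≤ p∣n)))
               (go L))

    density-no : ∀ z → ¬ Prime (suc z) → density (suc z) ≡ density z
    density-no z ¬pr = cong₂ _*_ (∏-no prime? (D-factor k) z ¬pr)
      (∏-no g? g-factor′ z (¬pr ∘ proj₁))

    private
      -- The equations come as arguments matched with `refl`, so the solver meets variables instead
      -- of the full rational expressions.
      count-∤ : ∀ y e {x l G} → x ≡ y → G ≡ y + e * fromℕ l → l ≡ 0 → x ≡ G
      count-∤ y e refl refl refl = solve 2 (λ a b → a := a :+ b :* con 0ℚ) refl y e

      count-∣ : ∀ f γ w y e {l G} → f * w ≡ y → γ * y ≡ y + e → G ≡ y + e * fromℕ l → l ≡ 1 → f * γ * w ≡ G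
      count-∣ f γ w y e refl eq refl refl = trans (solve 3 (λ a b c → a :* b :* c := b :* (a :* c)) refl f γ w)
        (trans eq (cong (y +_) (sym (*-identityʳ e))))

      regroup : ∀ a b c {x y} → x ≡ a * b → y ≡ c → x * y ≡ a * c * b
      regroup a b c refl refl = solve 3 (λ a b c → a :* b :* c := a :* c :* b) refl a b c

      regroup₂ : ∀ a b c d {x y} → x ≡ a * b → y ≡ c * d → x * y ≡ a * c * (b * d)
      regroup₂ a b c d refl refl = solve 4 (λ a b c d → a :* b :* (c :* d) := a :* c :* (b :* d)) refl a b c d

    -- Multiplying by p^(k-1) turns the factor of D_k into δ_k(p); the factor of g_k, present when p
    -- divides n, adds the correction of `goodCount-δ`. Either way the combined factor is a
    -- proportion of residue tuples.
    localDensity : ∀ z → Prime (suc z) → ∃ λ ρ → density (suc z) ≡ density z * ρ ×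
                   ρ * fromℕ (suc z ℕ.^ d) ≡ fromℕ (goodCount d n (suc z))
    localDensity z pr = go (p ∣? n)
      where
      p = suc z
      f = D-factor k p pr
      γ = g-factor k p pr
      w = fromℕ (p ℕ.^ d)
      Δ = δₚ k p {{pr}}
      e = (- 1ℚ) ^ d * fromℕ d
      go : Dec (p ∣ n) → _
      go (no p∤n)  = f ,
        regroup (D-partial k z) f (g-partial z) (∏-yes prime? (D-factor k) z pr) (∏-no g? g-factor′ z (p∤n ∘ proj₂)) ,
        count-∤ Δ e (D-factor-* i p pr) (goodCount-δ i n p pr) (𝟙-no (p ∣? n) p∤n)
      go (yes p∣n) = f * γ ,
        regroup₂ (D-partial k z) f (g-partial z) γ (∏-yes prime? (D-factor k) z pr) (∏-yes g? g-factor′ z (pr , p∣n)) ,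
        count-∣ f γ w Δ e (D-factor-* i p pr) (g-factor-* i p pr) (goodCount-δ i n p pr) (𝟙-yes (p ∣? n) p∣n)

    private
      P^ : ℕ → ℚ
      P^ z = fromℕ (primorial z ℕ.^ d)

      P^-pos : ∀ z → Positive (P^ z)
      P^-pos z = fromℕ-pos (primorial z ℕ.^ d) {{ℕₚ.m^n≢0 (primorial z) d {{ℕ.>-nonZero (primorial>0 z)}}}}

    density-count : ∀ z → density z * fromℕ (primorial z ℕ.^ d) ≡ fromℕ (∏ₚ (goodCount d n) z)
    density-count zero    = cong (λ t → 1ℚ * 1ℚ * fromℕ t) (ℕₚ.^-zeroˡ d)
    density-count (suc z) = go (prime? (suc z))
      where
      open ≡-Reasoning
      go : Dec (Prime (suc z)) → _
      go (no ¬pr) = begin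
        density (suc z) * P^ (suc z)    ≡⟨ cong₂ _*_ (density-no z ¬pr) (cong (λ t → fromℕ (t ℕ.^ d)) (∏ₚ-no (λ p → p) z ¬pr)) ⟩
        density z * P^ z                ≡⟨ density-count z ⟩
        fromℕ (∏ₚ (goodCount d n) z)    ≡⟨ cong fromℕ (sym (∏ₚ-no (goodCount d n) z ¬pr)) ⟩
        fromℕ (∏ₚ (goodCount d n) (suc z)) ∎
      go (yes pr) = let (ρ , step , ρ-count) = localDensity z pr in begin
        density (suc z) * P^ (suc z)
          ≡⟨ cong₂ _*_ step (trans (cong (λ t → fromℕ (t ℕ.^ d)) (∏ₚ-yes (λ p → p) z pr))
               (trans (cong fromℕ (^-distribʳ-* d (primorial z) (suc z))) (fromℕ-* (primorial z ℕ.^ d) (suc z ℕ.^ d)))) ⟩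
        density z * ρ * (P^ z * fromℕ (suc z ℕ.^ d))
          ≡⟨ solve 4 (λ a b c e → a :* b :* (c :* e) := (a :* c) :* (b :* e)) refl (density z) ρ (P^ z) (fromℕ (suc z ℕ.^ d)) ⟩
        density z * P^ z * (ρ * fromℕ (suc z ℕ.^ d))
          ≡⟨ cong₂ _*_ (density-count z) ρ-count ⟩
        fromℕ (∏ₚ (goodCount d n) z) * fromℕ (goodCount d n (suc z))
          ≡⟨ sym (fromℕ-* (∏ₚ (goodCount d n) z) (goodCount d n (suc z))) ⟩
        fromℕ (∏ₚ (goodCount d n) z ℕ.* goodCount d n (suc z))
          ≡⟨ cong fromℕ (sym (∏ₚ-yes (goodCount d n) z pr)) ⟩
        fromℕ (∏ₚ (goodCount d n) (suc z)) ∎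

    density≥0 : ∀ z → 0ℚ ≤ density z
    density≥0 z = *-cancelʳ-≤-pos (P^ z) {{P^-pos z}}
      (subst₂ _≤_ (sym (*-zeroˡ (P^ z))) (sym (density-count z)) (fromℕ≥0 _))

    -- The bound is read off from the count of residue tuples; it is not visible in the separate
    -- products, since the factors of g_k exceed 1 for odd k.
    density≤1 : ∀ z → density z ≤ 1ℚ
    density≤1 z = *-cancelʳ-≤-pos (P^ z) {{P^-pos z}}
      (subst₂ _≤_ (sym (density-count z)) (sym (*-identityˡ (P^ z))) (fromℕ-≤ (∏ₚ-goodCount≤ d n z)))

  module _ (i n : ℕ) .{{_ : NonZero n}} where

    open Density (suc i) n

    private
      d C : ℕ
      d = 2 ℕ.+ i
      C = d ℕ.* d ℕ.+ d

      1-ρ-bound : ∀ r ρ → ρ * fromℕ ((2 ℕ.+ r) ℕ.^ d) ≡ fromℕ (goodCount d n (2 ℕ.+ r)) →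
        0ℚ ≤ 1ℚ - ρ × (1ℚ - ρ) * fromℕ ((2 ℕ.+ r) ℕ.* (3 ℕ.+ r)) ≤ fromℕ (16 ℕ.* d !)
      1-ρ-bound r ρ eq = 0≤1-ρ , (begin
        (1ℚ - ρ) * fromℕ (p ℕ.* suc p)       ≤⟨ *-monoˡ 0≤1-ρ (fromℕ-≤ p[p+1]≤) ⟩
        (1ℚ - ρ) * fromℕ (2 ℕ.* (p ℕ.* p))   ≡⟨ cong ((1ℚ - ρ) *_) (fromℕ-* 2 (p ℕ.* p)) ⟩
        (1ℚ - ρ) * (fromℕ 2 * fromℕ (p ℕ.* p)) ≡⟨ solve 3 (λ a b c → a :* (b :* c) := b :* (a :* c)) refl (1ℚ - ρ) (fromℕ 2) (fromℕ (p ℕ.* p)) ⟩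
        fromℕ 2 * ((1ℚ - ρ) * fromℕ (p ℕ.* p)) ≤⟨ *-monoˡ (fromℕ≥0 2) main ⟩
        fromℕ 2 * fromℕ C                    ≤⟨ *-monoˡ (fromℕ≥0 2) (fromℕ-≤ (d²+d≤8d! i)) ⟩
        fromℕ 2 * fromℕ (8 ℕ.* d !)          ≡⟨ sym (fromℕ-* 2 (8 ℕ.* d !)) ⟩
        fromℕ (2 ℕ.* (8 ℕ.* d !))            ≡⟨ cong fromℕ (sym (ℕₚ.*-assoc 2 8 (d !))) ⟩
        fromℕ (16 ℕ.* d !)                   ∎)
        where
        open ≤-Reasoning
        p = 2 ℕ.+ r
        G = goodCount d n p
        p[p+1]≤ : p ℕ.* suc p ℕ.≤ 2 ℕ.* (p ℕ.* p)
        p[p+1]≤ = ℕₚ.≤-trans (ℕₚ.*-monoʳ-≤ p (ℕₚ.+-monoˡ-≤ p (s≤s (z≤n {suc r})))) (ℕₚ.≤-reflexive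
          (trans (ℕₚ.*-distribˡ-+ p p p) (cong (p ℕ.* p ℕ.+_) (sym (ℕₚ.+-identityʳ (p ℕ.* p))))))
        pos-^ : ∀ m → Positive (fromℕ (p ℕ.^ m))
        pos-^ m = fromℕ-pos (p ℕ.^ m) {{ℕₚ.m^n≢0 p m}}
        scaled : (1ℚ - ρ) * fromℕ (p ℕ.^ d) ≡ fromℕ (p ℕ.^ d) - fromℕ G
        scaled = trans (solve 2 (λ a b → (con 1ℚ :- a) :* b := b :- a :* b) refl ρ (fromℕ (p ℕ.^ d))) (cong (λ t → fromℕ (p ℕ.^ d) - t) eq)
        0≤1-ρ : 0ℚ ≤ 1ℚ - ρ
        0≤1-ρ = *-cancelʳ-≤-pos (fromℕ (p ℕ.^ d)) {{pos-^ d}} (subst₂ _≤_ (sym (*-zeroˡ (fromℕ (p ℕ.^ d)))) (sym scaled)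
          (subst (_≤ fromℕ (p ℕ.^ d) - fromℕ G) (+-inverseʳ (fromℕ G)) (+-monoˡ-≤ (- fromℕ G) (fromℕ-≤ (goodCount≤ d n p)))))
        main : (1ℚ - ρ) * fromℕ (p ℕ.* p) ≤ fromℕ C
        main = *-cancelʳ-≤-pos (fromℕ (p ℕ.^ i)) {{pos-^ i}} (begin
          (1ℚ - ρ) * fromℕ (p ℕ.* p) * fromℕ (p ℕ.^ i)    ≡⟨ *-assoc (1ℚ - ρ) _ _ ⟩
          (1ℚ - ρ) * (fromℕ (p ℕ.* p) * fromℕ (p ℕ.^ i))  ≡⟨ cong ((1ℚ - ρ) *_) (trans (sym (fromℕ-* (p ℕ.* p) (p ℕ.^ i))) (cong fromℕ (ℕₚ.*-assoc p p (p ℕ.^ i)))) ⟩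
          (1ℚ - ρ) * fromℕ (p ℕ.^ d)                      ≡⟨ scaled ⟩
          fromℕ (p ℕ.^ d) - fromℕ G                       ≤⟨ p≤r+q⇒p-q≤r {fromℕ (p ℕ.^ d)} {fromℕ G} {fromℕ (C ℕ.* p ℕ.^ i)} (subst (fromℕ (p ℕ.^ d) ≤_)
                                                               (trans (fromℕ-+ G (C ℕ.* p ℕ.^ i)) (+-comm (fromℕ G) (fromℕ (C ℕ.* p ℕ.^ i)))) (fromℕ-≤ (good#-large r n i 0))) ⟩
          fromℕ (C ℕ.* p ℕ.^ i)                           ≡⟨ fromℕ-* C (p ℕ.^ i) ⟩
          fromℕ C * fromℕ (p ℕ.^ i)                       ∎)

    density-step : ∀ j → ∣ density (suc j) - density j ∣ * fromℕ (suc j ℕ.* suc (suc j)) ≤ fromℕ (16 ℕ.* d !)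
    density-step j = go j (prime? (suc j))
      where
      open ≤-Reasoning
      go : ∀ j → Dec (Prime (suc j)) → ∣ density (suc j) - density j ∣ * fromℕ (suc j ℕ.* suc (suc j)) ≤ fromℕ (16 ℕ.* d !)
      go j (no ¬pr) = begin
        ∣ density (suc j) - R ∣ * X  ≡⟨ cong (λ t → ∣ t - R ∣ * X) (density-no j ¬pr) ⟩
        ∣ R - R ∣ * X                ≡⟨ cong {A = ℚ} {B = ℚ} (λ t → ∣ t ∣ * X) {R - R} {0ℚ} (+-inverseʳ R) ⟩
        0ℚ * X                       ≡⟨ *-zeroˡ X ⟩
        0ℚ                           ≤⟨ fromℕ≥0 _ ⟩
        fromℕ (16 ℕ.* d !)           ∎
        where
        R = density j
        X = fromℕ (suc j ℕ.* suc (suc j))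
      go zero    (yes pr) = ⊥-elim (¬prime[1] pr)
      go (suc r) (yes pr) = let (ρ , step , ρ-count) = localDensity (suc r) pr
                                (0≤1-ρ , bound) = 1-ρ-bound r ρ ρ-count in begin
        ∣ density (2 ℕ.+ r) - R ∣ * X   ≡⟨ cong (λ t → ∣ t - R ∣ * X) step ⟩
        ∣ R * ρ - R ∣ * X               ≡⟨ cong (λ t → ∣ t ∣ * X) (solve 2 (λ a b → a :* b :- a := :- (a :* (con 1ℚ :- b))) refl R ρ) ⟩
        ∣ - (R * (1ℚ - ρ)) ∣ * X        ≡⟨ cong (_* X) (trans (∣-p∣≡∣p∣ (R * (1ℚ - ρ))) (0≤p⇒∣p∣≡p (0≤* {R} {1ℚ - ρ} (density≥0 (suc r)) 0≤1-ρ))) ⟩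
        R * (1ℚ - ρ) * X                ≤⟨ *-monoʳ (fromℕ≥0 _) (*-monoʳ 0≤1-ρ (density≤1 (suc r))) ⟩
        1ℚ * (1ℚ - ρ) * X               ≡⟨ cong (_* X) (*-identityˡ (1ℚ - ρ)) ⟩
        (1ℚ - ρ) * X                    ≤⟨ bound ⟩
        fromℕ (16 ℕ.* d !)              ∎
        where
        R = density (suc r)
        X = fromℕ ((2 ℕ.+ r) ℕ.* (3 ℕ.+ r))

-- Size of n and the deviation for k ≥ 3.

module Deviation where

  open import Data.Nat as ℕ using (ℕ; zero; suc; NonZero; _!; s≤s)
  import Data.Nat.Properties as ℕₚ
  open import Data.Rational
    using (ℚ; 0ℚ; 1ℚ; ½; _+_; _-_; -_; _*_; 1/_; ∣_∣; _≤_; _<_; Positive)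
  open import Data.Rational.Properties
  open import Data.Rational.Solver using (module +-*-Solver)
  open import Data.Product using (_,_)
  open import Relation.Binary.PropositionalEquality hiding (J)
  open import Defs
  open LatticeSums
  open PrimeProducts
  open Sieve
  open LocalCounts
  open LocalDensities
  open +-*-Solver
  open ≤-Reasoning

  2^≤e^ : ∀ m j → 2 ℕ.≤ j → fromℕ (2 ℕ.^ m) ≤ seq (e ^ℝ m) j
  2^≤e^ zero    j 2≤j = ≤-refl
  2^≤e^ (suc m) j 2≤j = begin
    fromℕ (2 ℕ.* 2 ℕ.^ m)         ≡⟨ fromℕ-* 2 (2 ℕ.^ m) ⟩
    fromℕ 2 * fromℕ (2 ℕ.^ m)     ≤⟨ *-monoˡ (fromℕ≥0 2) (2^≤e^ m j 2≤j) ⟩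
    fromℕ 2 * seq (e ^ℝ m) j      ≤⟨ *-monoʳ (≤-trans (fromℕ≥0 (2 ℕ.^ m)) (2^≤e^ m j 2≤j)) (2≤e j 2≤j) ⟩
    seq e j * seq (e ^ℝ m) j      ∎

  -- Distinct integers differ by at least 1, so the instance ε = ½ of the real inequality already
  -- decides.
  e^≤⇒2^≤ : ∀ m n → e ^ℝ m ≤ℝ fromℚ (fromℕ n) → 2 ℕ.^ m ℕ.≤ n
  e^≤⇒2^≤ m n h = ℕₚ.≮⇒≥ λ n<2^m →
    let (N , hN) = h ½ (positive⁻¹ ½) in
    <-irrefl refl (<-≤-trans (½<1 (fromℕ n)) (begin
      1ℚ + fromℕ n              ≡⟨ sym (fromℕ-suc n) ⟩
      fromℕ (suc n)             ≤⟨ fromℕ-≤ n<2^m ⟩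
      fromℕ (2 ℕ.^ m)           ≤⟨ 2^≤e^ m (2 ℕ.+ N) (ℕₚ.m≤m+n 2 N) ⟩
      seq (e ^ℝ m) (2 ℕ.+ N)    ≤⟨ hN (2 ℕ.+ N) (ℕₚ.m≤n+m N 2) ⟩
      fromℕ n + ½               ∎))
    where
    ½<1 : ∀ q → q + ½ < 1ℚ + q
    ½<1 q = subst (q + ½ <_) (+-comm q 1ℚ) (+-monoʳ-< q (+-monoʳ-< ½ (positive⁻¹ ½)))

  -- An upper bound for the partial sums of the logarithm.

  module LogBound (n : ℕ) .{{_ : NonZero n}} where

    open Log n

    private
      x≤1 : x ≤ 1ℚ
      x≤1 = subst (x ≤_) (+-identityʳ 1ℚ) (+-monoʳ-≤ 1ℚ (neg-antimono-≤ (1/fromℕ-nonNeg n)))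

      x^≥0 : ∀ a → 0ℚ ≤ x ^ a
      x^≥0 a = 0≤^ {x} a x≥0

      x^suc≤x^ : ∀ a → x ^ suc a ≤ x ^ a
      x^suc≤x^ a = subst (x * x ^ a ≤_) (*-identityˡ (x ^ a)) (*-monoʳ {x ^ a} {x} {1ℚ} (x^≥0 a) x≤1)

      x^≤1 : ∀ a → x ^ a ≤ 1ℚ
      x^≤1 zero    = ≤-refl
      x^≤1 (suc a) = ≤-trans (x^suc≤x^ a) (x^≤1 a)

      term-≤ : ∀ a .{{_ : NonZero a}} i → a ℕ.≤ suc i → term i ≤ x ^ suc i * 1/ fromℕ a
      term-≤ a i a≤ = *-cancelʳ-≤-pos (fromℕ (suc i)) (begin
        term i * fromℕ (suc i)                        ≡⟨ ÷-* (x ^ suc i) (fromℕ (suc i)) ⟩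
        x ^ suc i                                     ≡⟨ sym (÷-* (x ^ suc i) (fromℕ a)) ⟩
        x ^ suc i * 1/ fromℕ a * fromℕ a              ≤⟨ *-monoˡ (0≤* {x ^ suc i} {1/ fromℕ a} (x^≥0 (suc i)) (1/fromℕ-nonNeg a)) (fromℕ-≤ a≤) ⟩
        x ^ suc i * 1/ fromℕ a * fromℕ (suc i)        ∎)

      term-≤-1/ : ∀ a .{{_ : NonZero a}} i → a ℕ.≤ suc i → term i ≤ 1/ fromℕ a
      term-≤-1/ a i a≤ = ≤-trans (term-≤ a i a≤)
        (subst (x ^ suc i * 1/ fromℕ a ≤_) (*-identityˡ (1/ fromℕ a)) (*-monoʳ (1/fromℕ-nonNeg a) (x^≤1 (suc i))))

      block : ∀ a .{{_ : NonZero a}} L → Σ< (a ℕ.+ L) term ≤ Σ< a term + fromℕ L * 1/ fromℕ a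
      block a zero    rewrite ℕₚ.+-identityʳ a =
        ≤-reflexive (sym (trans (cong (Σ< a term +_) (*-zeroˡ (1/ fromℕ a))) (+-identityʳ (Σ< a term))))
      block a (suc L) rewrite ℕₚ.+-suc a L = begin
        Σ< (a ℕ.+ L) term + term (a ℕ.+ L)            ≤⟨ +-mono-≤ (block a L) (term-≤-1/ a (a ℕ.+ L) (ℕₚ.m≤n⇒m≤1+n (ℕₚ.m≤m+n a L))) ⟩
        Σ< a term + fromℕ L * w + w                   ≡⟨ solve 3 (λ s l w → s :+ l :* w :+ w := s :+ (con 1ℚ :+ l) :* w) refl (Σ< a term) (fromℕ L) w ⟩
        Σ< a term + (1ℚ + fromℕ L) * w                ≡⟨ cong (λ t → Σ< a term + t * w) (sym (fromℕ-suc L)) ⟩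
        Σ< a term + fromℕ (suc L) * w                 ∎
        where w = 1/ fromℕ a

      -- The term of index i is at most 1/(i+1), so the block of 2^j terms starting at index 2^j
      -- adds at most 1.
      dyadic : ∀ j → Σ< (2 ℕ.^ j) term ≤ fromℕ (suc j)
      dyadic zero    = subst (_≤ fromℕ 1) (sym (+-identityˡ (term 0))) (term-≤-1/ 1 0 ℕₚ.≤-refl)
      dyadic (suc j) = begin
        Σ< (2 ℕ.* a) term                   ≡⟨ cong (λ t → Σ< (a ℕ.+ t) term) (ℕₚ.+-identityʳ a) ⟩
        Σ< (a ℕ.+ a) term                   ≤⟨ block a a ⟩
        Σ< a term + fromℕ a * 1/ fromℕ a    ≤⟨ +-mono-≤ (dyadic j) (≤-reflexive (*-inverseʳ (fromℕ a))) ⟩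
        fromℕ (suc j) + 1ℚ                  ≡⟨ trans (+-comm (fromℕ (suc j)) 1ℚ) (sym (fromℕ-suc (suc j))) ⟩
        fromℕ (2 ℕ.+ j)                     ∎
        where
        a = 2 ℕ.^ j
        instance
          a≢0 : NonZero a
          a≢0 = ℕₚ.m^n≢0 2 j

      -- The product of n, x^a and 1/(K+1), with a = K + L, is the remaining budget of a geometric
      -- series: as n(1 - x) = 1, it drops by x^a/(K+1) at index a, which is at least the term
      -- there.
      tail : ∀ K L → Σ< (K ℕ.+ L) term + fromℕ n * (x ^ (K ℕ.+ L) * 1/ fromℕ (suc K)) ≤ Σ< K term + fromℕ n * 1/ fromℕ (suc K)
      tail K zero    = subst (λ t → Σ< t term + fromℕ n * (x ^ t * w) ≤ Σ< K term + fromℕ n * w) (sym (ℕₚ.+-identityʳ K))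
        (+-monoʳ-≤ (Σ< K term) (*-monoˡ (fromℕ≥0 n)
          (subst (x ^ K * w ≤_) (*-identityˡ w) (*-monoʳ (1/fromℕ-nonNeg (suc K)) (x^≤1 K)))))
        where w = 1/ fromℕ (suc K)
      tail K (suc L) = subst (λ t → Σ< t term + fromℕ n * (x ^ t * w) ≤ Σ< K term + fromℕ n * w) (sym (ℕₚ.+-suc K L)) (begin
        S + term a + N * (x * y * w)
          ≡⟨ cong (λ t → S + term a + t) (trans
               (solve 4 (λ n i y w → n :* ((con 1ℚ :- i) :* y :* w) := n :* (y :* w) :- (n :* i) :* (y :* w)) refl N (1/ N) y w)
               (cong (λ t → N * (y * w) - t * (y * w)) (*-inverseʳ N))) ⟩
        S + term a + (N * (y * w) - 1ℚ * (y * w))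
          ≤⟨ +-monoˡ-≤ (N * (y * w) - 1ℚ * (y * w)) (+-monoʳ-≤ S (≤-trans (term-≤ (suc K) a (s≤s (ℕₚ.m≤m+n K L)))
               (*-monoʳ (1/fromℕ-nonNeg (suc K)) (x^suc≤x^ a)))) ⟩
        S + y * w + (N * (y * w) - 1ℚ * (y * w))
          ≡⟨ solve 3 (λ s v u → s :+ v :+ (u :- con 1ℚ :* v) := s :+ u) refl S (y * w) (N * (y * w)) ⟩
        S + N * (y * w)
          ≤⟨ tail K L ⟩
        Σ< K term + N * w ∎)
        where
        a = K ℕ.+ L
        S = Σ< a term
        N = fromℕ n
        y = x ^ a
        w = 1/ fromℕ (suc K)

    -- The terms below index 2ᵐ⁺¹ ≥ n are grouped in dyadic blocks, the others are dominated by a geometric series.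
    log-≤ : ∀ m → n ℕ.≤ 2 ℕ.^ suc m → ∀ I → Σ< I term ≤ fromℕ (3 ℕ.+ m)
    log-≤ m n≤K I = begin
      Σ< I term                              ≤⟨ Σ<-mono term term≥0 (ℕₚ.m≤n+m I K) ⟩
      Σ< (K ℕ.+ I) term                      ≡⟨ sym (+-identityʳ (Σ< (K ℕ.+ I) term)) ⟩
      Σ< (K ℕ.+ I) term + 0ℚ                 ≤⟨ +-monoʳ-≤ (Σ< (K ℕ.+ I) term) (0≤* {fromℕ n} {x ^ (K ℕ.+ I) * w} (fromℕ≥0 n)
                                                  (0≤* {x ^ (K ℕ.+ I)} {w} (x^≥0 (K ℕ.+ I)) (1/fromℕ-nonNeg (suc K)))) ⟩
      Σ< (K ℕ.+ I) term + fromℕ n * (x ^ (K ℕ.+ I) * w) ≤⟨ tail K I ⟩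
      Σ< K term + fromℕ n * w                ≤⟨ +-mono-≤ (dyadic (suc m)) (≤-trans
                                                  (*-monoʳ (1/fromℕ-nonNeg (suc K)) (fromℕ-≤ (ℕₚ.m≤n⇒m≤1+n n≤K)))
                                                  (≤-reflexive (*-inverseʳ (fromℕ (suc K))))) ⟩
      fromℕ (2 ℕ.+ m) + 1ℚ                   ≡⟨ trans (+-comm (fromℕ (2 ℕ.+ m)) 1ℚ) (sym (fromℕ-suc (2 ℕ.+ m))) ⟩
      fromℕ (3 ℕ.+ m)                        ∎
      where
      K = 2 ℕ.^ suc m
      w = 1/ fromℕ (suc K)

  -- A triangle inequality: A is the sifted count, b the true one, r and r′ the densities at z and
  -- w, X the volume n^d/d!, Y = n^d and F = d!. Sieve tail, boundary terms and density tail add up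
  -- to 16 + 1 + 16; the factor F in the density tail cancels against the volume.
  combine : ∀ (A b r r′ X Y F Z : ℚ) → 0ℚ ≤ Z → 0ℚ ≤ X → 1ℚ ≤ F → X * F ≡ Y →
    F * (Z * A) ≤ r * (Z * Y) + Y → r * (Z * Y) ≤ F * (Z * A) + Y →
    Z * ∣ A - b ∣ ≤ fromℕ 16 * Y → ∣ r′ - r ∣ * Z ≤ fromℕ 16 * F →
    Z * ∣ b - r′ * X ∣ ≤ fromℕ 33 * Y
  combine A b r r′ X Y F Z Z≥0 X≥0 1≤F XF≡Y upper lower sieve tail = begin
    Z * ∣ b - r′ * X ∣
      ≡⟨ cong (λ t → Z * ∣ t ∣) (solve 5 (λ a b r s x → b :- s :* x := (:- (a :- b) :+ (a :- r :* x)) :+ (:- ((s :- r) :* x))) refl A b r r′ X) ⟩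
    Z * ∣ (- (A - b) + (A - r * X)) + - ((r′ - r) * X) ∣
      ≤⟨ *-monoˡ Z≥0 (≤-trans (∣p+q∣≤∣p∣+∣q∣ (- (A - b) + (A - r * X)) (- ((r′ - r) * X)))
           (+-monoˡ-≤ ∣ - ((r′ - r) * X) ∣ (∣p+q∣≤∣p∣+∣q∣ (- (A - b)) (A - r * X)))) ⟩
    Z * (∣ - (A - b) ∣ + ∣ A - r * X ∣ + ∣ - ((r′ - r) * X) ∣)
      ≡⟨ cong₂ (λ s t → Z * (s + ∣ A - r * X ∣ + t)) (∣-p∣≡∣p∣ (A - b))
           (trans (∣-p∣≡∣p∣ ((r′ - r) * X)) (trans (∣p*q∣≡∣p∣*∣q∣ (r′ - r) X) (cong (∣ r′ - r ∣ *_) (0≤p⇒∣p∣≡p X≥0)))) ⟩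
    Z * (∣ A - b ∣ + ∣ A - r * X ∣ + ∣ r′ - r ∣ * X)
      ≡⟨ solve 5 (λ z u v w x → z :* (u :+ v :+ w :* x) := z :* u :+ z :* v :+ (w :* z) :* x) refl Z (∣ A - b ∣) (∣ A - r * X ∣) (∣ r′ - r ∣) X ⟩
    Z * ∣ A - b ∣ + Z * ∣ A - r * X ∣ + ∣ r′ - r ∣ * Z * X
      ≤⟨ +-mono-≤ (+-mono-≤ sieve middle) (*-monoʳ X≥0 tail) ⟩
    fromℕ 16 * Y + Y + fromℕ 16 * F * X
      ≡⟨ cong (fromℕ 16 * Y + Y +_) (trans (*-assoc (fromℕ 16) F X) (cong (fromℕ 16 *_) (trans (*-comm F X) XF≡Y))) ⟩
    fromℕ 16 * Y + Y + fromℕ 16 * Y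
      ≡⟨ solve 1 (λ y → con (fromℕ 16) :* y :+ y :+ con (fromℕ 16) :* y := con (fromℕ 33) :* y) refl Y ⟩
    fromℕ 33 * Y ∎
    where
    E = Z * ∣ A - r * X ∣
    E≥0 : 0ℚ ≤ E
    E≥0 = 0≤* {Z} {∣ A - r * X ∣} Z≥0 (0≤∣p∣ (A - r * X))
    F≥0 : 0ℚ ≤ F
    F≥0 = ≤-trans (nonNegative⁻¹ 1ℚ) 1≤F
    FE≡ : F * E ≡ ∣ F * (Z * A) - r * (Z * Y) ∣
    FE≡ = trans (cong₂ (λ s t → s * (t * ∣ A - r * X ∣)) (sym (0≤p⇒∣p∣≡p F≥0)) (sym (0≤p⇒∣p∣≡p Z≥0)))
      (trans (cong (∣ F ∣ *_) (sym (∣p*q∣≡∣p∣*∣q∣ Z (A - r * X))))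
      (trans (sym (∣p*q∣≡∣p∣*∣q∣ F (Z * (A - r * X)))) (cong ∣_∣
        (trans (solve 5 (λ f z a r x → f :* (z :* (a :- r :* x)) := f :* (z :* a) :- r :* (z :* (x :* f))) refl F Z A r X)
               (cong (λ t → F * (Z * A) - r * (Z * t)) XF≡Y)))))
    -- `upper` and `lower` bound F times this error, and F ≥ 1 lets the factor be dropped.
    middle : E ≤ Y
    middle = begin
      E                                   ≡⟨ sym (*-identityˡ E) ⟩
      1ℚ * E                              ≤⟨ *-monoʳ E≥0 1≤F ⟩
      F * E                               ≡⟨ FE≡ ⟩
      ∣ F * (Z * A) - r * (Z * Y) ∣       ≤⟨ p≤r∧-p≤r⇒∣p∣≤r
           (p≤r+q⇒p-q≤r {F * (Z * A)} {r * (Z * Y)} {Y} (subst (F * (Z * A) ≤_) (+-comm (r * (Z * Y)) Y) upper))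
           (subst (_≤ Y) (solve 2 (λ u v → v :- u := :- (u :- v)) refl (F * (Z * A)) (r * (Z * Y)))
             (p≤r+q⇒p-q≤r {r * (Z * Y)} {F * (Z * A)} {Y} (subst (r * (Z * Y) ≤_) (+-comm (F * (Z * A)) Y) lower))) ⟩
      Y                                   ∎

  -- Telescoping gives C(1/(z+1) - 1/(w+1)); dropping the second reciprocal makes the bound uniform
  -- in w, as the limit defining D_k requires.
  increment-≤ : ∀ (a : ℕ → ℚ) C (step : ∀ j → ∣ a (suc j) - a j ∣ * fromℕ (suc j ℕ.* suc (suc j)) ≤ fromℕ C) z w →
                z ℕ.≤ w → ∣ a w - a z ∣ * fromℕ (suc z) ≤ fromℕ C
  increment-≤ a C step z w z≤w = subst (λ t → ∣ a t - a z ∣ * fromℕ (suc z) ≤ fromℕ C) (ℕₚ.m∸n+n≡m z≤w) (begin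
    ∣ a t - a z ∣ * Z                        ≤⟨ *-monoʳ (fromℕ≥0 (suc z)) (Steps.telescope a C step z (w ℕ.∸ z)) ⟩
    fromℕ C * (1/ Z - 1/ fromℕ (suc t)) * Z  ≤⟨ *-monoʳ (fromℕ≥0 (suc z)) (*-monoˡ (fromℕ≥0 C)
                                                  (subst (1/ Z - 1/ fromℕ (suc t) ≤_) (+-identityʳ (1/ Z)) (+-monoʳ-≤ (1/ Z) (neg-antimono-≤ (1/fromℕ-nonNeg (suc t)))))) ⟩
    fromℕ C * 1/ Z * Z                       ≡⟨ ÷-* (fromℕ C) Z ⟩
    fromℕ C                                  ∎)
    where
    t = w ℕ.∸ z ℕ.+ z
    Z = fromℕ (suc z)

  module _ (i N z : ℕ) where

    open Density (suc i) (suc N)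

    private
      n d : ℕ
      n = suc N
      d = 2 ℕ.+ i
      M = primorial z
      A = simplex d N (sifted n z)
      Z = suc z
      -- The lattice estimate asks for slack dM around N = n - 1; one more period, which is at least
      -- 1, pays for passing from N to n.
      a = suc d ℕ.* M
      Y = n ℕ.^ d

      1≤M : 1 ℕ.≤ M
      1≤M = primorial>0 z

      M^d-pos : Positive (fromℕ (M ℕ.^ d))
      M^d-pos = fromℕ-pos (M ℕ.^ d) {{ℕₚ.m^n≢0 M d {{ℕ.>-nonZero 1≤M}}}}

      rearrange : ∀ c → density z * fromℕ c * fromℕ (M ℕ.^ d) ≡ fromℕ (∏ₚ (goodCount d n) z ℕ.* c)
      rearrange c = trans (solve 3 (λ r c m → r :* c :* m := r :* m :* c) refl (density z) (fromℕ c) (fromℕ (M ℕ.^ d)))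
        (trans (cong (_* fromℕ c) (density-count z)) (sym (fromℕ-* (∏ₚ (goodCount d n) z) c)))

      rearrange′ : fromℕ (d ! ℕ.* A) * fromℕ (M ℕ.^ d) ≡ fromℕ (d ! ℕ.* M ℕ.^ d ℕ.* A)
      rearrange′ = trans (sym (fromℕ-* (d ! ℕ.* A) (M ℕ.^ d))) (cong fromℕ
        (trans (ℕₚ.*-assoc (d !) A (M ℕ.^ d)) (trans (cong (d ! ℕ.*_) (ℕₚ.*-comm A (M ℕ.^ d))) (sym (ℕₚ.*-assoc (d !) (M ℕ.^ d) A)))))

      A-≤ : fromℕ (d ! ℕ.* A) ≤ density z * fromℕ ((n ℕ.+ a) ℕ.^ d)
      A-≤ = *-cancelʳ-≤-pos (fromℕ (M ℕ.^ d)) {{M^d-pos}} (begin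
        fromℕ (d ! ℕ.* A) * fromℕ (M ℕ.^ d)                 ≡⟨ rearrange′ ⟩
        fromℕ (d ! ℕ.* M ℕ.^ d ℕ.* A)                       ≤⟨ fromℕ-≤ (ℕₚ.≤-trans (sifted-simplex-≤ d N z)
            (ℕₚ.*-monoʳ-≤ (∏ₚ (goodCount d n) z) (ℕₚ.^-monoˡ-≤ d (ℕₚ.+-mono-≤ (ℕₚ.n≤1+n N) (ℕₚ.m≤n+m (d ℕ.* M) M))))) ⟩
        fromℕ (∏ₚ (goodCount d n) z ℕ.* (n ℕ.+ a) ℕ.^ d)    ≡⟨ sym (rearrange ((n ℕ.+ a) ℕ.^ d)) ⟩
        density z * fromℕ ((n ℕ.+ a) ℕ.^ d) * fromℕ (M ℕ.^ d) ∎)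

      A-≥ : density z * fromℕ ((n ℕ.∸ a) ℕ.^ d) ≤ fromℕ (d ! ℕ.* A)
      A-≥ = *-cancelʳ-≤-pos (fromℕ (M ℕ.^ d)) {{M^d-pos}} (begin
        density z * fromℕ ((n ℕ.∸ a) ℕ.^ d) * fromℕ (M ℕ.^ d) ≡⟨ rearrange ((n ℕ.∸ a) ℕ.^ d) ⟩
        fromℕ (∏ₚ (goodCount d n) z ℕ.* (n ℕ.∸ a) ℕ.^ d)    ≤⟨ fromℕ-≤ (ℕₚ.≤-trans
            (ℕₚ.*-monoʳ-≤ (∏ₚ (goodCount d n) z) (ℕₚ.^-monoˡ-≤ d n∸a≤)) (sifted-simplex-≥ d N z)) ⟩
        fromℕ (d ! ℕ.* M ℕ.^ d ℕ.* A)                       ≡⟨ sym rearrange′ ⟩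
        fromℕ (d ! ℕ.* A) * fromℕ (M ℕ.^ d)                 ∎)
        where
        n∸a≤ : n ℕ.∸ a ℕ.≤ N ℕ.∸ d ℕ.* M
        n∸a≤ = ℕₚ.∸-monoʳ-≤ n (ℕₚ.+-monoˡ-≤ (d ℕ.* M) 1≤M)

      scale : ∀ c → fromℕ (d !) * (fromℕ Z * fromℕ c) ≡ fromℕ Z * fromℕ (d ! ℕ.* c)
      scale c = trans (solve 3 (λ f z c → f :* (z :* c) := z :* (f :* c)) refl (fromℕ (d !)) (fromℕ Z) (fromℕ c))
        (cong (fromℕ Z *_) (sym (fromℕ-* (d !) c)))

    module _ (small : 2 ℕ.* Z ℕ.* d ℕ.* a ℕ.≤ n) where

      sifted-upper : fromℕ (d !) * (fromℕ Z * fromℕ A) ≤ density z * (fromℕ Z * fromℕ Y) + fromℕ Y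
      sifted-upper = begin
        fromℕ (d !) * (fromℕ Z * fromℕ A)                   ≡⟨ scale A ⟩
        fromℕ Z * fromℕ (d ! ℕ.* A)                         ≤⟨ *-monoˡ (fromℕ≥0 Z) A-≤ ⟩
        fromℕ Z * (density z * fromℕ ((n ℕ.+ a) ℕ.^ d))     ≡⟨ solve 3 (λ z r c → z :* (r :* c) := r :* (z :* c)) refl (fromℕ Z) (density z) (fromℕ ((n ℕ.+ a) ℕ.^ d)) ⟩
        density z * (fromℕ Z * fromℕ ((n ℕ.+ a) ℕ.^ d))     ≡⟨ cong (density z *_) (sym (fromℕ-* Z ((n ℕ.+ a) ℕ.^ d))) ⟩
        density z * fromℕ (Z ℕ.* (n ℕ.+ a) ℕ.^ d)           ≤⟨ *-monoˡ (density≥0 z) (fromℕ-≤ (power-upper Z d n a small)) ⟩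
        density z * fromℕ (Y ℕ.+ Z ℕ.* Y)                   ≡⟨ cong (density z *_) (trans (fromℕ-+ Y (Z ℕ.* Y)) (cong (fromℕ Y +_) (fromℕ-* Z Y))) ⟩
        density z * (fromℕ Y + fromℕ Z * fromℕ Y)           ≡⟨ solve 3 (λ r y u → r :* (y :+ u) := r :* u :+ r :* y) refl (density z) (fromℕ Y) (fromℕ Z * fromℕ Y) ⟩
        density z * (fromℕ Z * fromℕ Y) + density z * fromℕ Y ≤⟨ +-monoʳ-≤ (density z * (fromℕ Z * fromℕ Y)) (*-monoʳ (fromℕ≥0 Y) (density≤1 z)) ⟩
        density z * (fromℕ Z * fromℕ Y) + 1ℚ * fromℕ Y      ≡⟨ cong (density z * (fromℕ Z * fromℕ Y) +_) (*-identityˡ (fromℕ Y)) ⟩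
        density z * (fromℕ Z * fromℕ Y) + fromℕ Y           ∎

      sifted-lower : density z * (fromℕ Z * fromℕ Y) ≤ fromℕ (d !) * (fromℕ Z * fromℕ A) + fromℕ Y
      sifted-lower = begin
        density z * (fromℕ Z * fromℕ Y)                     ≡⟨ cong (density z *_) (sym (fromℕ-* Z Y)) ⟩
        density z * fromℕ (Z ℕ.* Y)                         ≤⟨ *-monoˡ (density≥0 z) (fromℕ-≤ (power-lower Z d n a small)) ⟩
        density z * fromℕ (Z ℕ.* W ℕ.+ Y)                   ≡⟨ cong (density z *_) (trans (fromℕ-+ (Z ℕ.* W) Y) (cong (_+ fromℕ Y) (fromℕ-* Z W))) ⟩
        density z * (fromℕ Z * fromℕ W + fromℕ Y)           ≡⟨ solve 4 (λ r z w y → r :* (z :* w :+ y) := z :* (r :* w) :+ r :* y) refl (density z) (fromℕ Z) (fromℕ W) (fromℕ Y) ⟩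
        fromℕ Z * (density z * fromℕ W) + density z * fromℕ Y ≤⟨ +-mono-≤ (*-monoˡ (fromℕ≥0 Z) A-≥) (*-monoʳ (fromℕ≥0 Y) (density≤1 z)) ⟩
        fromℕ Z * fromℕ (d ! ℕ.* A) + 1ℚ * fromℕ Y          ≡⟨ cong₂ _+_ (sym (scale A)) (*-identityˡ (fromℕ Y)) ⟩
        fromℕ (d !) * (fromℕ Z * fromℕ A) + fromℕ Y         ∎
        where W = (n ℕ.∸ a) ℕ.^ d

    -- The lost tuples are bounded by a block of the series of `exact-pairs-step`, running from z to
    -- z + n, where the sieve is complete because z + n ≥ n.
    sieve-tail : fromℕ Z * ∣ fromℕ A - fromℕ (B (suc d) n) ∣ ≤ fromℕ 16 * fromℕ Y
    sieve-tail = begin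
      fromℕ Z * ∣ fromℕ A - fromℕ b ∣                ≡⟨ *-comm (fromℕ Z) ∣ fromℕ A - fromℕ b ∣ ⟩
      ∣ fromℕ A - fromℕ b ∣ * fromℕ Z                ≡⟨ cong (_* fromℕ Z) (0≤p⇒∣p∣≡p 0≤A-b) ⟩
      (fromℕ A - fromℕ b) * fromℕ Z                  ≤⟨ *-monoʳ (fromℕ≥0 Z) (≤-trans
          (p≤r+q⇒p-q≤r {fromℕ A} {fromℕ b} {S (z ℕ.+ n) - S z} A≤) (p≤∣p∣ (S (z ℕ.+ n) - S z))) ⟩
      ∣ S (z ℕ.+ n) - S z ∣ * fromℕ Z                ≤⟨ increment-≤ S (16 ℕ.* N ℕ.^ d) step z (z ℕ.+ n) (ℕₚ.m≤m+n z n) ⟩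
      fromℕ (16 ℕ.* N ℕ.^ d)                         ≤⟨ fromℕ-≤ (ℕₚ.*-monoʳ-≤ 16 (ℕₚ.^-monoˡ-≤ d (ℕₚ.n≤1+n N))) ⟩
      fromℕ (16 ℕ.* Y)                               ≡⟨ fromℕ-* 16 Y ⟩
      fromℕ 16 * fromℕ Y                             ∎
      where
      b = B (suc d) n
      E : ℕ → ℕ
      E j = exact d N (pairs (suc j))
      S : ℕ → ℚ
      S j = fromℕ (∑ j E)
      S-suc : ∀ j → S (suc j) - S j ≡ fromℕ (E j)
      S-suc j = trans (cong (_- S j) (fromℕ-+ (∑ j E) (E j))) (solve 2 (λ s t → s :+ t :- s := t) refl (S j) (fromℕ (E j)))
      step : ∀ j → ∣ S (suc j) - S j ∣ * fromℕ (suc j ℕ.* suc (suc j)) ≤ fromℕ (16 ℕ.* N ℕ.^ d)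
      step j = begin
        ∣ S (suc j) - S j ∣ * fromℕ (suc j ℕ.* suc (suc j))  ≡⟨ cong {A = ℚ} {B = ℚ} (λ t → ∣ t ∣ * J) {S (suc j) - S j} {fromℕ (E j)} (S-suc j) ⟩
        ∣ fromℕ (E j) ∣ * fromℕ (suc j ℕ.* suc (suc j))      ≡⟨ cong {A = ℚ} {B = ℚ} (_* J) {∣ fromℕ (E j) ∣} {fromℕ (E j)} (0≤p⇒∣p∣≡p (fromℕ≥0 (E j))) ⟩
        fromℕ (E j) * fromℕ (suc j ℕ.* suc (suc j))          ≡⟨ sym (fromℕ-* (E j) (suc j ℕ.* suc (suc j))) ⟩
        fromℕ (E j ℕ.* (suc j ℕ.* suc (suc j)))              ≤⟨ fromℕ-≤ (exact-pairs-step i N j) ⟩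
        fromℕ (16 ℕ.* N ℕ.^ d)                               ∎
        where J = fromℕ (suc j ℕ.* suc (suc j))
      0≤A-b : 0ℚ ≤ fromℕ A - fromℕ b
      0≤A-b = subst (_≤ fromℕ A - fromℕ b) (+-inverseʳ (fromℕ b)) (+-monoˡ-≤ (- fromℕ b) (fromℕ-≤ (B-≤-simplex d N z)))
      A≤ : fromℕ A ≤ S (z ℕ.+ n) - S z + fromℕ b
      A≤ = begin
        fromℕ A                                              ≤⟨ fromℕ-≤ (simplex-≤-B d N z n (ℕₚ.m≤n+m n z)) ⟩
        fromℕ (b ℕ.+ T)                                      ≡⟨ fromℕ-+ b T ⟩
        fromℕ b + fromℕ T                                    ≡⟨ solve 3 (λ s t b → b :+ t := (s :+ t) :- s :+ b) refl (S z) (fromℕ T) (fromℕ b) ⟩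
        S z + fromℕ T - S z + fromℕ b                        ≡⟨ cong (λ t → t - S z + fromℕ b) (trans (sym (fromℕ-+ (∑ z E) T)) (cong fromℕ (sym (∑-split z n E)))) ⟩
        S (z ℕ.+ n) - S z + fromℕ b                          ∎
        where T = ∑ n (λ j → E (z ℕ.+ j))

    -- The level w stays free above z because it is the index of the sequence defining D_k.
    deviation : 2 ℕ.* Z ℕ.* d ℕ.* a ℕ.≤ n → ∀ X → 0ℚ ≤ X → X * fromℕ (d !) ≡ fromℕ Y → ∀ w → z ℕ.≤ w →
                fromℕ Z * ∣ fromℕ (B (suc d) n) - density w * X ∣ ≤ fromℕ 33 * fromℕ Y
    deviation small X X≥0 X*d! w z≤w = combine (fromℕ A) (fromℕ (B (suc d) n)) (density z) (density w) X (fromℕ Y) (fromℕ (d !)) (fromℕ Z)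
      (fromℕ≥0 Z) X≥0 (fromℕ-≤ (ℕₚ.1≤n! d)) X*d! (sifted-upper small) (sifted-lower small) sieve-tail
      (≤-trans (increment-≤ density (16 ℕ.* d !) (density-step i n) z w z≤w) (≤-reflexive (fromℕ-* 16 (d !))))

-- Passage to the real numbers and conclusion.

open import Defs
open import Data.Nat using (ℕ; NonZero; NonTrivial; _∸_; _!)
open import Data.Nat.Properties using (_!≢0)
import Data.Nat as ℕ
open import Data.Rational using (_*_; _÷_)

open import Data.Nat using (suc)
import Data.Nat.Properties as ℕₚ
open import Data.Product using (∃; _,_)
open import Data.Rational using (ℚ; 0ℚ; 1ℚ; _+_; _-_; _≤_; _<_; ∣_∣; Positive; positive)
open import Data.Rational.Properties
open import Data.Rational.Solver using (module +-*-Solver)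
open import Relation.Binary.PropositionalEquality hiding (J)
open PrimeProducts
open LocalCounts
open LocalDensities
open Deviation
open +-*-Solver
open ≤-Reasoning

volume : ℕ → ℕ → ℚ
volume d n = (fromℕ n ^ d ÷ fromℕ (d !)) {{d !≢0}}

volume-* : ∀ d n → volume d n * fromℕ (d !) ≡ fromℕ (n ℕ.^ d)
volume-* d n = trans (÷-* (fromℕ n ^ d) (fromℕ (d !)) {{d !≢0}}) (sym (fromℕ-^ n d))

volume≥0 : ∀ d n → 0ℚ ≤ volume d n
volume≥0 d n = 0≤* {fromℕ n ^ d} (0≤^ d (fromℕ≥0 n)) (1/fromℕ-nonNeg (d !) {{d !≢0}})

-- Real inequalities are eventual inequalities between terms of sequences. With the reciprocal
-- cleared, the partial sums of the logarithm stand on the smaller side, where an upper bound for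
-- them can be used.
scaled-bound⇒theorem : (k n : ℕ) .{{_ : NonTrivial k}} .{{_ : NonZero n}} →
  (n≥ : e ^ℝ (k ℕ.* 2 ℕ.^ (k ℕ.+ 2)) ≤ℝ fromℚ (fromℕ n)) → ∀ w₀ →
  (∀ w → w₀ ℕ.≤ w → ∣ fromℕ (B k n) - D-partial k w * g k n * volume (k ∸ 1) n ∣ * seq (log n) w ≤ fromℕ 707 * fromℕ n ^ (k ∸ 1)) →
  ∣ fromℚ (fromℕ (B k n)) -ℝ D k *ℝ fromℚ (g k n) *ℝ fromℚ (volume (k ∸ 1) n) ∣ℝ
    ≤ℝ (fromℚ (fromℕ 707 * fromℕ n ^ (k ∸ 1)) ÷ℝ log n) {{n≥e^m⇒log>0 k n n≥}}
scaled-bound⇒theorem k n n≥ w₀ bound ε ε>0 = go (n≥e^m⇒log>0 k n n≥)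
  where
  U : ℚ
  U = fromℕ 707 * fromℕ n ^ (k ∸ 1)
  E : ℕ → ℚ
  E w = ∣ fromℕ (B k n) - D-partial k w * g k n * volume (k ∸ 1) n ∣
  Λ : ℕ → ℚ
  Λ = seq (log n)
  go : 0ℝ <ℝ log n → ∃ λ w₁ → ∀ w → w₁ ℕ.≤ w → E w ≤ U * recip (Λ w) + ε
  -- The witness that log n is positive keeps its partial sums above c from w₁ on, so there `recip`
  -- is a true inverse.
  go (c , c>0 , w₁ , h) = w₀ ℕ.⊔ w₁ , λ w w≥ →
    let Λ>0 : 0ℚ < Λ w
        Λ>0 = <-≤-trans c>0 (subst (_≤ Λ w) (+-identityˡ c) (h w (ℕₚ.m⊔n≤o⇒n≤o w₀ w₁ w≥)))
    in begin
    E w                      ≤⟨ *-cancelʳ-≤-pos (Λ w) {{positive Λ>0}} (begin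
         E w * Λ w                   ≤⟨ bound w (ℕₚ.m⊔n≤o⇒m≤o w₀ w₁ w≥) ⟩
         U                           ≡⟨ sym (*-identityʳ U) ⟩
         U * 1ℚ                      ≡⟨ cong (U *_) (sym (trans (*-comm (recip (Λ w)) (Λ w)) (recip-inverse (Λ w) Λ>0))) ⟩
         U * (recip (Λ w) * Λ w)     ≡⟨ sym (*-assoc U (recip (Λ w)) (Λ w)) ⟩
         U * recip (Λ w) * Λ w       ∎) ⟩
    U * recip (Λ w)          ≡⟨ sym (+-identityʳ (U * recip (Λ w))) ⟩
    U * recip (Λ w) + 0ℚ     ≤⟨ +-monoʳ-≤ (U * recip (Λ w)) (<⇒≤ ε>0) ⟩
    U * recip (Λ w) + ε      ∎

-- From w = n on, the truncated product gives the count for k = 2 exactly, so the deviation is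
-- eventually zero.
B₂≡density : ∀ N w → 1 ℕ.≤ N → suc N ℕ.≤ w → let open Density 0 (suc N) in fromℕ (B 2 (suc N)) ≡ density w * volume 1 (suc N)
B₂≡density N w 1≤N n≤w = *-cancelʳ-≡-pos P P-pos (begin-equality
  fromℕ (B 2 n) * P                       ≡⟨ sym (fromℕ-* (B 2 n) (primorial w)) ⟩
  fromℕ (B 2 n ℕ.* primorial w)           ≡⟨ cong fromℕ (B₂-exact N w 1≤N n≤w) ⟩
  fromℕ (n ℕ.* ∏ₚ (goodCount 1 n) w)      ≡⟨ fromℕ-* n (∏ₚ (goodCount 1 n) w) ⟩
  fromℕ n * fromℕ (∏ₚ (goodCount 1 n) w)  ≡⟨ cong (fromℕ n *_) (sym (trans (cong (λ t → density w * fromℕ t) (sym (ℕₚ.*-identityʳ (primorial w)))) (density-count w))) ⟩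
  fromℕ n * (density w * P)               ≡⟨ solve 3 (λ n r p → n :* (r :* p) := r :* n :* p) refl (fromℕ n) (density w) P ⟩
  density w * fromℕ n * P                 ≡⟨ cong (λ t → density w * t * P) (sym volume≡) ⟩
  density w * volume 1 n * P              ∎)
  where
  open Density 0 (suc N)
  n = suc N
  P = fromℕ (primorial w)
  P-pos : Positive P
  P-pos = fromℕ-pos (primorial w) {{ℕ.>-nonZero (primorial>0 w)}}
  volume≡ : volume 1 n ≡ fromℕ n
  volume≡ = trans (sym (*-identityʳ (volume 1 n))) (trans (volume-* 1 n) (cong fromℕ (ℕₚ.*-identityʳ n)))

large-k-bound : ∀ i N → (n≥ : 2 ℕ.^ ((3 ℕ.+ i) ℕ.* 2 ℕ.^ ((3 ℕ.+ i) ℕ.+ 2)) ℕ.≤ suc N) → let n = suc N ; d = 2 ℕ.+ i ; open Density (suc i) n in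
  ∃ λ w₀ → ∀ w → w₀ ℕ.≤ w → ∣ fromℕ (B (suc d) n) - density w * volume d n ∣ * seq (log n) w ≤ fromℕ 707 * fromℕ n ^ d
large-k-bound i N n≥ = let (z , m , n<2^ , m<8z , small) = sievingLevel d n n≥ in z , λ w z≤w → let E = ∣ fromℕ (B (suc d) n) - density w * volume d n ∣ in begin
  E * seq (log n) w                   ≤⟨ *-monoˡ (0≤∣p∣ (fromℕ (B (suc d) n) - density w * volume d n)) (LogBound.log-≤ n m (ℕₚ.<⇒≤ n<2^) w) ⟩
  -- The choice m < 8z turns the bound m + 3 for the logarithm into 8(z+1), the scale in which
  -- `deviation` is stated.
  E * fromℕ (3 ℕ.+ m)                 ≤⟨ *-monoˡ (0≤∣p∣ (fromℕ (B (suc d) n) - density w * volume d n)) (fromℕ-≤ (3+m≤ z m m<8z)) ⟩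
  E * fromℕ (8 ℕ.* suc z)             ≡⟨ cong (E *_) (fromℕ-* 8 (suc z)) ⟩
  E * (fromℕ 8 * fromℕ (suc z))       ≡⟨ solve 3 (λ e a z → e :* (a :* z) := a :* (z :* e)) refl E (fromℕ 8) (fromℕ (suc z)) ⟩
  fromℕ 8 * (fromℕ (suc z) * E)       ≤⟨ *-monoˡ (fromℕ≥0 8) (deviation i N z small (volume d n) (volume≥0 d n) (volume-* d n) w z≤w) ⟩
  fromℕ 8 * (fromℕ 33 * fromℕ (n ℕ.^ d)) ≡⟨ sym (*-assoc (fromℕ 8) (fromℕ 33) (fromℕ (n ℕ.^ d))) ⟩
  fromℕ 8 * fromℕ 33 * fromℕ (n ℕ.^ d) ≡⟨ cong (_* fromℕ (n ℕ.^ d)) (sym (fromℕ-* 8 33)) ⟩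
  fromℕ 264 * fromℕ (n ℕ.^ d)         ≤⟨ *-monoʳ (fromℕ≥0 (n ℕ.^ d)) (fromℕ-≤ (ℕₚ.m≤m+n 264 443)) ⟩
  fromℕ 707 * fromℕ (n ℕ.^ d)         ≡⟨ cong (fromℕ 707 *_) (fromℕ-^ n d) ⟩
  fromℕ 707 * fromℕ n ^ d             ∎
  where
  n = suc N
  d = 2 ℕ.+ i
  open Density (suc i) n
  3+m≤ : ∀ z m → m ℕ.< 8 ℕ.* z → 3 ℕ.+ m ℕ.≤ 8 ℕ.* suc z
  3+m≤ z m m<8z = ℕₚ.≤-trans (ℕₚ.+-mono-≤ (ℕₚ.m≤m+n 2 6) m<8z) (ℕₚ.≤-reflexive (sym (ℕₚ.*-suc 8 z)))

theorem4 : (k n : ℕ) .{{_ : NonTrivial k}} .{{_ : NonZero n}} →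
    (n≥ : e ^ℝ (k ℕ.* 2 ℕ.^ (k ℕ.+ 2)) ≤ℝ fromℚ (fromℕ n)) →
    ∣ fromℚ (fromℕ (B k n))
    -ℝ D k *ℝ fromℚ (g k n) *ℝ fromℚ ((fromℕ n ^ (k ∸ 1) ÷ fromℕ ((k ∸ 1) !)) {{(k ∸ 1) !≢0}}) ∣ℝ
    ≤ℝ (fromℚ (fromℕ 707 * fromℕ n ^ (k ∸ 1)) ÷ℝ log n) {{n≥e^m⇒log>0 k n n≥}}
theorem4 2 n@(suc N) n≥ = scaled-bound⇒theorem 2 n n≥ n λ w n≤w → begin
  ∣ b - D-partial 2 w * g 2 n * X ∣ * Λ w  ≡⟨ cong (λ t → ∣ b - t * X ∣ * Λ w) (cong (D-partial 2 w *_) (sym (g-partial-stable w n≤w))) ⟩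
  ∣ b - density w * X ∣ * Λ w              ≡⟨ cong (λ t → ∣ b - t ∣ * Λ w) (sym (B₂≡density N w 1≤N n≤w)) ⟩
  ∣ b - b ∣ * Λ w                          ≡⟨ cong {A = ℚ} {B = ℚ} (λ t → ∣ t ∣ * Λ w) {b - b} {0ℚ} (+-inverseʳ b) ⟩
  0ℚ * Λ w                                 ≡⟨ *-zeroˡ (Λ w) ⟩
  0ℚ                                       ≤⟨ 0≤* {fromℕ 707} {fromℕ n ^ 1} (fromℕ≥0 707) (0≤^ 1 (fromℕ≥0 n)) ⟩
  fromℕ 707 * fromℕ n ^ 1                  ∎
  where
  open Density 0 n
  b = fromℕ (B 2 n)
  X = volume 1 n
  Λ = seq (log n)
  1≤N : 1 ℕ.≤ N
  1≤N = ℕₚ.≤-pred (e^m≤n⇒1<n (2 ℕ.* 2 ℕ.^ (2 ℕ.+ 2)) n n≥)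
theorem4 (suc (suc (suc i))) n@(suc N) n≥ =
  let (w₀ , bound) = large-k-bound i N (e^≤⇒2^≤ (k ℕ.* 2 ℕ.^ (k ℕ.+ 2)) n n≥) in
  -- The index must pass z for the sieve bound and n for the partial product of g_k to have reached
  -- g_k(n).
  scaled-bound⇒theorem k n n≥ (w₀ ℕ.⊔ n) λ w w≥ → subst
    (λ t → ∣ fromℕ (B k n) - D-partial k w * t * volume (k ∸ 1) n ∣ * seq (log n) w ≤ fromℕ 707 * fromℕ n ^ (k ∸ 1))
    (g-partial-stable w (ℕₚ.m⊔n≤o⇒n≤o w₀ n w≥)) (bound w (ℕₚ.m⊔n≤o⇒m≤o w₀ n w≥))
  where
  open Density (suc i) n
  k : ℕ
  k = suc (suc (suc i))
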